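{- A prime graph with at least $5$ vertices has at least $3$ non-essential vertices if and only if it is not locally equivalent to a graph with two specified vertices $x$ and $y$ consisting of at least two internally-disjoint paths from $x$ to $y$, in which $x$ and $y$ have no common neighbor.
   Context: All graphs are finite and simple. For a vertex $v$ of a graph $G$, $G*v$ is the graph on $V(G)$ with $E(G*v)=E(G)\triangle\{xy: x,y \text{ distinct neighbors of } v\}$ (local complementation); graphs are locally equivalent if one is obtained from the other by a sequence of local complementations. For an edge $vw$, $G\wedge vw := G*v*w*v$. $G/v$ denotes $G\setminus v$ if $v$ is isolated, and otherwise $G\wedge vw\setminus v$ for an arbitrary neighbor $w$ of $v$ (well defined up to local equivalence). A split of a graph is a partition $(A,B)$ of its vertex set with $\min\{|A|,|B|\}\ge 2$ such that for some $A'\subseteq A$, $B'\subseteq B$, vertices $x\in A$, $y\in B$ are adjacent iff $x\in A'$ and $y\in B'$; a graph is prime if it has no split. A vertex $v$ is non-essential if at least two of $G\setminus v$, $G*v\setminus v$, $G/v$ are prime. A graph "consisting of" paths means it is the union of these paths (vertex set and edge set are the unions). -}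

module Defs where

open import Data.Nat using (ℕ; zero; suc)
open import Data.Fin using (Fin; punchIn; _≟_)
open import Data.Bool using (Bool; true; false; _∧_; _xor_; not; if_then_else_)
open import Data.Bool.Properties using (∧-comm)
open import Data.List using (List; []; _∷_; _++_)
open import Data.List.Membership.Propositional using (_∈_)
open import Data.List.Relation.Unary.Unique.Propositional using (Unique)
open import Data.List.Relation.Unary.Linked using (Linked)
open import Data.Product using (Σ; ∃; ∃-syntax; _×_; _,_)
open import Data.Sum using (_⊎_)
open import Function.Bundles using (_⇔_)
open import Relation.Nullary using (¬_; yes; no; does)
open import Relation.Binary.PropositionalEquality using (_≡_; _≢_; refl; sym; cong)

record Graph (n : ℕ) : Set where
  field
    adj    : Fin n → Fin n → Bool
    adj-sym : ∀ x y → adj x y ≡ adj y x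
    adj-irr : ∀ x → adj x x ≡ false
open Graph public

Adj : ∀ {n} → Graph n → Fin n → Fin n → Set
Adj G x y = adj G x y ≡ true

SameGraph : ∀ {n} → Graph n → Graph n → Set
SameGraph G H = ∀ x y → adj G x y ≡ adj H x y

lcAdj : ∀ {n} → Graph n → Fin n → Fin n → Fin n → Bool
lcAdj G v x y = if does (x ≟ y) then false
                else (adj G x y xor (adj G v x ∧ adj G v y))

private
  lc-sym : ∀ {n} (G : Graph n) v x y → lcAdj G v x y ≡ lcAdj G v y x
  lc-sym G v x y with x ≟ y | y ≟ x
  ... | yes _ | yes _ = refl
  ... | yes refl | no ¬p = Data.Empty.⊥-elim (¬p refl)
    where import Data.Empty
  ... | no ¬p | yes refl = Data.Empty.⊥-elim (¬p refl)
    where import Data.Empty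
  ... | no _ | no _ rewrite adj-sym G x y | ∧-comm (adj G v x) (adj G v y) = refl

  lc-irr : ∀ {n} (G : Graph n) v x → lcAdj G v x x ≡ false
  lc-irr G v x with x ≟ x
  ... | yes _ = refl
  ... | no ¬p = Data.Empty.⊥-elim (¬p refl)
    where import Data.Empty

_*_ : ∀ {n} → Graph n → Fin n → Graph n
G * v = record { adj = lcAdj G v ; adj-sym = lc-sym G v ; adj-irr = lc-irr G v }

infixl 7 _*_

-- pivoting  G ∧ vw := G * v * w * v  (used only for edges vw)
pivot : ∀ {n} → Graph n → Fin n → Fin n → Graph n
pivot G v w = G * v * w * v

delete : ∀ {n} → Graph (suc n) → Fin (suc n) → Graph n
delete G v = record
  { adj = λ x y → adj G (punchIn v x) (punchIn v y)
  ; adj-sym = λ x y → adj-sym G (punchIn v x) (punchIn v y)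
  ; adj-irr = λ x → adj-irr G (punchIn v x) }

data LocEq {n} : Graph n → Graph n → Set where
  done : ∀ {G H} → SameGraph G H → LocEq G H
  step : ∀ {G H} (v : Fin n) → LocEq (G * v) H → LocEq G H

Split : ∀ {n} → Graph n → Set
Split {n} G =
  Σ (Fin n → Bool) λ A →
    (∃[ a₁ ] ∃[ a₂ ] a₁ ≢ a₂ × A a₁ ≡ true × A a₂ ≡ true) ×
    (∃[ b₁ ] ∃[ b₂ ] b₁ ≢ b₂ × A b₁ ≡ false × A b₂ ≡ false) ×
    Σ (Fin n → Bool) λ A' → Σ (Fin n → Bool) λ B' →
      (∀ x → A' x ≡ true → A x ≡ true) ×
      (∀ y → B' y ≡ true → A y ≡ false) ×
      (∀ x y → A x ≡ true → A y ≡ false →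
         (Adj G x y ⇔ (A' x ≡ true × B' y ≡ true)))

Prime : ∀ {n} → Graph n → Set
Prime G = ¬ Split G

-- G / v : G \ v if v is isolated, otherwise (G ∧ vw) \ v for a neighbour w.
-- Since G / v is only defined up to local equivalence (which preserves
-- primeness), "G / v is prime" is rendered as: the corresponding
-- representative for some admissible choice of w is prime.

Isolated : ∀ {n} → Graph n → Fin n → Set
Isolated G v = ∀ u → adj G v u ≡ false

ContractPrime : ∀ {n} → Graph (suc n) → Fin (suc n) → Set
ContractPrime G v =
  (Isolated G v × Prime (delete G v)) ⊎
  (∃[ w ] Adj G v w × Prime (delete (pivot G v w) v))

NonEssential : ∀ {n} → Graph n → Fin n → Set
NonEssential {zero} G ()
NonEssential {suc n} G v =
  (Prime (delete G v) × Prime (delete (G * v) v)) ⊎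
  (Prime (delete G v) × ContractPrime G v) ⊎
  (Prime (delete (G * v) v) × ContractPrime G v)

AtLeastThreeNonEssential : ∀ {n} → Graph n → Set
AtLeastThreeNonEssential G =
  ∃[ a ] ∃[ b ] ∃[ c ] a ≢ b × a ≢ c × b ≢ c ×
    NonEssential G a × NonEssential G b × NonEssential G c

pathSeq : ∀ {n} → Fin n → Fin n → List (Fin n) → List (Fin n)
pathSeq x y m = x ∷ (m ++ y ∷ [])

Consecutive : ∀ {n} → Fin n → Fin n → List (Fin n) → Set
Consecutive {n} u v p = ∃[ as ] ∃[ bs ] p ≡ as ++ u ∷ v ∷ bs

IsPath : ∀ {n} → Graph n → List (Fin n) → Set
IsPath H p = Unique p × Linked (Adj H) p

PathUnion : ∀ {n} → Graph n → Fin n → Fin n → Set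
PathUnion {n} H x y =
  x ≢ y ×
  Σ ℕ λ k → (2 Data.Nat.≤ k) ×
  Σ (Fin k → List (Fin n)) λ mid →
    (∀ i → IsPath H (pathSeq x y (mid i))) ×
    (∀ i j → i ≢ j → mid i ≢ mid j × (∀ u → u ∈ mid i → u ∈ mid j → Data.Empty.⊥)) ×
    (∀ u → ∃[ i ] u ∈ pathSeq x y (mid i)) ×
    (∀ u v → Adj H u v → ∃[ i ] (Consecutive u v (pathSeq x y (mid i))
                                 ⊎ Consecutive v u (pathSeq x y (mid i)))) ×
    (∀ z → Adj H x z → Adj H y z → Data.Empty.⊥)
  where import Data.Empty

{-# OPTIONS --safe #-}
module Submission where

-- A graph is studied through its stabilizer space: the maximal isotropic subspace of (F₂²)ⁿ of all vectors whose Z-part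
-- is the adjacency matrix applied to the X-part. Local complementation merely permutes the directions X, Y, Z at every
-- vertex, and the three minors at v correspond to the three directions at v. For a prime graph the space has no nonzero
-- vector of weight at most 2, and the minor at v in direction p has a split with a side of size 2 iff there is a vector of
-- weight 3, a triple, with direction p at v.
--
-- Crossing two splits shows that every essential vertex lies in a triple; by an analogue of Tutte's triangle lemma, an
-- essential vertex sharing a triple with another essential vertex lies in triples of two different directions. Triples of
-- different directions at a vertex meet in exactly two vertices, so triples form chains. If all vertices but x and y are
-- essential, each other vertex v can be given a triple centred at v, and each vertex a direction, such that in some locally
-- equivalent graph the centred triples are the stars; all vertices but x and y then have degree 2, and primality makes the
-- graph a union of paths from x to y. If x and y have a common neighbour v, the split of a minor at v shows that the graph
-- is a cycle up to the edge xy.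
--
-- Conversely, in a union of paths without common neighbours of x and y, every other vertex v has degree 2 and a neighbour
-- of degree 2. Their two stars are triples with different directions at v, so that two minors at v have splits.

open import Defs
open import Data.Nat using (ℕ; zero; suc; _≤_; z≤n; s≤s)
import Data.Nat.Properties as ℕ
open import Data.Fin using (Fin; zero; suc; punchIn; punchOut; _≟_)
import Data.Fin as Fin
import Data.Fin.Properties as Fin
open import Data.Fin.Patterns using (0F; 1F; 2F; 3F; 4F)
open import Data.Fin.Subset.Properties using (anySubset?)
open import Data.Bool using (Bool; true; false; _∧_; _∨_; _xor_; not; if_then_else_)
import Data.Bool.Properties as 𝔹
open import Data.Empty using (⊥; ⊥-elim)
open import Data.Maybe using (Maybe; just; nothing)
import Data.Maybe as Maybe
import Data.Maybe.Properties as Maybe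
open import Data.List using (List; []; _∷_; _++_; length; lookup; filter; map; allFin)
open import Data.List.Properties using (filter-notAll; ∷-injectiveˡ; ∷-injectiveʳ; ∷ʳ-injectiveʳ; ++-assoc)
open import Data.List.Membership.Propositional using (_∈_; _∉_)
open import Data.List.Membership.Propositional.Properties using (∈-filter⁺; ∈-filter⁻; ∈-allFin; ∈-lookup; ∈-∃++; ∈-++⁺ˡ; ∈-++⁺ʳ; ∈-++⁻)
open import Data.List.Relation.Unary.All using (All; []; _∷_)
import Data.List.Relation.Unary.All as All
open import Data.List.Relation.Unary.AllPairs using ([]; _∷_)
open import Data.List.Relation.Unary.Any using (here; there; index; any?)
import Data.List.Relation.Unary.Any as Any
open import Data.List.Relation.Unary.Any.Properties using (lookup-index)
open import Data.List.Relation.Unary.Linked using (Linked; [-]; _∷_)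
open import Data.List.Relation.Unary.Unique.Propositional using (Unique)
open import Data.List.Relation.Unary.Unique.Propositional.Properties using (filter⁺; allFin⁺; ++⁺)
open import Data.Product using (Σ; ∃₂; ∃-syntax; _×_; _,_; proj₁; proj₂)
import Data.Product.Properties as Prod
open import Data.Sum using (_⊎_; inj₁; inj₂; [_,_]′; swap)
import Data.Vec as Vec
import Data.Vec.Properties as Vec
open import Function using (_∘_; id; case_of_)
open import Function.Bundles using (_⇔_; mk⇔; Equivalence)
open import Relation.Nullary using (¬_; Dec; yes; no; does)
open import Relation.Nullary.Decidable using (True; toWitness; _×-dec_; _⊎-dec_; _→-dec_; ¬?; map′; dec-true; dec-false; decidable-stable)
open import Relation.Binary.Definitions using (Tri; tri<; tri≈; tri>)
open import Relation.Binary.PropositionalEquality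
open import Algebra.Bundles using (CommutativeRing)
import Algebra.Properties.Semiring.Sum (CommutativeRing.semiring 𝔹.xor-∧-commutativeRing) as Sum

-- Every normal form in the proof rests on one principle: directions prescribed at some vertices can
-- be made Z-directions by local complementations as soon as no nonzero vector of the space is
-- supported on these vertices and has the prescribed directions there. Most steps therefore
-- prescribe directions and exclude an obstructing vector, usually because isotropy forces it to
-- vanish at one vertex after another until too few remain.
--
-- The obstacle is agreement. Triples centred at different vertices must prescribe the same
-- direction wherever they meet off their centres, so the possible positions of a vertex in a chain
-- are classified and the choices matched case by case. The classification needs six vertices, since
-- it uses two vertices outside a set of four. On five vertices, where any three vertices carry a
-- triple, a path is written down directly.
--
-- Splits, triples and choices of stars are handled under double negation. Nothing is lost, because
-- having three non-essential vertices is decidable.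

variable
  n : ℕ
  A B : Set

-- Double negation and exhaustive finite checks

M : Set → Set
M A = ¬ ¬ A

_>>=_ : M A → (A → M B) → M B
(m >>= f) k = m λ a → f a k

return : A → M A
return a k = k a

excluded-middle : ∀ A → M (Dec A)
excluded-middle A k = k (no λ a → k (yes a))

-- Finiteness of the index set lets double negation pass through the quantifier; this allows a star
-- to be picked at every vertex at once.
choice : {B : Fin n → Set} → (∀ i → M (B i)) → M (∀ i → B i)
choice {zero}  f = return λ ()
choice {suc n} f = do
  b ← f zero
  bs ← choice (f ∘ suc)
  return λ { zero → b ; (suc i) → bs i }

-- Used to prove identities in F₂, F₂² and F₂³ by running through all cases.
dec! : {A : Set} (d : Dec A) → {True d} → A
dec! d {t} = toWitness t

∀ᵇ : {P : Bool → Set} → (∀ b → Dec (P b)) → Dec (∀ b → P b)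
∀ᵇ P? = map′ (λ { (f , t) false → f ; (f , t) true → t }) (λ g → g false , g true) (P? false ×-dec P? true)

-- Pauli operators modulo phase, as (X-part, Z-part) in F₂²

Pauli : Set
Pauli = Bool × Bool

pattern 𝐈 = false , false
pattern 𝐗 = true , false
pattern 𝐘 = true , true
pattern 𝐙 = false , true

∀ᵖ : {P : Pauli → Set} → (∀ p → Dec (P p)) → Dec (∀ p → P p)
∀ᵖ P? = map′ (λ g (s , z) → g s z) (λ g s z → g (s , z)) (∀ᵇ λ s → ∀ᵇ λ z → P? (s , z))

_≟ᵖ_ : (p q : Pauli) → Dec (p ≡ q)
_≟ᵖ_ = Prod.≡-dec 𝔹._≟_ 𝔹._≟_

infixl 6 _⊕_
_⊕_ : Pauli → Pauli → Pauli
(s , z) ⊕ (s' , z') = s xor s' , z xor z'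

-- The symplectic form on F₂²: it is `true` when the two operators anticommute, that is, when they
-- are nonzero and distinct.
ω : Pauli → Pauli → Bool
ω (s , z) (s' , z') = (s ∧ z') xor (z ∧ s')

ω-true⇒≢ : ∀ p q → ω p q ≡ true → p ≢ q
ω-true⇒≢ = dec! (∀ᵖ λ p → ∀ᵖ λ q → (ω p q 𝔹.≟ true) →-dec ¬? (p ≟ᵖ q))

ω-false : ∀ p q → ω p q ≡ false → p ≢ 𝐈 → q ≢ 𝐈 → p ≡ q
ω-false = dec! (∀ᵖ λ p → ∀ᵖ λ q → (ω p q 𝔹.≟ false) →-dec (¬? (p ≟ᵖ 𝐈) →-dec (¬? (q ≟ᵖ 𝐈) →-dec (p ≟ᵖ q))))

ω-true : ∀ p q → p ≢ q → p ≢ 𝐈 → q ≢ 𝐈 → ω p q ≡ true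
ω-true = dec! (∀ᵖ λ p → ∀ᵖ λ q → ¬? (p ≟ᵖ q) →-dec (¬? (p ≟ᵖ 𝐈) →-dec (¬? (q ≟ᵖ 𝐈) →-dec (ω p q 𝔹.≟ true))))

ω-self : ∀ p → ω p p ≡ false
ω-self = dec! (∀ᵖ λ p → ω p p 𝔹.≟ false)

⊕-self : ∀ p → p ⊕ p ≡ 𝐈
⊕-self = dec! (∀ᵖ λ p → (p ⊕ p) ≟ᵖ 𝐈)

⊕≡𝐈⇒≡ : ∀ p q → p ⊕ q ≡ 𝐈 → p ≡ q
⊕≡𝐈⇒≡ = dec! (∀ᵖ λ p → ∀ᵖ λ q → ((p ⊕ q) ≟ᵖ 𝐈) →-dec (p ≟ᵖ q))

⊕-distinct : ∀ p q r → p ≢ 𝐈 → q ≢ 𝐈 → r ≢ 𝐈 → p ≢ q → p ≢ r → q ≢ r → p ⊕ q ⊕ r ≡ 𝐈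
⊕-distinct = dec! (∀ᵖ λ p → ∀ᵖ λ q → ∀ᵖ λ r → ¬? (p ≟ᵖ 𝐈) →-dec (¬? (q ≟ᵖ 𝐈) →-dec (¬? (r ≟ᵖ 𝐈) →-dec
  (¬? (p ≟ᵖ q) →-dec (¬? (p ≟ᵖ r) →-dec (¬? (q ≟ᵖ r) →-dec ((p ⊕ q ⊕ r) ≟ᵖ 𝐈)))))))

S≡false⇒𝐙 : ∀ p → p ≢ 𝐈 → proj₁ p ≡ false → p ≡ 𝐙
S≡false⇒𝐙 = dec! (∀ᵖ λ p → ¬? (p ≟ᵖ 𝐈) →-dec ((proj₁ p 𝔹.≟ false) →-dec (p ≟ᵖ 𝐙)))

≢false⇒≡ : ∀ {b c} → b ≢ false → c ≢ false → b ≡ c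
≢false⇒≡ b≢ c≢ = trans (𝔹.¬-not b≢) (sym (𝔹.¬-not c≢))

true≢false : true ≢ false
true≢false ()

⊕-identityʳ : ∀ p → p ⊕ 𝐈 ≡ p
⊕-identityʳ = dec! (∀ᵖ λ p → (p ⊕ 𝐈) ≟ᵖ p)

-- Sums over F₂

δ : Fin n → Fin n → Bool
δ u v = does (u ≟ v)

δ-refl : (v : Fin n) → δ v v ≡ true
δ-refl v = dec-true (v ≟ v) refl

δ-≢ : {u v : Fin n} → u ≢ v → δ u v ≡ false
δ-≢ {u = u} {v} = dec-false (u ≟ v)

opaque
  sum : (Fin n → Bool) → Bool
  sum = Sum.sum

  sum-cong : {f g : Fin n → Bool} → (∀ u → f u ≡ g u) → sum f ≡ sum g
  sum-cong {f = f} {g} = Sum.sum-cong-≗ {x = f} {y = g}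

  sum-xor : (f g : Fin n → Bool) → sum (λ u → f u xor g u) ≡ sum f xor sum g
  sum-xor = Sum.∑-distrib-+

  ∧-sum : ∀ b (f : Fin n → Bool) → b ∧ sum f ≡ sum λ u → b ∧ f u
  ∧-sum = Sum.*-distribˡ-sum

  sum-comm : (f : Fin n → Fin n → Bool) → sum (λ u → sum λ v → f u v) ≡ sum (λ v → sum λ u → f u v)
  sum-comm = Sum.∑-comm

  sum-zero : (f : Fin n → Bool) → (∀ u → f u ≡ false) → sum f ≡ false
  sum-zero {n = n} f f≡ = trans (sum-cong f≡) (Sum.sum-replicate-zero n)

  sum-extract : (f : Fin n → Bool) (a : Fin n) → sum f ≡ f a xor sum λ u → not (δ a u) ∧ f u
  sum-extract f zero = refl
  sum-extract f (suc a) =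
    trans (cong (f zero xor_) (sum-extract (f ∘ suc) a)) (swap-xor (f zero) (f (suc a)) _)
    where
    swap-xor : ∀ a b c → a xor (b xor c) ≡ b xor (a xor c)
    swap-xor = dec! (∀ᵇ λ a → ∀ᵇ λ b → ∀ᵇ λ c → (a xor (b xor c)) 𝔹.≟ (b xor (a xor c)))

sum-supp₁ : (f : Fin n → Bool) (a : Fin n) → (∀ u → u ≢ a → f u ≡ false) → sum f ≡ f a
sum-supp₁ f a f≡ = trans (sum-extract f a) (trans (cong (f a xor_) (sum-zero _ rest)) (𝔹.xor-identityʳ _))
  where
  rest : ∀ u → not (δ a u) ∧ f u ≡ false
  rest u with a ≟ u
  ... | yes _ = refl
  ... | no a≢u = f≡ u (a≢u ∘ sym)

sum-supp₂ : (f : Fin n → Bool) {a b : Fin n} → a ≢ b → (∀ u → u ≢ a → u ≢ b → f u ≡ false) →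
  sum f ≡ f a xor f b
sum-supp₂ f {a} {b} a≢b f≡ = trans (sum-extract f a) (cong (f a xor_)
    (trans (sum-supp₁ _ b rest) (cong (λ c → not c ∧ f b) (δ-≢ a≢b))))
  where
  rest : ∀ u → u ≢ b → not (δ a u) ∧ f u ≡ false
  rest u u≢b with a ≟ u
  ... | yes _ = refl
  ... | no a≢u = f≡ u (a≢u ∘ sym) u≢b

sum-supp₃ : (f : Fin n → Bool) {a b c : Fin n} → a ≢ b → a ≢ c → b ≢ c →
  (∀ u → u ≢ a → u ≢ b → u ≢ c → f u ≡ false) → sum f ≡ f a xor (f b xor f c)
sum-supp₃ f {a} {b} {c} a≢b a≢c b≢c f≡ = trans (sum-extract f a) (cong (f a xor_)
    (trans (sum-supp₂ _ b≢c rest) (cong₂ (λ d e → (not d ∧ f b) xor (not e ∧ f c)) (δ-≢ a≢b) (δ-≢ a≢c))))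
  where
  rest : ∀ u → u ≢ b → u ≢ c → not (δ a u) ∧ f u ≡ false
  rest u u≢b u≢c with a ≟ u
  ... | yes _ = refl
  ... | no a≢u = f≡ u (a≢u ∘ sym) u≢b u≢c

-- Stabilizer formalism: the graph state of G is the maximal isotropic space of
-- all d whose Z-part is the adjacency matrix applied to the X-part.
Vector : ℕ → Set
Vector n = Fin n → Pauli

S Z : Vector n → Fin n → Bool
S d v = proj₁ (d v)
Z d v = proj₂ (d v)

record L (G : Graph n) (d : Vector n) : Set where
  constructor stabilizes
  field Z≡ : ∀ v → Z d v ≡ sum λ u → S d u ∧ adj G u v
open L public

_⊞_ : Vector n → Vector n → Vector n
(d ⊞ d') v = d v ⊕ d' v

module _ {G : Graph n} where

  L-⊞ : ∀ {d d'} → L G d → L G d' → L G (d ⊞ d')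
  L-⊞ {d} {d'} (stabilizes d∈) (stabilizes d'∈) = stabilizes λ v → begin
    Z d v xor Z d' v                                                  ≡⟨ cong₂ _xor_ (d∈ v) (d'∈ v) ⟩
    sum (λ u → S d u ∧ adj G u v) xor sum (λ u → S d' u ∧ adj G u v)  ≡⟨ sym (sum-xor _ _) ⟩
    sum (λ u → (S d u ∧ adj G u v) xor (S d' u ∧ adj G u v))          ≡⟨ sum-cong (λ u → sym (𝔹.∧-distribʳ-xor (adj G u v) (S d u) (S d' u))) ⟩
    sum (λ u → (S d u xor S d' u) ∧ adj G u v)                        ∎
    where open ≡-Reasoning

  L-cong : ∀ {d d'} → (∀ v → d v ≡ d' v) → L G d → L G d'
  L-cong d≗ d∈ = stabilizes λ v → trans (cong proj₂ (sym (d≗ v))) (trans (Z≡ d∈ v)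
    (sum-cong λ u → cong (λ p → proj₁ p ∧ adj G u v) (d≗ u)))

  -- Once each Z-part is replaced by the adjacency matrix applied to the X-part, the two halves of
  -- the form are the same double sum, by symmetry of the matrix.
  isotropic : ∀ {d d'} → L G d → L G d' → sum (λ v → ω (d v) (d' v)) ≡ false
  isotropic {d} {d'} d∈ d'∈ = begin
    sum (λ v → (S d v ∧ Z d' v) xor (Z d v ∧ S d' v))              ≡⟨ sum-xor (λ v → S d v ∧ Z d' v) _ ⟩
    sum (λ v → S d v ∧ Z d' v) xor sum (λ v → Z d v ∧ S d' v)      ≡⟨ cong₂ _xor_ (expand {d} d'∈) flip ⟩
    Q xor Q                                                        ≡⟨ 𝔹.xor-same Q ⟩
    false                                                          ∎
    where
    open ≡-Reasoning
    Q = sum λ v → sum λ u → S d v ∧ (S d' u ∧ adj G u v)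
    expand : ∀ {d d'} → L G d' → sum (λ v → S d v ∧ Z d' v) ≡ sum (λ v → sum λ u → S d v ∧ (S d' u ∧ adj G u v))
    expand {d} {d'} d'∈ = sum-cong λ v → trans (cong (S d v ∧_) (Z≡ d'∈ v)) (∧-sum (S d v) _)
    swap∧ : ∀ a b c → a ∧ (b ∧ c) ≡ b ∧ (a ∧ c)
    swap∧ = dec! (∀ᵇ λ a → ∀ᵇ λ b → ∀ᵇ λ c → (a ∧ (b ∧ c)) 𝔹.≟ (b ∧ (a ∧ c)))
    flip : sum (λ v → Z d v ∧ S d' v) ≡ Q
    flip = begin
      sum (λ v → Z d v ∧ S d' v)                                 ≡⟨ sum-cong (λ v → 𝔹.∧-comm (Z d v) (S d' v)) ⟩
      sum (λ v → S d' v ∧ Z d v)                                 ≡⟨ expand {d'} d∈ ⟩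
      sum (λ v → sum λ u → S d' v ∧ (S d u ∧ adj G u v))         ≡⟨ sum-comm _ ⟩
      sum (λ u → sum λ v → S d' v ∧ (S d u ∧ adj G u v))         ≡⟨ sum-cong (λ u → sum-cong λ v →
                                                                      trans (swap∧ (S d' v) (S d u) _) (cong (λ e → S d u ∧ (S d' v ∧ e)) (adj-sym G u v))) ⟩
      Q                                                          ∎

  -- The X-part determines a vector of the space; so no nonzero vector consists of Z-directions
  -- only.
  L-S≡0 : ∀ {d} → L G d → (∀ v → S d v ≡ false) → ∀ v → d v ≡ 𝐈
  L-S≡0 d∈ s≡ v = cong₂ _,_ (s≡ v) (trans (Z≡ d∈ v) (sum-zero _ λ u → cong (_∧ adj G u v) (s≡ u)))

-- The stabilizer generator of `v`: X at `v` and Z at its neighbours.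
star : Graph n → Fin n → Vector n
star G v u = δ v u , adj G v u

L-star : (G : Graph n) (v : Fin n) → L G (star G v)
L-star G v = stabilizes λ u → sym (trans (sum-supp₁ _ v λ w w≢v → cong (_∧ adj G w u) (δ-≢ (w≢v ∘ sym)))
                          (cong (_∧ adj G v u) (δ-refl v)))

star-≢𝐈 : (G : Graph n) (x : Fin n) → star G x x ≢ 𝐈
star-≢𝐈 G x eq = true≢false (trans (sym (δ-refl x)) (cong proj₁ eq))

star-off : (G : Graph n) {x u : Fin n} → u ≢ x → adj G x u ≡ false → star G x u ≡ 𝐈
star-off G ux eq = cong₂ _,_ (δ-≢ (ux ∘ sym)) eq

-- Local complementation

sum-δ : (a : Fin n) (f : Fin n → Bool) → sum (λ u → δ a u ∧ f u) ≡ f a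
sum-δ a f = trans (sum-supp₁ _ a λ u u≢a → cong (_∧ f u) (δ-≢ (u≢a ∘ sym))) (cong (_∧ f a) (δ-refl a))

-- Two shears of F₂²: `e` adds the Z-part to the X-part, `m` the X-part to the Z-part. They are
-- never active together, which makes the map an involution.
act : Bool → Bool → Pauli → Pauli
act e m (s , z) = s xor (e ∧ z) , z xor (m ∧ s)

act-involutive : ∀ e m → e ∧ m ≡ false → ∀ p → act e m (act e m p) ≡ p
act-involutive = dec! (∀ᵇ λ e → ∀ᵇ λ m → (e ∧ m 𝔹.≟ false) →-dec ∀ᵖ λ p → act e m (act e m p) ≟ᵖ p)

act-ω : ∀ e m → e ∧ m ≡ false → ∀ p q → ω (act e m p) (act e m q) ≡ ω p q
act-ω = dec! (∀ᵇ λ e → ∀ᵇ λ m → (e ∧ m 𝔹.≟ false) →-dec ∀ᵖ λ p → ∀ᵖ λ q → ω (act e m p) (act e m q) 𝔹.≟ ω p q)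

act-𝐈 : ∀ e m → act e m 𝐈 ≡ 𝐈
act-𝐈 = dec! (∀ᵇ λ e → ∀ᵇ λ m → act e m 𝐈 ≟ᵖ 𝐈)

-- The effect of local complementation at w on the stabilizer component at v:
-- it exchanges Y and Z at w, and X and Y at the neighbours of w.
τ : Graph n → Fin n → Fin n → Pauli → Pauli
τ G w v = act (δ w v) (adj G w v)

δ∧adj : (G : Graph n) (w v : Fin n) → δ w v ∧ adj G w v ≡ false
δ∧adj G w v with w ≟ v
... | yes refl = adj-irr G w
... | no _ = refl

τ-involutive : (G : Graph n) (w v : Fin n) (p : Pauli) → τ G w v (τ G w v p) ≡ p
τ-involutive G w v = act-involutive (δ w v) (adj G w v) (δ∧adj G w v)

lcAdj-≢ : (G : Graph n) (w : Fin n) {x y : Fin n} → x ≢ y →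
  adj (G * w) x y ≡ adj G x y xor (adj G w x ∧ adj G w y)
lcAdj-≢ G w {x} {y} x≢y with x ≟ y
... | yes x≡y = ⊥-elim (x≢y x≡y)
... | no _ = refl

lcAdj-self : (G : Graph n) (w v : Fin n) → adj (G * w) w v ≡ adj G w v
lcAdj-self G w v with w ≟ v
... | yes refl = sym (adj-irr G w)
... | no _ rewrite adj-irr G w = 𝔹.xor-identityʳ _

lc-involutive : (G : Graph n) (w : Fin n) → SameGraph (G * w * w) G
lc-involutive G w x y = case x ≟ y of λ where
    (yes refl) → trans (adj-irr (G * w * w) x) (sym (adj-irr G x))
    (no x≢y) → trans (lcAdj-≢ (G * w) w x≢y) (trans (cong₂ _xor_ (lcAdj-≢ G w x≢y)
      (cong₂ _∧_ (lcAdj-self G w x) (lcAdj-self G w y)))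
      (cancel (adj G x y) _))
  where
  cancel : ∀ a b → (a xor b) xor b ≡ a
  cancel = dec! (∀ᵇ λ a → ∀ᵇ λ b → ((a xor b) xor b) 𝔹.≟ a)

L-same : {G H : Graph n} → SameGraph G H → ∀ {d} → L G d → L H d
L-same G≈H {d} d∈ = stabilizes λ v → trans (Z≡ d∈ v) (sum-cong λ u → cong (S d u ∧_) (G≈H u v))

-- The sum over the new adjacency splits into four: the old row, the contribution of the
-- complemented pairs, a term at `x = u` that removes this contribution from the diagonal, and a
-- term at `x = w` for the changed X-part.
L-τ : (G : Graph n) (w : Fin n) → ∀ {d} → L G d → L (G * w) (λ v → τ G w v (d v))
L-τ G w {d} (stabilizes d∈) = stabilizes λ u → let nᵤ = adj G w u in sym (begin
  sum (λ x → (S d x xor (δ w x ∧ Z d x)) ∧ adj (G * w) x u)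
    ≡⟨ sum-cong (pointwise u) ⟩
  sum (λ x → ((S d x ∧ adj G x u) xor (nᵤ ∧ (S d x ∧ adj G x w))) xor
             ((δ u x ∧ (S d x ∧ nᵤ)) xor (δ w x ∧ (Z d x ∧ nᵤ))))
    ≡⟨ trans (sum-xor _ _) (cong₂ _xor_ (sum-xor _ _) (sum-xor _ _)) ⟩
  (sum (λ x → S d x ∧ adj G x u) xor sum (λ x → nᵤ ∧ (S d x ∧ adj G x w))) xor
  (sum (λ x → δ u x ∧ (S d x ∧ nᵤ)) xor sum (λ x → δ w x ∧ (Z d x ∧ nᵤ)))
    ≡⟨ cong₂ _xor_ (cong₂ _xor_ (sym (d∈ u)) (trans (sym (∧-sum nᵤ _)) (cong (nᵤ ∧_) (sym (d∈ w)))))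
                   (cong₂ _xor_ (sum-δ u _) (sum-δ w _)) ⟩
  (Z d u xor (nᵤ ∧ Z d w)) xor ((S d u ∧ nᵤ) xor (Z d w ∧ nᵤ))
    ≡⟨ collect (Z d u) nᵤ (Z d w) (S d u) ⟩
  Z d u xor (nᵤ ∧ S d u) ∎)
  where
  open ≡-Reasoning
  collect : ∀ a b c e → (a xor (b ∧ c)) xor ((e ∧ b) xor (c ∧ b)) ≡ a xor (b ∧ e)
  collect = dec! (∀ᵇ λ a → ∀ᵇ λ b → ∀ᵇ λ c → ∀ᵇ λ e →
    ((a xor (b ∧ c)) xor ((e ∧ b) xor (c ∧ b))) 𝔹.≟ (a xor (b ∧ e)))
  diagonal : ∀ s δ z m → δ ∧ m ≡ false →
    (s xor (δ ∧ z)) ∧ false ≡ ((s ∧ false) xor (m ∧ (s ∧ m))) xor ((s ∧ m) xor (δ ∧ (z ∧ m)))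
  diagonal = dec! (∀ᵇ λ s → ∀ᵇ λ δ → ∀ᵇ λ z → ∀ᵇ λ m → (δ ∧ m 𝔹.≟ false) →-dec
    (((s xor (δ ∧ z)) ∧ false) 𝔹.≟ (((s ∧ false) xor (m ∧ (s ∧ m))) xor ((s ∧ m) xor (δ ∧ (z ∧ m))))))
  generic : ∀ s z a m k →
    (s xor false) ∧ (a xor (k ∧ m)) ≡ ((s ∧ a) xor (m ∧ (s ∧ k))) xor (false xor false)
  generic = dec! (∀ᵇ λ s → ∀ᵇ λ z → ∀ᵇ λ a → ∀ᵇ λ m → ∀ᵇ λ k →
    ((s xor false) ∧ (a xor (k ∧ m))) 𝔹.≟ (((s ∧ a) xor (m ∧ (s ∧ k))) xor (false xor false)))
  centre : ∀ s z m → (s xor z) ∧ m ≡ ((s ∧ m) xor (m ∧ (s ∧ false))) xor (z ∧ m)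
  centre = dec! (∀ᵇ λ s → ∀ᵇ λ z → ∀ᵇ λ m → ((s xor z) ∧ m) 𝔹.≟ (((s ∧ m) xor (m ∧ (s ∧ false))) xor (z ∧ m)))
  pointwise : ∀ u x → (S d x xor (δ w x ∧ Z d x)) ∧ adj (G * w) x u ≡
    ((S d x ∧ adj G x u) xor (adj G w u ∧ (S d x ∧ adj G x w))) xor
    ((δ u x ∧ (S d x ∧ adj G w u)) xor (δ w x ∧ (Z d x ∧ adj G w u)))
  pointwise u x with u ≟ x
  ... | yes refl rewrite adj-irr (G * w) u | adj-irr G u | adj-sym G u w =
    diagonal (S d u) (δ w u) (Z d u) (adj G w u) (δ∧adj G w u)
  ... | no u≢x rewrite lcAdj-≢ G w (u≢x ∘ sym) with w ≟ x
  ...   | yes refl rewrite adj-irr G w | 𝔹.xor-identityʳ (adj G w u) = centre (S d w) (Z d w) (adj G w u)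
  ...   | no _ rewrite adj-sym G x w = generic (S d x) (Z d x) (adj G x u) (adj G w u) (adj G w x)

-- Sequences of local complementations and prescribed directions

infixl 7 _⋆_
_⋆_ : Graph n → List (Fin n) → Graph n
G ⋆ [] = G
G ⋆ (u ∷ us) = (G * u) ⋆ us

τ* : Graph n → List (Fin n) → Fin n → Pauli → Pauli
τ* G [] v p = p
τ* G (u ∷ us) v p = τ* (G * u) us v (τ G u v p)

τ*⁻¹ : Graph n → List (Fin n) → Fin n → Pauli → Pauli
τ*⁻¹ G [] v p = p
τ*⁻¹ G (u ∷ us) v p = τ G u v (τ*⁻¹ (G * u) us v p)

τ*-τ*⁻¹ : (G : Graph n) (us : List (Fin n)) (v : Fin n) (p : Pauli) → τ* G us v (τ*⁻¹ G us v p) ≡ p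
τ*-τ*⁻¹ G [] v p = refl
τ*-τ*⁻¹ G (u ∷ us) v p = trans (cong (τ* (G * u) us v) (τ-involutive G u v _)) (τ*-τ*⁻¹ (G * u) us v p)

τ*⁻¹-τ* : (G : Graph n) (us : List (Fin n)) (v : Fin n) (p : Pauli) → τ*⁻¹ G us v (τ* G us v p) ≡ p
τ*⁻¹-τ* G [] v p = refl
τ*⁻¹-τ* G (u ∷ us) v p = trans (cong (τ G u v) (τ*⁻¹-τ* (G * u) us v _)) (τ-involutive G u v p)

τ*-injective : (G : Graph n) (us : List (Fin n)) (v : Fin n) {p q : Pauli} → τ* G us v p ≡ τ* G us v q → p ≡ q
τ*-injective G us v eq = trans (sym (τ*⁻¹-τ* G us v _)) (trans (cong (τ*⁻¹ G us v) eq) (τ*⁻¹-τ* G us v _))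

τ*-𝐈 : (G : Graph n) (us : List (Fin n)) (v : Fin n) → τ* G us v 𝐈 ≡ 𝐈
τ*-𝐈 G [] v = refl
τ*-𝐈 G (u ∷ us) v = trans (cong (τ* (G * u) us v) (act-𝐈 (δ u v) (adj G u v))) (τ*-𝐈 (G * u) us v)

τ*-ω : (G : Graph n) (us : List (Fin n)) (v : Fin n) (p q : Pauli) → ω (τ* G us v p) (τ* G us v q) ≡ ω p q
τ*-ω G [] v p q = refl
τ*-ω G (u ∷ us) v p q = trans (τ*-ω (G * u) us v _ _) (act-ω (δ u v) (adj G u v) (δ∧adj G u v) p q)

L-τ* : (G : Graph n) (us : List (Fin n)) → ∀ {d} → L G d → L (G ⋆ us) (λ v → τ* G us v (d v))
L-τ* G [] d∈ = d∈
L-τ* G (u ∷ us) d∈ = L-τ* (G * u) us (L-τ G u d∈)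

L-τ⁻¹ : (G : Graph n) (u : Fin n) → ∀ {d} → L (G * u) d → L G (λ v → τ G u v (d v))
L-τ⁻¹ G u {d} d∈ = L-same (lc-involutive G u)
  (L-cong (λ v → cong (λ m → act (δ u v) m (d v)) (lcAdj-self G u v)) (L-τ (G * u) u d∈))

L-τ*⁻¹ : (G : Graph n) (us : List (Fin n)) → ∀ {d} → L (G ⋆ us) d → L G (λ v → τ*⁻¹ G us v (d v))
L-τ*⁻¹ G [] d∈ = d∈
L-τ*⁻¹ G (u ∷ us) d∈ = L-τ⁻¹ G u (L-τ*⁻¹ (G * u) us d∈)

τ-𝐙 : (G : Graph n) {w v : Fin n} → w ≢ v → τ G w v 𝐙 ≡ 𝐙
τ-𝐙 G {w} {v} w≢v rewrite δ-≢ w≢v | 𝔹.∧-zeroʳ (adj G w v) = refl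

-- Where `ζ` is `nothing` the direction stays free and an obstruction has to vanish. The condition
-- is necessary: turning all prescribed directions into Z would turn an obstruction into a vector
-- without X-part.
NoObstruction : Graph n → (Fin n → Maybe Pauli) → Set
NoObstruction G ζ = ∀ d → L G d → (∀ v → d v ≡ 𝐈 ⊎ just (d v) ≡ ζ v) → ∀ v → d v ≡ 𝐈

-- The last clause forbids complementation at a vertex already prescribed Z. It lets `cut-transport`
-- keep a split of the graph without `v` while the other vertices are rotated.
Rotation : Graph n → (Fin n → Maybe Pauli) → Set
Rotation G ζ = ∃[ us ] (∀ v {p} → ζ v ≡ just p → τ* G us v p ≡ 𝐙) × (∀ {u} → u ∈ us → ζ u ≢ just 𝐙)

_≟ᵐ_ : (p q : Maybe Pauli) → Dec (p ≡ q)
_≟ᵐ_ = Maybe.≡-dec _≟ᵖ_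

module _ (G : Graph n) (ζ : Fin n → Maybe Pauli) (u : Fin n) where

  rotate : Fin n → Maybe Pauli
  rotate v = Maybe.map (τ G u v) (ζ v)

  rotate-≢𝐈 : (∀ v → ζ v ≢ just 𝐈) → ∀ v → rotate v ≢ just 𝐈
  rotate-≢𝐈 ζ≢𝐈 v eq with ζ v in eq'
  ... | just p = ζ≢𝐈 v (trans eq' (cong just
      (trans (sym (τ-involutive G u v p)) (trans (cong (τ G u v) (Maybe.just-injective eq)) (act-𝐈 (δ u v) (adj G u v))))))

  rotate-NoObstruction : NoObstruction G ζ → NoObstruction (G * u) rotate
  rotate-NoObstruction noObs d d∈ on v =
    trans (sym (τ-involutive G u v (d v))) (trans (cong (τ G u v) (noObs _ (L-τ⁻¹ G u d∈) on' v)) (act-𝐈 (δ u v) (adj G u v)))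
    where
    on' : ∀ v → τ G u v (d v) ≡ 𝐈 ⊎ just (τ G u v (d v)) ≡ ζ v
    on' v with on v
    ... | inj₁ d≡ = inj₁ (trans (cong (τ G u v) d≡) (act-𝐈 (δ u v) (adj G u v)))
    ... | inj₂ d≡ with ζ v
    ...   | just p = inj₂ (cong just (trans (cong (τ G u v) (Maybe.just-injective d≡)) (τ-involutive G u v p)))

  unrotate : ζ u ≢ just 𝐙 → Rotation (G * u) rotate → Rotation G ζ
  unrotate ζᵤ≢𝐙 (us , to𝐙 , avoid) = u ∷ us , (λ v eq → to𝐙 v (cong (Maybe.map _) eq)) , avoid'
    where
    avoid' : ∀ {w} → w ∈ u ∷ us → ζ w ≢ just 𝐙
    avoid' (here refl) = ζᵤ≢𝐙
    avoid' {w} (there w∈) ζw≡𝐙 = case u ≟ w of λ where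
      (yes refl) → ζᵤ≢𝐙 ζw≡𝐙
      (no u≢w) → avoid w∈ (trans (cong (Maybe.map (τ G u w)) ζw≡𝐙) (cong just (τ-𝐙 G u≢w)))

  Settled : Maybe Pauli → Set
  Settled t = t ≡ nothing ⊎ t ≡ just 𝐙

  rotate-Settled : ∀ {v} → u ≢ v → Settled (ζ v) → Settled (rotate v)
  rotate-Settled u≢v (inj₁ eq) = inj₁ (cong (Maybe.map _) eq)
  rotate-Settled u≢v (inj₂ eq) = inj₂ (trans (cong (Maybe.map _) eq) (cong just (τ-𝐙 G u≢v)))

-- Each b with prescribed type X or Y is repaired by local complementation at b, preceded if the type
-- is X by local complementation at a neighbour not yet fixed; if there is none, star b is an obstruction.
rotation′ : (bs : List (Fin n)) (G : Graph n) (ζ : Fin n → Maybe Pauli) → (∀ v → ζ v ≢ just 𝐈) →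
  NoObstruction G ζ → (∀ v → v ∉ bs → ζ v ≡ nothing ⊎ ζ v ≡ just 𝐙) → Rotation G ζ
rotation′ [] G ζ ζ≢𝐈 noObs settled = [] , go , λ ()
  where
  go : ∀ v {p} → ζ v ≡ just p → p ≡ 𝐙
  go v eq with settled v (λ ())
  ... | inj₁ eq' = case trans (sym eq') eq of λ where ()
  ... | inj₂ eq' = Maybe.just-injective (trans (sym eq) eq')
rotation′ {n} (b ∷ bs) G ζ ζ≢𝐈 noObs settled = head (ζ b) refl
  where
  others : ∀ {v} → b ≢ v → v ∉ bs → v ∉ b ∷ bs
  others b≢v v∉ (here v≡b) = b≢v (sym v≡b)
  others b≢v v∉ (there v∈) = v∉ v∈
  drop : ζ b ≡ nothing ⊎ ζ b ≡ just 𝐙 → Rotation G ζ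
  drop ok = rotation′ bs G ζ ζ≢𝐈 noObs λ v v∉ → case b ≟ v of λ where
    (yes refl) → ok
    (no b≢v) → settled v (others b≢v v∉)
  head : ∀ t → ζ b ≡ t → Rotation G ζ
  head nothing eq = drop (inj₁ eq)
  head (just 𝐈) eq = ⊥-elim (ζ≢𝐈 b eq)
  head (just 𝐙) eq = drop (inj₂ eq)
  head (just 𝐘) eq = unrotate G ζ b (λ eq' → case trans (sym eq) eq' of λ ())
    (rotation′ bs (G * b) (rotate G ζ b) (rotate-≢𝐈 G ζ b ζ≢𝐈) (rotate-NoObstruction G ζ b noObs) settled')
    where
    settled' : ∀ v → v ∉ bs → rotate G ζ b v ≡ nothing ⊎ rotate G ζ b v ≡ just 𝐙
    settled' v v∉ = case b ≟ v of λ where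
      (yes refl) → inj₂ (trans (cong (Maybe.map _) eq) (cong just (cong₂ (λ e m → act e m 𝐘) (δ-refl b) (adj-irr G b))))
      (no b≢v) → rotate-Settled G ζ b b≢v (settled v (others b≢v v∉))
  head (just 𝐗) eq with Fin.any? (λ u → (adj G b u 𝔹.≟ true) ×-dec ¬? (ζ u ≟ᵐ just 𝐙))
  ... | no none = case noObs (star G b) (L-star G b) onζ b of λ eq' → case trans (sym (δ-refl b)) (cong proj₁ eq') of λ ()
    where
    onζ : ∀ v → star G b v ≡ 𝐈 ⊎ just (star G b v) ≡ ζ v
    onζ v with b ≟ v | adj G b v in eq'
    ... | yes refl | _ rewrite trans (sym eq') (adj-irr G b) = inj₂ (sym eq)
    ... | no _ | false = inj₁ refl
    ... | no _ | true with ζ v ≟ᵐ just 𝐙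
    ...   | yes ok = inj₂ (sym ok)
    ...   | no bad = ⊥-elim (none (v , eq' , bad))
  ... | yes (u , bu , ζᵤ≢𝐙) =
    unrotate G ζ u ζᵤ≢𝐙 (unrotate G₁ ζ₁ b (λ eq' → case trans (sym ζ₁b) eq' of λ ())
      (rotation′ bs (G₁ * b) (rotate G₁ ζ₁ b) (rotate-≢𝐈 G₁ ζ₁ b (rotate-≢𝐈 G ζ u ζ≢𝐈))
        (rotate-NoObstruction G₁ ζ₁ b (rotate-NoObstruction G ζ u noObs)) settled'))
    where
    G₁ = G * u
    ζ₁ = rotate G ζ u
    u≢b : u ≢ b
    u≢b refl = case trans (sym (adj-irr G u)) bu of λ ()
    ζ₁b : ζ₁ b ≡ just 𝐘
    ζ₁b = trans (cong (Maybe.map _) eq) (cong just (cong₂ (λ e m → act e m 𝐗) (δ-≢ u≢b) (trans (adj-sym G u b) bu)))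
    settled' : ∀ v → v ∉ bs → rotate G₁ ζ₁ b v ≡ nothing ⊎ rotate G₁ ζ₁ b v ≡ just 𝐙
    settled' v v∉ = case b ≟ v of λ where
      (yes refl) → inj₂ (trans (cong (Maybe.map _) ζ₁b) (cong just (cong₂ (λ e m → act e m 𝐘) (δ-refl b) (adj-irr G₁ b))))
      (no b≢v) → rotate-Settled G₁ ζ₁ b b≢v (case u ≟ v of λ where
        (no u≢v) → rotate-Settled G ζ u u≢v (settled v (others b≢v v∉))
        (yes refl) → [ (λ eq' → inj₁ (cong (Maybe.map _) eq')) , (λ eq' → ⊥-elim (ζᵤ≢𝐙 eq')) ]′ (settled u (others b≢v v∉)))

opaque
  rotation : (G : Graph n) (ζ : Fin n → Maybe Pauli) → (∀ v → ζ v ≢ just 𝐈) → NoObstruction G ζ → Rotation G ζ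
  rotation G ζ ζ≢𝐈 noObs = rotation′ (allFin _) G ζ ζ≢𝐈 noObs λ v v∉ → ⊥-elim (v∉ (∈-allFin v))

-- Cuts

_∈?_ : (u : Fin n) (xs : List (Fin n)) → Dec (u ∈ xs)
u ∈? xs = any? (u ≟_) xs

fresh : (xs : List (Fin n)) → suc (length xs) ≤ n → ∃[ u ] u ∉ xs
fresh {n} xs xs<n with Fin.any? (λ u → ¬? (u ∈? xs))
... | yes found = found
... | no none = ⊥-elim (ℕ.<⇒≱ xs<n (Fin.injective⇒≤ {f = λ u → index (all u)} λ {u} {v} eq →
    trans (lookup-index (all u)) (trans (cong (lookup xs) eq) (sym (lookup-index (all v))))))
  where
  all : ∀ u → u ∈ xs
  all u = decidable-stable (u ∈? xs) λ u∉ → none (u , u∉)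

Two : (Fin n → Set) → Set
Two P = ∃₂ λ a b → a ≢ b × P a × P b

two-fresh : (xs : List (Fin n)) → suc (suc (length xs)) ≤ n → Two (_∉ xs)
two-fresh xs le =
  let u , u∉ = fresh xs (ℕ.≤-trans (ℕ.n≤1+n _) le)
      v , v∉ = fresh (u ∷ xs) le
  in u , v , (λ u≡v → v∉ (here (sym u≡v))) , u∉ , v∉ ∘ there

pigeonhole : {a b c x y : A} → a ≢ b → a ≢ c → b ≢ c → a ≡ x ⊎ a ≡ y → b ≡ x ⊎ b ≡ y → c ≡ x ⊎ c ≡ y → ⊥
pigeonhole a≢b _ _ (inj₁ p) (inj₁ q) _ = a≢b (trans p (sym q))
pigeonhole a≢b _ _ (inj₂ p) (inj₂ q) _ = a≢b (trans p (sym q))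
pigeonhole _ a≢c _ (inj₁ p) (inj₂ q) (inj₁ r) = a≢c (trans p (sym r))
pigeonhole _ _ b≢c (inj₁ p) (inj₂ q) (inj₂ r) = b≢c (trans q (sym r))
pigeonhole _ _ b≢c (inj₂ p) (inj₁ q) (inj₁ r) = b≢c (trans q (sym r))
pigeonhole _ a≢c _ (inj₂ p) (inj₁ q) (inj₂ r) = a≢c (trans p (sym r))

two-map : {P Q : Fin n → Set} → (∀ {u} → P u → Q u) → Two P → Two Q
two-map f (a , b , a≢b , pa , pb) = a , b , a≢b , f pa , f pb

-- A split of the subgraph of G induced on the complement of E.
record Cut (G : Graph n) (E : Fin n → Set) : Set where
  constructor cut
  field
    side  : Fin n → Bool
    left  : Two λ u → ¬ E u × side u ≡ true
    right : Two λ u → ¬ E u × side u ≡ false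
    α β   : Fin n → Bool
    rank1 : ∀ {x y} → ¬ E x → ¬ E y → side x ≡ true → side y ≡ false → adj G x y ≡ α x ∧ β y

∅ : Fin n → Set
∅ _ = ⊥

bool-⇔ : ∀ {a b c} → a ≡ true ⇔ (b ≡ true × c ≡ true) → a ≡ b ∧ c
bool-⇔ {true} {b} {c} e with Equivalence.to e refl
... | refl , refl = refl
bool-⇔ {false} {false} {c} e = refl
bool-⇔ {false} {true} {false} e = refl
bool-⇔ {false} {true} {true} e = Equivalence.from e (refl , refl)

∧-true : ∀ a b → a ∧ b ≡ true → a ≡ true × b ≡ true
∧-true true true _ = refl , refl

cut⇒split : {G : Graph n} → Cut G ∅ → Split G
cut⇒split c = side ,
    two-split left , two-split right ,
    (λ x → side x ∧ α x) , (λ y → not (side y) ∧ β y) , (λ x → proj₁ ∘ ∧-true (side x) (α x)) ,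
    (λ y → trans (sym (𝔹.not-involutive (side y))) ∘ cong not ∘ proj₁ ∘ ∧-true (not (side y)) (β y)) ,
    λ x y sx sy → mk⇔
      (λ xy → let αx , βy = ∧-true (α x) (β y) (trans (sym (rank1 id id sx sy)) xy)
              in cong₂ _∧_ sx αx , cong₂ (λ a b → not a ∧ b) sy βy)
      (λ (αx , βy) → trans (rank1 id id sx sy) (cong₂ _∧_ (proj₂ (∧-true (side x) (α x) αx)) (proj₂ (∧-true (not (side y)) (β y) βy))))
  where
  open Cut c
  two-split : ∀ {b} → Two (λ u → ¬ ⊥ × side u ≡ b) → ∃[ a₁ ] ∃[ a₂ ] a₁ ≢ a₂ × side a₁ ≡ b × side a₂ ≡ b
  two-split (a , b , a≢b , (_ , sa) , (_ , sb)) = a , b , a≢b , sa , sb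

split⇒cut : {G : Graph n} → Split G → Cut G ∅
split⇒cut (A , (a , b , a≢b , sa , sb) , (c , d , c≢d , sc , sd) , A' , B' , _ , _ , iff) =
  cut A (a , b , a≢b , (id , sa) , (id , sb)) (c , d , c≢d , (id , sc) , (id , sd)) A' B' λ _ _ sx sy → bool-⇔ (iff _ _ sx sy)

prime⇒no-cut : {G : Graph n} → Prime G → ¬ Cut G ∅
prime⇒no-cut prime = prime ∘ cut⇒split

cut⇒split-delete : {G : Graph (suc n)} {v : Fin (suc n)} → Cut G (_≡ v) → Split (delete G v)
cut⇒split-delete {G = G} {v} c =
    side ∘ in′ , two-out left , two-out right ,
    (λ x → side (in′ x) ∧ α (in′ x)) , (λ y → not (side (in′ y)) ∧ β (in′ y)) , (λ x → proj₁ ∘ ∧-true (side (in′ x)) (α (in′ x))) ,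
    (λ y → trans (sym (𝔹.not-involutive (side (in′ y)))) ∘ cong not ∘ proj₁ ∘ ∧-true (not (side (in′ y))) (β (in′ y))) ,
    λ x y sx sy → let eq = rank1 (Fin.punchInᵢ≢i v x) (Fin.punchInᵢ≢i v y) sx sy in mk⇔
      (λ xy → let αx , βy = ∧-true (α (in′ x)) (β (in′ y)) (trans (sym eq) xy)
              in cong₂ _∧_ sx αx , cong₂ (λ a b → not a ∧ b) sy βy)
      (λ (αx , βy) → trans eq (cong₂ _∧_ (proj₂ (∧-true (side (in′ x)) (α (in′ x)) αx)) (proj₂ (∧-true (not (side (in′ y))) (β (in′ y)) βy))))
  where
  open Cut c
  in′ = punchIn v
  two-out : ∀ {b} → Two (λ u → u ≢ v × side u ≡ b) → ∃[ a₁ ] ∃[ a₂ ] a₁ ≢ a₂ × side (in′ a₁) ≡ b × side (in′ a₂) ≡ b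
  two-out (a , b , a≢b , (a≢v , sa) , (b≢v , sb)) =
    punchOut (a≢v ∘ sym) , punchOut (b≢v ∘ sym) , a≢b ∘ Fin.punchOut-injective (a≢v ∘ sym) (b≢v ∘ sym) ,
    trans (cong side (Fin.punchIn-punchOut _)) sa , trans (cong side (Fin.punchIn-punchOut _)) sb

extend : Fin (suc n) → (Fin n → Bool) → Fin (suc n) → Bool
extend v f u with v ≟ u
... | yes _ = false
... | no v≢u = f (punchOut v≢u)

extend-punchIn : (v : Fin (suc n)) (f : Fin n → Bool) (i : Fin n) → extend v f (punchIn v i) ≡ f i
extend-punchIn v f i with v ≟ punchIn v i
... | yes eq = ⊥-elim (Fin.punchInᵢ≢i v i (sym eq))
... | no v≢ = cong f (trans (Fin.punchOut-cong v refl) (Fin.punchOut-punchIn v))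

split-delete⇒cut : {G : Graph (suc n)} {v : Fin (suc n)} → Split (delete G v) → Cut G (_≡ v)
split-delete⇒cut {G = G} {v} (A , left , right , A' , B' , _ , _ , iff) =
  cut (extend v A) (two-in left) (two-in right) (extend v A') (extend v B') λ {x} {y} → rank x y
  where
  two-in : ∀ {b} → ∃[ a₁ ] ∃[ a₂ ] a₁ ≢ a₂ × A a₁ ≡ b × A a₂ ≡ b → Two (λ u → u ≢ v × extend v A u ≡ b)
  two-in (a , b , a≢b , sa , sb) =
    punchIn v a , punchIn v b , a≢b ∘ Fin.punchIn-injective v a b ,
    (Fin.punchInᵢ≢i v a , trans (extend-punchIn v A a) sa) ,
    (Fin.punchInᵢ≢i v b , trans (extend-punchIn v A b) sb)
  rank : ∀ x y → x ≢ v → y ≢ v → extend v A x ≡ true → extend v A y ≡ false →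
    adj G x y ≡ extend v A' x ∧ extend v B' y
  rank x y x≢v y≢v sx sy
    rewrite sym (Fin.punchIn-punchOut (x≢v ∘ sym)) | sym (Fin.punchIn-punchOut (y≢v ∘ sym))
          | extend-punchIn v A (punchOut (x≢v ∘ sym)) | extend-punchIn v A (punchOut (y≢v ∘ sym))
          | extend-punchIn v A' (punchOut (x≢v ∘ sym)) | extend-punchIn v B' (punchOut (y≢v ∘ sym))
    = bool-⇔ (iff _ _ sx sy)

cut-same : {G H : Graph n} {E : Fin n → Set} → SameGraph G H → Cut G E → Cut H E
cut-same G≈H (cut A l r α β rk) = cut A l r α β λ ex ey sx sy → trans (sym (G≈H _ _)) (rk ex ey sx sy)

cut-flip : {G : Graph n} {E : Fin n → Set} → Cut G E → Cut G E
cut-flip {G = G} (cut A l r α β rk) = cut (not ∘ A) (two-map neg r) (two-map neg l) β α λ {x} {y} ex ey sx sy →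
    trans (adj-sym G x y) (trans (rk ey ex (unneg {A y} sy) (unneg {A x} sx)) (𝔹.∧-comm (α y) (β x)))
  where
  neg : ∀ {P : Set} {a b} → P × a ≡ b → P × not a ≡ not b
  neg (p , eq) = p , cong not eq
  unneg : ∀ {a b} → not a ≡ b → a ≡ not b
  unneg {a} eq = trans (sym (𝔹.not-involutive a)) (cong not eq)

rank1ᵀ : {G : Graph n} {E : Fin n → Set} (k : Cut G E) → let open Cut k in
  ∀ {x y} → ¬ E x → ¬ E y → side x ≡ false → side y ≡ true → adj G x y ≡ β x ∧ α y
rank1ᵀ {G = G} k {x} {y} ex ey sx sy = trans (adj-sym G x y) (trans (Cut.rank1 k ey ex sy sx) (𝔹.∧-comm (Cut.α k y) (Cut.β k x)))

orient : {G : Graph n} {E : Fin n → Set} (x y : Fin n) → ((k : Cut G E) → Cut.side k x ≡ true → Cut.side k y ≡ true → ⊥) → Cut G E →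
  Σ (Cut G E) λ k → Cut.side k x ≡ true × Cut.side k y ≡ false
orient x y together k = by-side (Cut.side k x) (Cut.side k y) refl refl
  where
  by-side : ∀ b b' → Cut.side k x ≡ b → Cut.side k y ≡ b' → Σ (Cut _ _) λ k → Cut.side k x ≡ true × Cut.side k y ≡ false
  by-side true true sx sy = ⊥-elim (together k sx sy)
  by-side false false sx sy = ⊥-elim (together (cut-flip k) (cong not sx) (cong not sy))
  by-side true false sx sy = k , sx , sy
  by-side false true sx sy = cut-flip k , cong not sx , cong not sy

-- Complementation at `u` adds to the rows on the side of `u` multiples of the row of `u`, which
-- across the cut is itself a multiple of `β`; hence only `α` changes. For `u` on the other side
-- only `β` changes.
cut-lc : {G : Graph n} {E : Fin n → Set} (u : Fin n) → ¬ E u → Cut G E → Cut (G * u) E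
cut-lc {G = G} {E} u u∉E (cut A l r α β rk) = by-side (A u) refl
  where
  row : ∀ a b c d → (a ∧ b) xor (c ∧ (d ∧ b)) ≡ (a xor (c ∧ d)) ∧ b
  row = dec! (∀ᵇ λ a → ∀ᵇ λ b → ∀ᵇ λ c → ∀ᵇ λ d → ((a ∧ b) xor (c ∧ (d ∧ b))) 𝔹.≟ ((a xor (c ∧ d)) ∧ b))
  col : ∀ a b c d → (a ∧ b) xor ((a ∧ d) ∧ c) ≡ a ∧ (b xor (c ∧ d))
  col = dec! (∀ᵇ λ a → ∀ᵇ λ b → ∀ᵇ λ c → ∀ᵇ λ d → ((a ∧ b) xor ((a ∧ d) ∧ c)) 𝔹.≟ (a ∧ (b xor (c ∧ d))))
  x≢y : ∀ {x y} → A x ≡ true → A y ≡ false → x ≢ y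
  x≢y sx sy refl = true≢false (trans (sym sx) sy)
  by-side : ∀ b → A u ≡ b → Cut (G * u) E
  by-side true su = cut A l r (λ x → α x xor (adj G u x ∧ α u)) β λ {x} {y} ex ey sx sy →
    trans (lcAdj-≢ G u (x≢y sx sy))
      (trans (cong₂ (λ a b → a xor (adj G u x ∧ b)) (rk ex ey sx sy) (rk u∉E ey su sy)) (row (α x) (β y) (adj G u x) (α u)))
  by-side false su = cut A l r α (λ y → β y xor (adj G u y ∧ β u)) λ {x} {y} ex ey sx sy →
    trans (lcAdj-≢ G u (x≢y sx sy))
      (trans (cong₂ (λ a b → a xor (b ∧ adj G u y)) (rk ex ey sx sy) (trans (adj-sym G u x) (rk ex u∉E sx su)))
        (col (α x) (β y) (adj G u y) (β u)))

cut-⋆ : {E : Fin n → Set} (us : List (Fin n)) {G : Graph n} → (∀ {u} → u ∈ us → ¬ E u) → Cut G E → Cut (G ⋆ us) E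
cut-⋆ [] _ c = c
cut-⋆ (u ∷ us) out c = cut-⋆ us (out ∘ there) (cut-lc u (out (here refl)) c)

prime-lc : {G : Graph n} (u : Fin n) → Prime G → Prime (G * u)
prime-lc {G = G} u prime s =
  prime⇒no-cut {G = G} prime (cut-same (lc-involutive G u) (cut-lc {G = G * u} u id (split⇒cut s)))

prime-⋆ : (us : List (Fin n)) {G : Graph n} → Prime G → Prime (G ⋆ us)
prime-⋆ [] prime = prime
prime-⋆ (u ∷ us) {G} prime = prime-⋆ us {G * u} (prime-lc {G = G} u prime)

-- The X-part is the pairing with the Z-direction, so the choice of Z-directions determines the
-- graph: the star of `x`, carried from one graph to the other, still has X-part at `x` alone and an
-- unchanged Z-part off `x`, so it is the star of `x` there.
same-frame⇒same-graph : (G : Graph n) (us ws : List (Fin n)) (ζ : Fin n → Pauli) →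
  (∀ v → τ* G us v (ζ v) ≡ 𝐙) → (∀ v → τ* G ws v (ζ v) ≡ 𝐙) → SameGraph (G ⋆ us) (G ⋆ ws)
same-frame⇒same-graph G us ws ζ us𝐙 ws𝐙 x y = case x ≟ y of λ where
    (yes refl) → trans (adj-irr (G ⋆ us) x) (sym (adj-irr (G ⋆ ws) x))
    (no x≢y) → trans (sym (Ze y x≢y)) (trans (Z≡ e∈ y)
      (trans (sum-cong λ u → cong (_∧ adj (G ⋆ ws) u y) (Se u)) (sum-δ x _)))
  where
  K = star (G ⋆ us) x
  e : Vector _
  e v = τ* G ws v (τ*⁻¹ G us v (K v))
  e∈ : L (G ⋆ ws) e
  e∈ = L-τ* G ws (L-τ*⁻¹ G us (L-star (G ⋆ us) x))
  ω-𝐙 : ∀ p → ω p 𝐙 ≡ proj₁ p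
  ω-𝐙 = dec! (∀ᵖ λ p → ω p 𝐙 𝔹.≟ proj₁ p)
  Se : ∀ u → S e u ≡ δ x u
  Se u = begin
    S e u                                      ≡⟨ sym (ω-𝐙 (e u)) ⟩
    ω (e u) 𝐙                                  ≡⟨ cong (ω (e u)) (sym (ws𝐙 u)) ⟩
    ω (e u) (τ* G ws u (ζ u))                  ≡⟨ τ*-ω G ws u _ _ ⟩
    ω (τ*⁻¹ G us u (K u)) (ζ u)                ≡⟨ sym (τ*-ω G us u _ _) ⟩
    ω (τ* G us u (τ*⁻¹ G us u (K u))) (τ* G us u (ζ u)) ≡⟨ cong₂ ω (τ*-τ*⁻¹ G us u (K u)) (us𝐙 u) ⟩
    ω (K u) 𝐙                                  ≡⟨ ω-𝐙 (K u) ⟩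
    δ x u                                      ∎
    where open ≡-Reasoning
  fixes : ∀ u p → proj₁ p ≡ false → τ* G ws u (τ*⁻¹ G us u p) ≡ p
  fixes u 𝐈 _ = trans (cong (τ* G ws u) (trans (cong (τ*⁻¹ G us u) (sym (τ*-𝐈 G us u))) (τ*⁻¹-τ* G us u 𝐈))) (τ*-𝐈 G ws u)
  fixes u 𝐙 _ = trans (cong (τ* G ws u) (trans (cong (τ*⁻¹ G us u) (sym (us𝐙 u))) (τ*⁻¹-τ* G us u (ζ u)))) (ws𝐙 u)
  Ze : ∀ y → x ≢ y → Z e y ≡ adj (G ⋆ us) x y
  Ze y x≢y = cong proj₂ (fixes y (K y) (δ-≢ x≢y))

⋆-++ : (G : Graph n) (us ws : List (Fin n)) → G ⋆ (us ++ ws) ≡ G ⋆ us ⋆ ws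
⋆-++ G [] ws = refl
⋆-++ G (u ∷ us) ws = ⋆-++ (G * u) us ws

τ*-++ : (G : Graph n) (us ws : List (Fin n)) (v : Fin n) (p : Pauli) →
  τ* G (us ++ ws) v p ≡ τ* (G ⋆ us) ws v (τ* G us v p)
τ*-++ G [] ws v p = refl
τ*-++ G (u ∷ us) ws v p = τ*-++ (G * u) us ws v (τ G u v p)

τ*⁻¹-𝐈 : (G : Graph n) (us : List (Fin n)) (v : Fin n) → τ*⁻¹ G us v 𝐈 ≡ 𝐈
τ*⁻¹-𝐈 G us v = trans (cong (τ*⁻¹ G us v) (sym (τ*-𝐈 G us v))) (τ*⁻¹-τ* G us v 𝐈)

τ*⁻¹-injective : (G : Graph n) (us : List (Fin n)) (v : Fin n) {p q : Pauli} → τ*⁻¹ G us v p ≡ τ*⁻¹ G us v q → p ≡ q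
τ*⁻¹-injective G us v eq = trans (sym (τ*-τ*⁻¹ G us v _)) (trans (cong (τ* G us v) eq) (τ*-τ*⁻¹ G us v _))

-- The minor of G at v in direction p is well defined up to local equivalence.
cut-transport : (G : Graph n) (us ws : List (Fin n)) {v : Fin n} {p : Pauli} →
  τ* G us v p ≡ 𝐙 → τ* G ws v p ≡ 𝐙 → Cut (G ⋆ us) (_≡ v) → Cut (G ⋆ ws) (_≡ v)
cut-transport G us ws {v} {p} us𝐙 ws𝐙 c =
  let vs , to𝐙 , avoid = rotation H (just ∘ ζ) ζ≢𝐈 noObs
  in cut-same (same-frame⇒same-graph G (us ++ vs) ws (λ u → τ*⁻¹ G ws u 𝐙)
         (λ u → trans (τ*-++ G us vs u _) (to𝐙 u refl)) (λ u → τ*-τ*⁻¹ G ws u 𝐙))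
       (subst (λ K → Cut K (_≡ v)) (sym (⋆-++ G us vs)) (cut-⋆ vs (λ { u∈ refl → avoid u∈ (cong just ζv) }) c))
  where
  H = G ⋆ us
  ζ = λ u → τ* G us u (τ*⁻¹ G ws u 𝐙)
  ζv : ζ v ≡ 𝐙
  ζv = trans (cong (τ* G us v) (trans (cong (τ*⁻¹ G ws v) (sym ws𝐙)) (τ*⁻¹-τ* G ws v p))) us𝐙
  ζ≢𝐈 : ∀ u → just (ζ u) ≢ just 𝐈
  ζ≢𝐈 u eq = case τ*⁻¹-injective G ws u (τ*-injective G us u
      (trans (Maybe.just-injective eq) (sym (trans (cong (τ* G us u) (τ*⁻¹-𝐈 G ws u)) (τ*-𝐈 G us u))))) of λ ()
  noObs : NoObstruction H (just ∘ ζ)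
  noObs d d∈ on u = τ*⁻¹-injective G us u (τ*-injective G ws u
      (trans (L-S≡0 e∈ S≡0 u) (sym (trans (cong (τ* G ws u) (τ*⁻¹-𝐈 G us u)) (τ*-𝐈 G ws u)))))
    where
    e∈ = L-τ* G ws (L-τ*⁻¹ G us d∈)
    S≡0 : ∀ u → proj₁ (τ* G ws u (τ*⁻¹ G us u (d u))) ≡ false
    S≡0 u = [ (λ eq → cong proj₁ (trans (cong (τ* G ws u) (trans (cong (τ*⁻¹ G us u) eq) (τ*⁻¹-𝐈 G us u))) (τ*-𝐈 G ws u)))
            , (λ eq → cong proj₁ (trans (cong (τ* G ws u ∘ τ*⁻¹ G us u) (Maybe.just-injective eq))
                (trans (cong (τ* G ws u) (τ*⁻¹-τ* G us u _)) (τ*-τ*⁻¹ G ws u 𝐙)))) ]′ (on u)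

-- Triples

record Triple (G : Graph n) (d : Vector n) (a b c : Fin n) : Set where
  constructor triple
  field
    a≢b : a ≢ b
    a≢c : a ≢ c
    b≢c : b ≢ c
    mem : L G d
    at₁ : d a ≢ 𝐈
    at₂ : d b ≢ 𝐈
    at₃ : d c ≢ 𝐈
    off : ∀ {u} → u ≢ a → u ≢ b → u ≢ c → d u ≡ 𝐈
open Triple public

module _ {G : Graph n} {d : Vector n} where

  swap₂₃ : ∀ {a b c} → Triple G d a b c → Triple G d a c b
  swap₂₃ (triple ab ac bc m pa pb pc o) = triple ac ab (bc ∘ sym) m pa pc pb λ ua uc ub → o ua ub uc

  swap₁₂ : ∀ {a b c} → Triple G d a b c → Triple G d b a c
  swap₁₂ (triple ab ac bc m pa pb pc o) = triple (ab ∘ sym) bc ac m pb pa pc λ ub ua uc → o ua ub uc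

  swap₁₃ : ∀ {a b c} → Triple G d a b c → Triple G d c b a
  swap₁₃ = swap₁₂ ∘ swap₂₃ ∘ swap₁₂

  rotˡ : ∀ {a b c} → Triple G d a b c → Triple G d b c a
  rotˡ = swap₂₃ ∘ swap₁₂

  rotʳ : ∀ {a b c} → Triple G d a b c → Triple G d c a b
  rotʳ = swap₁₂ ∘ swap₂₃

  elem : ∀ {a b c} → Triple G d a b c → ∀ {u} → d u ≢ 𝐈 → u ≡ a ⊎ u ≡ b ⊎ u ≡ c
  elem {a} {b} {c} t {u} du with u ≟ a | u ≟ b | u ≟ c
  ... | yes eq | _ | _ = inj₁ eq
  ... | no _ | yes eq | _ = inj₂ (inj₁ eq)
  ... | no _ | no _ | yes eq = inj₂ (inj₂ eq)
  ... | no ua | no ub | no uc = ⊥-elim (du (off t ua ub uc))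

  focus : ∀ {v p q} → Triple G d v p q → ∀ {u} → u ≢ v → d u ≢ 𝐈 → ∃[ r ] Triple G d v u r
  focus t u≢v du with elem t du
  ... | inj₁ eq = ⊥-elim (u≢v eq)
  ... | inj₂ (inj₁ refl) = _ , t
  ... | inj₂ (inj₂ refl) = _ , swap₂₃ t

  refocus : ∀ {a b c} → Triple G d a b c → ∀ {u} → d u ≢ 𝐈 → ∃₂ λ p q → Triple G d u p q
  refocus t du with elem t du
  ... | inj₁ refl = _ , _ , t
  ... | inj₂ (inj₁ refl) = _ , _ , swap₁₂ t
  ... | inj₂ (inj₂ refl) = _ , _ , swap₁₃ t

triple-cong : {G : Graph n} {d d' : Vector n} {a b c : Fin n} → (∀ v → d v ≡ d' v) → Triple G d a b c → Triple G d' a b c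
triple-cong d≗ (triple ab ac bc m pa pb pc o) = triple ab ac bc (L-cong d≗ m)
  (pa ∘ trans (d≗ _)) (pb ∘ trans (d≗ _)) (pc ∘ trans (d≗ _)) λ ua ub uc → trans (sym (d≗ _)) (o ua ub uc)

triple-τ* : {G : Graph n} (us : List (Fin n)) {d : Vector n} {a b c : Fin n} →
  Triple G d a b c → Triple (G ⋆ us) (λ v → τ* G us v (d v)) a b c
triple-τ* {G = G} us (triple ab ac bc m pa pb pc o) = triple ab ac bc (L-τ* G us m) (nz pa) (nz pb) (nz pc)
  λ ua ub uc → trans (cong (τ* G us _) (o ua ub uc)) (τ*-𝐈 G us _)
  where
  nz : ∀ {v p} → p ≢ 𝐈 → τ* G us v p ≢ 𝐈
  nz {v} p≢ eq = p≢ (τ*-injective G us v (trans eq (sym (τ*-𝐈 G us v))))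

triple-τ*⁻¹ : {G : Graph n} (us : List (Fin n)) {d : Vector n} {a b c : Fin n} →
  Triple (G ⋆ us) d a b c → Triple G (λ v → τ*⁻¹ G us v (d v)) a b c
triple-τ*⁻¹ {G = G} us (triple ab ac bc m pa pb pc o) = triple ab ac bc (L-τ*⁻¹ G us m) (nz pa) (nz pb) (nz pc)
  λ ua ub uc → trans (cong (τ*⁻¹ G us _) (o ua ub uc)) (τ*⁻¹-𝐈 G us _)
  where
  nz : ∀ {v p} → p ≢ 𝐈 → τ*⁻¹ G us v p ≢ 𝐈
  nz {v} p≢ eq = p≢ (τ*⁻¹-injective G us v (trans eq (sym (τ*⁻¹-𝐈 G us v))))

-- Such a vector d exhibits a linear dependence between the rows of a and b.
pair-cut : {G : Graph n} {E : Fin n → Set} {d : Vector n} {a b : Fin n} → a ≢ b → ¬ E a → ¬ E b → L G d →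
  (∀ {u} → u ≢ a → u ≢ b → S d u ≡ false) → (S d a ≡ false → S d b ≡ false → ⊥) →
  (∀ {u} → ¬ E u → u ≢ a → u ≢ b → Z d u ≡ false) → Two (λ u → ¬ E u × u ≢ a × u ≢ b) → Cut G E
pair-cut {n} {G} {E} {d} {a} {b} a≢b a∉E b∉E d∈ S-off S-on Z-off others = cut side
    (a , b , a≢b , (a∉E , side-a) , (b∉E , side-b)) (two-map (λ (u∉E , ua , ub) → u∉E , side-off ua ub) others)
    (λ u → (δ u a ∧ S d b) xor (δ u b ∧ S d a)) (λ y → adj G a y ∨ adj G b y) rk
  where
  side : Fin n → Bool
  side u = does ((u ≟ a) ⊎-dec (u ≟ b))
  side-a : side a ≡ true
  side-a = dec-true ((a ≟ a) ⊎-dec (a ≟ b)) (inj₁ refl)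
  side-b : side b ≡ true
  side-b = dec-true ((b ≟ a) ⊎-dec (b ≟ b)) (inj₂ refl)
  side-off : ∀ {u} → u ≢ a → u ≢ b → side u ≡ false
  side-off {u} ua ub = dec-false ((u ≟ a) ⊎-dec (u ≟ b)) [ ua , ub ]′
  row : ∀ y → Z d y ≡ (S d a ∧ adj G a y) xor (S d b ∧ adj G b y)
  row y = trans (Z≡ d∈ y) (sum-supp₂ _ a≢b λ u ua ub → cong (_∧ adj G u y) (S-off ua ub))
  dependent : ∀ s t f g → (s ≡ false → t ≡ false → ⊥) → (s ∧ f) xor (t ∧ g) ≡ false →
    f ≡ (t xor false) ∧ (f ∨ g) × g ≡ s ∧ (f ∨ g)
  dependent false false f g h _ = ⊥-elim (h refl refl)
  dependent false true false false h _ = refl , refl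
  dependent false true true false h _ = refl , refl
  dependent true false false false h _ = refl , refl
  dependent true false false true h _ = refl , refl
  dependent true true false false h _ = refl , refl
  dependent true true true true h _ = refl , refl
  rk : ∀ {x y} → ¬ E x → ¬ E y → side x ≡ true → side y ≡ false →
    adj G x y ≡ ((δ x a ∧ S d b) xor (δ x b ∧ S d a)) ∧ (adj G a y ∨ adj G b y)
  rk {x} {y} _ y∉E sx sy with x ≟ a | x ≟ b
  ... | yes refl | yes refl = ⊥-elim (a≢b refl)
  ... | yes refl | no _ = proj₁ (dependent (S d a) (S d b) _ _ S-on (trans (sym (row y)) Zy))
    where Zy = Z-off y∉E (λ { refl → true≢false (trans (sym side-a) sy) }) (λ { refl → true≢false (trans (sym side-b) sy) })
  ... | no _ | yes refl = proj₂ (dependent (S d a) (S d b) _ _ S-on (trans (sym (row y)) Zy))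
    where Zy = Z-off y∉E (λ { refl → true≢false (trans (sym side-a) sy) }) (λ { refl → true≢false (trans (sym side-b) sy) })

-- Direction Z at `v` confines the X-part to `a` and `b`, so their rows are dependent once `v` is
-- deleted; `5 ≤ n` leaves two vertices for the other side.
triple-𝐙⇒cut : {G : Graph n} → 5 ≤ n → ∀ {d v a b} → Triple G d v a b → d v ≡ 𝐙 → Cut G (_≡ v)
triple-𝐙⇒cut 5≤n {d} {v} {a} {b} t dv = pair-cut (b≢c t) (a≢b t ∘ sym) (a≢c t ∘ sym) (mem t)
    S-off (λ sa sb → true≢false (trans (sym (cong proj₂ dv)) (cong proj₂ (L-S≡0 (mem t) (S≡0 sa sb) v))))
    (λ uv ua ub → cong proj₂ (off t uv ua ub))
    (two-map (λ u∉ → u∉ ∘ here , u∉ ∘ there ∘ here , u∉ ∘ there ∘ there ∘ here)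
      (two-fresh (v ∷ a ∷ b ∷ []) 5≤n))
  where
  S-off : ∀ {u} → u ≢ a → u ≢ b → S d u ≡ false
  S-off {u} ua ub = case u ≟ v of λ where
    (yes refl) → cong proj₁ dv
    (no uv) → cong proj₁ (off t uv ua ub)
  S≡0 : S d a ≡ false → S d b ≡ false → ∀ u → S d u ≡ false
  S≡0 sa sb u = case u ≟ a of λ where
    (yes refl) → sa
    (no ua) → case u ≟ b of λ where
      (yes refl) → sb
      (no ub) → S-off ua ub

by-cases : {P : Fin n → Set} {a u : Fin n} → P a → (u ≢ a → P u) → P u
by-cases {a = a} {u} pa pu with u ≟ a
... | yes refl = pa
... | no u≢a = pu u≢a

value-at : (f : Fin n → A) {c : A} {a u : Fin n} → f a ≡ c → (u ≢ a → f u ≡ c) → f u ≡ c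
value-at f {c} = by-cases {P = λ u → f u ≡ c}

module PrimeGraph {n : ℕ} (5≤n : 5 ≤ n) {G : Graph n} (prime : Prime G) where

  -- A nonzero vector on `a` and `b` is a dependence between their rows and yields a split with
  -- these two on one side.
  weight>2 : ∀ {d a b} → a ≢ b → L G d → (∀ {u} → u ≢ a → u ≢ b → d u ≡ 𝐈) → ∀ u → d u ≡ 𝐈
  weight>2 {d} {a} {b} a≢b d∈ off₂ = decidable-stable (Fin.all? λ u → d u ≟ᵖ 𝐈) λ d≢0 → prime⇒no-cut {G = G} prime
    (pair-cut a≢b id id d∈ (λ ua ub → cong proj₁ (off₂ ua ub)) (λ sa sb → d≢0 (L-S≡0 d∈ (S≡0 sa sb)))
      (λ _ ua ub → cong proj₂ (off₂ ua ub))
      (two-map (λ u∉ → id , u∉ ∘ here , u∉ ∘ there ∘ here)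
        (two-fresh (a ∷ b ∷ []) (ℕ.≤-trans (ℕ.n≤1+n _) 5≤n))))
    where
    S≡0 : S d a ≡ false → S d b ≡ false → ∀ u → S d u ≡ false
    S≡0 sa sb u = case u ≟ a of λ where
      (yes refl) → sa
      (no ua) → case u ≟ b of λ where
        (yes refl) → sb
        (no ub) → cong proj₁ (off₂ ua ub)

  other : (a : Fin n) → ∃[ b ] a ≢ b
  other a = let b , b∉ = fresh (a ∷ []) (ℕ.≤-trans (s≤s (s≤s z≤n)) 5≤n) in b , λ eq → b∉ (here (sym eq))

  to-triple : ∀ {d a b c} → a ≢ b → a ≢ c → b ≢ c → L G d → (∀ {u} → u ≢ a → u ≢ b → u ≢ c → d u ≡ 𝐈) →
    ∀ {u} → d u ≢ 𝐈 → Triple G d a b c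
  to-triple {d} ab ac bc d∈ o du = triple ab ac bc d∈
    (λ eq → du (weight>2 bc d∈ (λ ub uc → value-at d eq λ ua → o ua ub uc) _))
    (λ eq → du (weight>2 ac d∈ (λ ua uc → value-at d eq λ ub → o ua ub uc) _))
    (λ eq → du (weight>2 ab d∈ (λ ua ub → value-at d eq λ uc → o ua ub uc) _))
    o

  ω-sum : ∀ {d d' a b c} → Triple G d a b c → L G d' →
    ω (d a) (d' a) xor (ω (d b) (d' b) xor ω (d c) (d' c)) ≡ false
  ω-sum {d} {d'} t d'∈ = trans (sym (sum-supp₃ _ (a≢b t) (a≢c t) (b≢c t) λ u ua ub uc → cong (λ p → ω p (d' u)) (off t ua ub uc)))
    (isotropic (mem t) d'∈)

  ω≡true⇒≢𝐈 : ∀ p q → ω p q ≡ true → q ≢ 𝐈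
  ω≡true⇒≢𝐈 = dec! (∀ᵖ λ p → ∀ᵖ λ q → (ω p q 𝔹.≟ true) →-dec ¬? (q ≟ᵖ 𝐈))

  -- The sum of the two vectors lives on `p`, `q`, `r`. By isotropy they commute at `p` iff they
  -- commute at `q`. If they do, they agree at `p`; if not, `d'` is nonzero at `q`, so `q` is `r`.
  -- In both cases the sum has weight at most 2.
  agree⇒same : ∀ {d d' v p q r} → Triple G d v p q → Triple G d' v p r → d v ≡ d' v → ∀ u → d u ≡ d' u
  agree⇒same {d} {d'} {v} {p} {q} {r} t t' dv u = ⊕≡𝐈⇒≡ _ _ (e≡0 (ω (d p) (d' p)) refl u)
    where
    e = d ⊞ d'
    e∈ = L-⊞ (mem t) (mem t')
    ev : e v ≡ 𝐈
    ev = trans (cong (d v ⊕_) (sym dv)) (⊕-self (d v))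
    e-off : ∀ {u} → u ≢ p → u ≢ q → u ≢ r → e u ≡ 𝐈
    e-off {u} up uq ur = case u ≟ v of λ where
      (yes refl) → ev
      (no uv) → cong₂ _⊕_ (off t uv up uq) (off t' uv up ur)
    ω-sum' : ω (d p) (d' p) xor ω (d q) (d' q) ≡ false
    ω-sum' = subst (λ b → b xor (ω (d p) (d' p) xor ω (d q) (d' q)) ≡ false) (trans (cong (ω (d v)) (sym dv)) (ω-self (d v)))
      (ω-sum t (mem t'))
    e≡0 : ∀ b → ω (d p) (d' p) ≡ b → ∀ u → e u ≡ 𝐈
    e≡0 true eq = case elem t' (ω≡true⇒≢𝐈 (d q) (d' q) ωq) of λ where
        (inj₁ q≡v) → ⊥-elim (a≢c t (sym q≡v))
        (inj₂ (inj₁ q≡p)) → ⊥-elim (b≢c t (sym q≡p))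
        (inj₂ (inj₂ refl)) → weight>2 (b≢c t) e∈ λ up uq → e-off up uq uq
      where
      ωq : ω (d q) (d' q) ≡ true
      ωq = xor-false-true _ (subst (λ b → b xor ω (d q) (d' q) ≡ false) eq ω-sum')
        where
        xor-false-true : ∀ b → not b ≡ false → b ≡ true
        xor-false-true true _ = refl
    e≡0 false eq = case q ≟ r of λ where
        (yes refl) → weight>2 (a≢c t) e∈ λ {u} uv uq → off-p uq uq
        (no q≢r) → weight>2 q≢r e∈ off-p
      where
      ep : e p ≡ 𝐈
      ep = trans (cong (_⊕ d' p) (ω-false _ _ eq (at₂ t) (at₂ t'))) (⊕-self (d' p))
      off-p : ∀ {u} → u ≢ q → u ≢ r → e u ≡ 𝐈
      off-p {u} uq ur = case u ≟ p of λ where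
        (yes refl) → ep
        (no up) → e-off up uq ur

  -- The triples anticommute at `v`, hence at exactly one of `p` and `q`, which they therefore
  -- share. If they shared the third vertex too, they would agree there and their sum would have
  -- weight at most 2.
  cross : ∀ {d d' v p q p' q'} → Triple G d v p q → Triple G d' v p' q' → d v ≢ d' v →
    (∃[ r ] Triple G d' v p r × r ≢ q × d p ≢ d' p) ⊎ (∃[ r ] Triple G d' v q r × r ≢ p × d q ≢ d' q)
  cross {d} {d'} {v} {p} {q} t t' dv≢ = by-ω (ω (d p) (d' p)) (ω (d q) (d' q)) refl refl
      (subst (λ b → b xor (ω (d p) (d' p) xor ω (d q) (d' q)) ≡ false) (ω-true _ _ dv≢ (at₁ t) (at₁ t')) (ω-sum t (mem t')))
    where
    half : ∀ {x y} → Triple G d v x y → ω (d x) (d' x) ≡ true → ω (d y) (d' y) ≡ false →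
      ∃[ r ] Triple G d' v x r × r ≢ y × d x ≢ d' x
    half {x} {y} s ωx ωy with focus t' (a≢b s ∘ sym) (ω≡true⇒≢𝐈 (d x) (d' x) ωx)
    ... | r , s' = r , s' , r≢y , ω-true⇒≢ _ _ ωx
      where
      r≢y : r ≢ y
      r≢y refl = dv≢ (⊕≡𝐈⇒≡ _ _ (weight>2 (a≢b s) (L-⊞ (mem s) (mem s')) off′ v))
        where
        off′ : ∀ {u} → u ≢ v → u ≢ x → d u ⊕ d' u ≡ 𝐈
        off′ {u} uv ux = case u ≟ r of λ where
          (yes refl) → trans (cong (_⊕ d' r) (ω-false _ _ ωy (at₃ s) (at₃ s'))) (⊕-self (d' r))
          (no ur) → cong₂ _⊕_ (off s uv ux ur) (off s' uv ux ur)
    by-ω : ∀ b c → ω (d p) (d' p) ≡ b → ω (d q) (d' q) ≡ c → true xor (ω (d p) (d' p) xor ω (d q) (d' q)) ≡ false →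
      (∃[ r ] Triple G d' v p r × r ≢ q × d p ≢ d' p) ⊎ (∃[ r ] Triple G d' v q r × r ≢ p × d q ≢ d' q)
    by-ω true false eq eq' _ = inj₁ (half t eq eq')
    by-ω false true eq eq' _ = inj₂ (half (swap₂₃ t) eq' eq)
    by-ω false false eq eq' bad rewrite eq | eq' = ⊥-elim (true≢false bad)
    by-ω true true eq eq' bad rewrite eq | eq' = ⊥-elim (true≢false bad)

  same-support⇒same : ∀ {d d' a b c} → Triple G d a b c → Triple G d' a b c → ∀ u → d u ≡ d' u
  same-support⇒same {d} {d'} {a} t t' with d a ≟ᵖ d' a
  ... | yes eq = agree⇒same t t' eq
  ... | no neq with cross t t' neq
  ...   | inj₁ (r , s , r≢c , _) = ⊥-elim ([ a≢c t ∘ sym , [ b≢c t ∘ sym , r≢c ∘ sym ]′ ]′ (elem s (at₃ t')))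
  ...   | inj₂ (r , s , r≢b , _) = ⊥-elim ([ a≢b t ∘ sym , [ b≢c t , r≢b ∘ sym ]′ ]′ (elem s (at₂ t')))

-- Two nonprime minors at a vertex

AtMostOne : (Fin n → Set) → Set
AtMostOne P = ∀ x y → P x → P y → x ≡ y

dot : Bool × Pauli → Bool × Pauli → Bool
dot (a , b , c) (a' , b' , c') = (a ∧ a') xor ((b ∧ b') xor (c ∧ c'))

𝟎 : Bool × Pauli
𝟎 = false , 𝐈

_≟³_ : (l m : Bool × Pauli) → Dec (l ≡ m)
_≟³_ = Prod.≡-dec 𝔹._≟_ _≟ᵖ_

∀³ : {P : Bool × Pauli → Set} → (∀ l → Dec (P l)) → Dec (∀ l → P l)
∀³ P? = map′ (λ g (b , p) → g b p) (λ g b p → g (b , p)) (∀ᵇ λ b → ∀ᵖ λ p → P? (b , p))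

-- In F₂³ two planes cannot be orthogonal.
orthogonal⇒line : ∀ l l' → l ≢ 𝟎 → l' ≢ 𝟎 → l ≢ l' → ∀ m → m ≢ 𝟎 → dot l m ≡ false → dot l' m ≡ false →
  ∀ m' → m' ≢ 𝟎 → dot l m' ≡ false → dot l' m' ≡ false → m ≡ m'
orthogonal⇒line = dec! (∀³ λ l → ∀³ λ l' → ¬? (l ≟³ 𝟎) →-dec (¬? (l' ≟³ 𝟎) →-dec (¬? (l ≟³ l') →-dec
  (∀³ λ m → ¬? (m ≟³ 𝟎) →-dec ((dot l m 𝔹.≟ false) →-dec ((dot l' m 𝔹.≟ false) →-dec
  (∀³ λ m' → ¬? (m' ≟³ 𝟎) →-dec ((dot l m' 𝔹.≟ false) →-dec ((dot l' m' 𝔹.≟ false) →-dec (m ≟³ m'))))))))))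

module PrimeCuts {n : ℕ} (5≤n : 5 ≤ n) {G : Graph n} (prime : Prime G) where
  open PrimeGraph 5≤n {G} prime

  -- Labels that determine the rows towards the outside and lie on a line bound the cut-rank of P by 1.
  on-line⇒small : {T : Set} (0# : T) (_≟ᵀ_ : (s t : T) → Dec (s ≡ t)) (ℓ : Fin n → T) (P : Fin n → Bool) →
    (∀ {x y} → P x ≡ true → P y ≡ false → ℓ x ≡ 0# → adj G x y ≡ false) →
    (∀ {x x' y} → P x ≡ true → P x' ≡ true → P y ≡ false → ℓ x ≡ ℓ x' → adj G x y ≡ adj G x' y) →
    (∀ {x x'} → P x ≡ true → P x' ≡ true → ℓ x ≢ 0# → ℓ x' ≢ 0# → ℓ x ≡ ℓ x') →
    Two (λ u → P u ≡ false) → AtMostOne (λ u → P u ≡ true)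
  on-line⇒small 0# _≟ᵀ_ ℓ P zero-row same-row on-line others a b Pa Pb =
    decidable-stable (a ≟ b) λ a≢b → prime⇒no-cut {G = G} prime (by-label a≢b
      (Fin.any? λ x → (P x 𝔹.≟ true) ×-dec ¬? (ℓ x ≟ᵀ 0#)))
    where
    by-label : a ≢ b → Dec (∃[ x ] P x ≡ true × ℓ x ≢ 0#) → Cut G ∅
    by-label a≢b (no none) = cut P (a , b , a≢b , (id , Pa) , (id , Pb)) (two-map (id ,_) others)
      (λ _ → false) (λ _ → false) λ {x} _ _ Px Py → zero-row Px Py
        (decidable-stable (ℓ x ≟ᵀ 0#) λ ℓx → none (x , Px , ℓx))
    by-label a≢b (yes (x₀ , Px₀ , ℓx₀)) = cut P (a , b , a≢b , (id , Pa) , (id , Pb)) (two-map (id ,_) others)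
      (λ x → not (does (ℓ x ≟ᵀ 0#))) (adj G x₀) λ {x} {y} _ _ Px Py → row Px Py
      where
      row : ∀ {x y} → P x ≡ true → P y ≡ false → adj G x y ≡ not (does (ℓ x ≟ᵀ 0#)) ∧ adj G x₀ y
      row {x} Px Py with ℓ x ≟ᵀ 0#
      ... | yes ℓx = zero-row Px Py ℓx
      ... | no ℓx = same-row Px Px₀ Py (on-line Px Px₀ ℓx ℓx₀)

  -- Across the cut the rows of `a` and `b` are multiples of `β`, so the star of `a`, the star of
  -- `b` or their sum vanishes there. Its X-part at `v` is zero, whence the direction Z.
  small-side⇒triple : ∀ {v a b} (c : Cut G (_≡ v)) → a ≢ b → a ≢ v → b ≢ v → Cut.side c a ≡ true → Cut.side c b ≡ true →
    (∀ {u} → u ≢ v → Cut.side c u ≡ true → u ≡ a ⊎ u ≡ b) →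
    ∃[ d ] Triple G d v a b × d v ≡ 𝐙
  small-side⇒triple {v} {a} {b} c a≢b a≢v b≢v sa sb only = by-α (α a) (α b) refl refl
    where
    open Cut c
    outside : ∀ {u} → u ≢ v → u ≢ a → u ≢ b → side u ≡ false
    outside {u} uv ua ub with side u in eq
    ... | false = refl
    ... | true = ⊥-elim ([ ua , ub ]′ (only uv eq))
    finish : ∀ {d} → L G d → (∀ {u} → u ≢ v → u ≢ a → u ≢ b → d u ≡ 𝐈) → S d v ≡ false → ∀ {u} → d u ≢ 𝐈 →
      ∃[ d ] Triple G d v a b × d v ≡ 𝐙
    finish {d} d∈ o Sv du = let t = to-triple (a≢v ∘ sym) (b≢v ∘ sym) a≢b d∈ o du in d , t , S≡false⇒𝐙 _ (at₁ t) Sv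
    row : ∀ {x u} → x ≢ v → side x ≡ true → u ≢ v → u ≢ a → u ≢ b → adj G x u ≡ α x ∧ β u
    row xv sx uv ua ub = rank1 xv uv sx (outside uv ua ub)
    by-α : ∀ αa αb → α a ≡ αa → α b ≡ αb → ∃[ d ] Triple G d v a b × d v ≡ 𝐙
    by-α false _ eqa _ = finish (L-star G a)
      (λ {u} uv ua ub → star-off G ua (trans (row a≢v sa uv ua ub) (cong (_∧ β u) eqa))) (δ-≢ a≢v) (star-≢𝐈 G a)
    by-α true false _ eqb = finish (L-star G b)
      (λ {u} uv ua ub → star-off G ub (trans (row b≢v sb uv ua ub) (cong (_∧ β u) eqb))) (δ-≢ b≢v) (star-≢𝐈 G b)
    by-α true true eqa eqb = finish (L-⊞ (L-star G a) (L-star G b))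
      (λ {u} uv ua ub → cong₂ _,_ (cong₂ _xor_ (δ-≢ (ua ∘ sym)) (δ-≢ (ub ∘ sym)))
        (trans (cong₂ _xor_ (trans (row a≢v sa uv ua ub) (cong (_∧ β u) eqa)) (trans (row b≢v sb uv ua ub) (cong (_∧ β u) eqb))) (𝔹.xor-same (β u))))
      (cong₂ _xor_ (δ-≢ a≢v) (δ-≢ b≢v))
      λ eq → true≢false (trans (sym (cong₂ _xor_ (δ-refl a) (δ-≢ (a≢b ∘ sym)))) (cong proj₁ eq))

  thin-side⇒triple : ∀ {v} (c : Cut G (_≡ v)) (B : Fin n → Bool) →
    AtMostOne (λ u → u ≢ v × Cut.side c u ≡ true × B u ≡ true) →
    AtMostOne (λ u → u ≢ v × Cut.side c u ≡ true × B u ≡ false) →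
    ∃[ d ] ∃₂ λ a b → Triple G d v a b × d v ≡ 𝐙
  thin-side⇒triple {v} c B one₁ one₂ with Cut.left c
  ... | a , b , a≢b , (a≢v , sa) , (b≢v , sb) = let d , t = small-side⇒triple c a≢b a≢v b≢v sa sb only in d , a , b , t
    where
    open Cut c
    same : ∀ {x y} → x ≢ v → y ≢ v → side x ≡ true → side y ≡ true → B x ≡ B y → x ≡ y
    same {x} {y} xv yv sx sy eq with B x in eqx
    ... | true = one₁ x y (xv , sx , eqx) (yv , sy , sym eq)
    ... | false = one₂ x y (xv , sx , eqx) (yv , sy , sym eq)
    only : ∀ {u} → u ≢ v → side u ≡ true → u ≡ a ⊎ u ≡ b
    only {u} uv su with B u 𝔹.≟ B a | B u 𝔹.≟ B b
    ... | yes eq | _ = inj₁ (same uv a≢v su sa eq)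
    ... | no _ | yes eq = inj₂ (same uv b≢v su sb eq)
    ... | no na | no nb = ⊥-elim (a≢b (same a≢v b≢v sa sb (𝔹.not-injective (trans (sym (𝔹.¬-not na)) (𝔹.¬-not nb)))))

  -- The labels `ℓ` and `m` in F₂³ combine the coefficients of both splits with adjacency to `v`.
  -- Computing an edge between opposite quadrants from both splits shows that `ℓ` and `m` are
  -- orthogonal there, so on one of the quadrants the nonzero labels coincide. Labels determine
  -- rows, since a vertex outside the quadrant is `v` or is separated from it by one of the splits.
  crossing-quadrants : ∀ {v} (c : Cut G (_≡ v)) (c' : Cut (G * v) (_≡ v)) →
    M (AtMostOne (λ u → u ≢ v × Cut.side c u ≡ true × Cut.side c' u ≡ true) ⊎
       AtMostOne (λ u → u ≢ v × Cut.side c u ≡ false × Cut.side c' u ≡ false))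
  crossing-quadrants {v} c c' = do
      yes line ← excluded-middle (∀ x x' → Q true x ≡ true → Q true x' ≡ true → ℓ x ≢ 𝟎 → ℓ x' ≢ 𝟎 → ℓ x ≡ ℓ x')
        where no not-line → return (inj₂ λ x y p q → on-line⇒small 𝟎 _≟³_ m (Q false)
                (λ {x} {y} Qx Qy eq → trans (col Qx Qy) (trans (cong (λ l → dot l (vec y)) eq) refl))
                (λ {x} {x'} {y} Qx Qx' Qy eq → trans (col Qx Qy) (trans (cong (λ l → dot l (vec y)) eq) (sym (col Qx' Qy))))
                (λ {y} {y'} Qy Qy' my my' → decidable-stable (m y ≟³ m y') λ my≢ → not-line λ x x' Qx Qx' ℓx ℓx' →
                  decidable-stable (ℓ x ≟³ ℓ x') λ ℓx≢ → my≢ (orthogonal⇒line (ℓ x) (ℓ x') ℓx ℓx' ℓx≢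
                    (m y) my (orth Qx Qy) (orth Qx' Qy) (m y') my' (orth Qx Qy') (orth Qx' Qy')))
                (two-map (Q-false true ∘ proj₂) left)
                x y (Q-intro p) (Q-intro q))
      return (inj₁ λ x y p q → on-line⇒small 𝟎 _≟³_ ℓ (Q true)
                (λ {x} {y} Qx Qy eq → trans (row Qx Qy) (trans (cong (λ l → dot l (vec' y)) eq) refl))
                (λ {x} {x'} {y} Qx Qx' Qy eq → trans (row Qx Qy) (trans (cong (λ l → dot l (vec' y)) eq) (sym (row Qx' Qy))))
                (λ {x} {x'} → line x x') (two-map (Q-false false ∘ proj₂) right)
                x y (Q-intro p) (Q-intro q))
    where
    open Cut c
    open Cut c' using () renaming (side to side'; α to γ; β to ε; rank1 to rank1')
    N = adj G v
    Q : Bool → Fin n → Bool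
    Q b u = does (¬? (u ≟ v) ×-dec ((side u 𝔹.≟ b) ×-dec (side' u 𝔹.≟ b)))
    Q-intro : ∀ {b u} → u ≢ v × side u ≡ b × side' u ≡ b → Q b u ≡ true
    Q-intro {b} {u} = dec-true (¬? (u ≟ v) ×-dec ((side u 𝔹.≟ b) ×-dec (side' u 𝔹.≟ b)))
    Q-elim : ∀ b {u} → Q b u ≡ true → u ≢ v × side u ≡ b × side' u ≡ b
    Q-elim b {u} eq = decidable-stable Q? λ ¬q → true≢false (trans (sym eq) (dec-false Q? ¬q))
      where Q? = ¬? (u ≟ v) ×-dec ((side u 𝔹.≟ b) ×-dec (side' u 𝔹.≟ b))
    Q-false : ∀ b {u} → side u ≡ b → Q (not b) u ≡ false
    Q-false b {u} su = dec-false (¬? (u ≟ v) ×-dec ((side u 𝔹.≟ not b) ×-dec (side' u 𝔹.≟ not b)))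
      λ (_ , su' , _) → 𝔹.not-¬ refl (trans (sym su) su')
    ℓ m : Fin n → Bool × Pauli
    ℓ u = α u , γ u , N u
    m u = β u , ε u , N u
    vec vec' : Fin n → Bool × Pauli
    vec y = if δ y v then (false , false , true) else if side y then (α y , false , false) else (false , γ y , N y)
    vec' y = if δ y v then (false , false , true) else if side y then (false , ε y , N y) else (β y , false , false)
    dot₁ : ∀ a b c k → a ∧ k ≡ dot (a , b , c) (k , false , false)
    dot₁ = dec! (∀ᵇ λ a → ∀ᵇ λ b → ∀ᵇ λ c → ∀ᵇ λ k → (a ∧ k) 𝔹.≟ dot (a , b , c) (k , false , false))
    dot₃ : ∀ a b c → c ≡ dot (a , b , c) (false , false , true)
    dot₃ = dec! (∀ᵇ λ a → ∀ᵇ λ b → ∀ᵇ λ c → c 𝔹.≟ dot (a , b , c) (false , false , true))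
    dot₂₃ : ∀ a b c k l e → e xor (c ∧ l) ≡ b ∧ k → e ≡ dot (a , b , c) (false , k , l)
    dot₂₃ = dec! (∀ᵇ λ a → ∀ᵇ λ b → ∀ᵇ λ c → ∀ᵇ λ k → ∀ᵇ λ l → ∀ᵇ λ e →
      ((e xor (c ∧ l)) 𝔹.≟ (b ∧ k)) →-dec (e 𝔹.≟ dot (a , b , c) (false , k , l)))
    dot≡false : ∀ a b c a' b' c' → (a ∧ a') xor (c ∧ c') ≡ b ∧ b' → dot (a , b , c) (a' , b' , c') ≡ false
    dot≡false = dec! (∀ᵇ λ a → ∀ᵇ λ b → ∀ᵇ λ c → ∀ᵇ λ a' → ∀ᵇ λ b' → ∀ᵇ λ c' →
      (((a ∧ a') xor (c ∧ c')) 𝔹.≟ (b ∧ b')) →-dec (dot (a , b , c) (a' , b' , c') 𝔹.≟ false))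
    rank-lc : ∀ {x y} → x ≢ v → y ≢ v → side' x ≡ true → side' y ≡ false → adj G x y xor (N x ∧ N y) ≡ γ x ∧ ε y
    rank-lc {x} {y} xv yv sx sy = trans (sym (lcAdj-≢ G v λ { refl → true≢false (trans (sym sx) sy) })) (rank1' xv yv sx sy)
    orth : ∀ {x y} → Q true x ≡ true → Q false y ≡ true → dot (ℓ x) (m y) ≡ false
    orth {x} {y} Qx Qy with Q-elim true {x} Qx | Q-elim false {y} Qy
    ... | xv , Ax , Bx | yv , Ay , By = dot≡false (α x) (γ x) (N x) (β y) (ε y) (N y)
      (trans (cong (_xor (N x ∧ N y)) (sym (rank1 xv yv Ax Ay))) (rank-lc xv yv Bx By))
    outside : ∀ b {y} → Q b y ≡ false → y ≢ v → side y ≡ b → side' y ≡ b → ⊥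
    outside b Qy yv Ay By = true≢false (trans (sym (Q-intro (yv , Ay , By))) Qy)
    row : ∀ {x y} → Q true x ≡ true → Q true y ≡ false → adj G x y ≡ dot (ℓ x) (vec' y)
    row {x} {y} Qx Qy = let xv , Ax , Bx = Q-elim true Qx in go xv Ax Bx (outside true Qy)
      where
      go : x ≢ v → side x ≡ true → side' x ≡ true → (y ≢ v → side y ≡ true → side' y ≡ true → ⊥) →
        adj G x y ≡ dot (ℓ x) (vec' y)
      go xv Ax Bx out with y ≟ v | side y in Ay | side' y in By
      ... | yes refl | _ | _ = trans (adj-sym G x y) (dot₃ (α x) (γ x) (N x))
      ... | no yv | false | _ = trans (rank1 xv yv Ax Ay) (dot₁ (α x) (γ x) (N x) (β y))
      ... | no yv | true | false = dot₂₃ (α x) (γ x) (N x) (ε y) (N y) _ (rank-lc xv yv Bx By)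
      ... | no yv | true | true = ⊥-elim (out yv refl refl)
    col : ∀ {x y} → Q false x ≡ true → Q false y ≡ false → adj G x y ≡ dot (m x) (vec y)
    col {x} {y} Qx Qy = let xv , Ax , Bx = Q-elim false Qx in go xv Ax Bx (outside false Qy)
      where
      go : x ≢ v → side x ≡ false → side' x ≡ false → (y ≢ v → side y ≡ false → side' y ≡ false → ⊥) →
        adj G x y ≡ dot (m x) (vec y)
      go xv Ax Bx out with y ≟ v | side y in Ay | side' y in By
      ... | yes refl | _ | _ = trans (adj-sym G x y) (dot₃ (β x) (ε x) (N x))
      ... | no yv | true | _ = trans (adj-sym G x y) (trans (rank1 yv xv Ay Ax)
              (trans (𝔹.∧-comm (α y) (β x)) (dot₁ (β x) (ε x) (N x) (α y))))
      ... | no yv | false | true = dot₂₃ (β x) (ε x) (N x) (γ y) (N y) _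
              (trans (cong₂ _xor_ (adj-sym G x y) (𝔹.∧-comm (N x) (N y))) (trans (rank-lc yv xv By Bx) (𝔹.∧-comm (γ y) (ε x))))
      ... | no yv | false | false = ⊥-elim (out yv refl refl)

-- Two of the three minors of G at v being nonprime forces a side of one of the splits to have
-- two elements: opposite quadrants of the two splits cannot both have cut-rank 2.
two-cuts⇒triple : 5 ≤ n → {G : Graph n} → Prime G → ∀ {v} → Cut G (_≡ v) → Cut (G * v) (_≡ v) →
  M ((∃[ d ] ∃₂ λ a b → Triple G d v a b × d v ≡ 𝐙) ⊎ (∃[ d ] ∃₂ λ a b → Triple (G * v) d v a b × d v ≡ 𝐙))
two-cuts⇒triple 5≤n {G} prime {v} c c' = do
    q ← crossing-quadrants c c'
    q' ← crossing-quadrants c (cut-flip c')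
    return (combine q q')
  where
  open PrimeCuts 5≤n {G} prime
  module G′ = PrimeCuts 5≤n {G * v} (prime-lc {G = G} v prime)
  open Cut c using (side)
  open Cut c' using () renaming (side to side')
  Quadrant : Bool → Bool → Set
  Quadrant b b' = AtMostOne (λ u → u ≢ v × side u ≡ b × side' u ≡ b')
  combine : Quadrant true true ⊎ Quadrant false false →
    AtMostOne (λ u → u ≢ v × side u ≡ true × not (side' u) ≡ true) ⊎
    AtMostOne (λ u → u ≢ v × side u ≡ false × not (side' u) ≡ false) → _
  combine (inj₁ tt′) (inj₁ tf) = inj₁ (thin-side⇒triple c side' tt′
    λ x y (xv , sx , tx) (yv , sy , ty) → tf x y (xv , sx , cong not tx) (yv , sy , cong not ty))
  combine (inj₁ tt′) (inj₂ ft) = inj₂ (G′.thin-side⇒triple c' side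
    (λ x y (xv , sx , tx) (yv , sy , ty) → tt′ x y (xv , tx , sx) (yv , ty , sy))
    λ x y (xv , sx , tx) (yv , sy , ty) → ft x y (xv , tx , cong not sx) (yv , ty , cong not sy))
  combine (inj₂ ff) (inj₁ tf) = inj₂ (G′.thin-side⇒triple (cut-flip c') side
    (λ x y (xv , sx , tx) (yv , sy , ty) → tf x y (xv , tx , sx) (yv , ty , sy))
    λ x y (xv , sx , tx) (yv , sy , ty) → ff x y (xv , tx , 𝔹.not-injective sx) (yv , ty , 𝔹.not-injective sy))
  combine (inj₂ ff) (inj₂ ft) = inj₁ (thin-side⇒triple (cut-flip c) side'
    (λ x y (xv , sx , tx) (yv , sy , ty) → ft x y (xv , 𝔹.not-injective sx , cong not tx) (yv , 𝔹.not-injective sy , cong not ty))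
    λ x y (xv , sx , tx) (yv , sy , ty) → ff x y (xv , 𝔹.not-injective sx , tx) (yv , 𝔹.not-injective sy , ty))

-- Tutte's triangle lemma

⟂⇒line : ∀ l l' m → l ≢ 𝐈 → l' ≢ 𝐈 → m ≢ 𝐈 →
  (proj₁ l ∧ proj₁ m) xor (proj₂ l ∧ proj₂ m) ≡ false → (proj₁ l' ∧ proj₁ m) xor (proj₂ l' ∧ proj₂ m) ≡ false → l ≡ l'
⟂⇒line = dec! (∀ᵖ λ l → ∀ᵖ λ l' → ∀ᵖ λ m → ¬? (l ≟ᵖ 𝐈) →-dec (¬? (l' ≟ᵖ 𝐈) →-dec (¬? (m ≟ᵖ 𝐈) →-dec
  (((proj₁ l ∧ proj₁ m) xor (proj₂ l ∧ proj₂ m) 𝔹.≟ false) →-dec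
   (((proj₁ l' ∧ proj₁ m) xor (proj₂ l' ∧ proj₂ m) 𝔹.≟ false) →-dec (l ≟ᵖ l'))))))

-- In F₂² the vectors orthogonal to `x` form a line, so `c` is zero or equal to `y`; as `s` is
-- orthogonal to `y`, it is orthogonal to `c`.
no-bad-square : ∀ x s y c → x ≢ 𝐈 → y ≢ 𝐈 →
  proj₁ x ∧ proj₁ y ≡ proj₂ x ∧ proj₂ y → proj₁ x ∧ proj₁ c ≡ proj₂ x ∧ proj₂ c →
  proj₁ s ∧ proj₁ y ≡ proj₂ s ∧ proj₂ y → proj₁ s ∧ proj₁ c ≢ proj₂ s ∧ proj₂ c → ⊥
no-bad-square = dec! (∀ᵖ λ x → ∀ᵖ λ s → ∀ᵖ λ y → ∀ᵖ λ c → ¬? (x ≟ᵖ 𝐈) →-dec (¬? (y ≟ᵖ 𝐈) →-dec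
  ((proj₁ x ∧ proj₁ y 𝔹.≟ proj₂ x ∧ proj₂ y) →-dec ((proj₁ x ∧ proj₁ c 𝔹.≟ proj₂ x ∧ proj₂ c) →-dec
  ((proj₁ s ∧ proj₁ y 𝔹.≟ proj₂ s ∧ proj₂ y) →-dec (¬? (proj₁ s ∧ proj₁ c 𝔹.≟ proj₂ s ∧ proj₂ c) →-dec no id))))))

module PrimeRows {n : ℕ} (5≤n : 5 ≤ n) {G : Graph n} (prime : Prime G) where
  open PrimeGraph 5≤n {G} prime
  open PrimeCuts 5≤n {G} prime

  neighbours>1 : ∀ {x c} → x ≢ c → (∀ {u} → u ≢ x → u ≢ c → adj G x u ≡ false) → ⊥
  neighbours>1 {x} x≢c none = star-≢𝐈 G x (weight>2 x≢c (L-star G x) (λ ux uc → star-off G ux (none ux uc)) x)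

  neighbour : ∀ x → ∃[ u ] Adj G x u
  neighbour x with Fin.any? (λ u → adj G x u 𝔹.≟ true)
  ... | yes found = found
  ... | no none = ⊥-elim (neighbours>1 (proj₂ (other x)) λ {u} _ _ → 𝔹.¬-not λ xu → none (u , xu))

  -- The vertex `v` can join the `true` side, which turns the cut into a split of the whole graph.
  absorb-row : ∀ {v} (k : Cut G (_≡ v)) (r : Bool) →
    (∀ {y} → y ≢ v → Cut.side k y ≡ false → adj G v y ≡ r ∧ Cut.β k y) → ⊥
  absorb-row {v} k r rows = prime⇒no-cut {G = G} prime
      (cut side′ (two-map (λ (uv , su) → id , on uv su) left) (two-map (λ (uv , su) → id , on uv su) right)
        (λ u → if δ u v then r else α u) β λ {x} {y} _ _ → rk x y)
    where
    open Cut k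
    side′ : Fin n → Bool
    side′ u = if δ u v then true else side u
    on : ∀ {u s} → u ≢ v → side u ≡ s → side′ u ≡ s
    on {u} uv su = trans (cong (λ d → if d then true else side u) (δ-≢ uv)) su
    rk : ∀ x y → side′ x ≡ true → side′ y ≡ false → adj G x y ≡ (if δ x v then r else α x) ∧ β y
    rk x y sx sy with x ≟ v | y ≟ v
    ... | yes refl | no yv = rows yv sy
    ... | no xv | no yv = rank1 xv yv sx sy

  absorb : ∀ {v b} (k : Cut G (_≡ v)) → b ≢ v → Cut.side k b ≡ true →
    (∀ {y} → y ≢ v → Cut.side k y ≡ false → adj G v y ≡ adj G b y) → ⊥
  absorb {v} {b} k b≢v sb rows = absorb-row k (Cut.α k b) λ yv sy → trans (rows yv sy) (Cut.rank1 k b≢v yv sb sy)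

-- The part of the triangle lemma that concerns one of the two mixed regions; exchanging `a` with
-- `b` and the two splits gives the other (`Mirror`).
module TwinCuts {n : ℕ} (5≤n : 5 ≤ n) {G : Graph n} (prime : Prime G) {a b c : Fin n} (a≢b : a ≢ b) (a≢c : a ≢ c) (b≢c : b ≢ c)
  (twin : ∀ {u} → u ≢ a → u ≢ b → u ≢ c → adj G a u ≡ adj G b u) (k : Cut G (_≡ a)) (k' : Cut G (_≡ b))
  (kb : Cut.side k b ≡ true) (kc : Cut.side k c ≡ false) (k'a : Cut.side k' a ≡ true) (k'c : Cut.side k' c ≡ false) where
  open PrimeCuts 5≤n {G} prime
  open PrimeRows 5≤n {G} prime
  open Cut k
  open Cut k' using () renaming (side to side'; α to γ; β to ε; rank1 to rank1')

  Region : Bool → Bool → Fin n → Set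
  Region s t u = (u ≢ a × u ≢ b × u ≢ c) × side u ≡ s × side' u ≡ t

  region? : ∀ s t u → Dec (Region s t u)
  region? s t u = (¬? (u ≟ a) ×-dec (¬? (u ≟ b) ×-dec ¬? (u ≟ c))) ×-dec ((side u 𝔹.≟ s) ×-dec (side' u 𝔹.≟ t))

  inside : ∀ {s t u} → does (region? s t u) ≡ true → Region s t u
  inside {s} {t} {u} eq = decidable-stable (region? s t u) λ ¬r → true≢false (trans (sym eq) (dec-false (region? s t u) ¬r))

  outside : ∀ {s t u} → does (region? s t u) ≡ false → ¬ Region s t u
  outside {s} {t} {u} eq r = true≢false (trans (sym (dec-true (region? s t u) r)) eq)

  two-outside : ∀ s t → Two (λ u → does (region? s t u) ≡ false)
  two-outside s t = a , b , a≢b , dec-false (region? s t a) (λ r → proj₁ (proj₁ r) refl)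
                                , dec-false (region? s t b) (λ r → proj₁ (proj₂ (proj₁ r)) refl)

  small : {T : Set} (0# : T) (_≟ᵀ_ : (s t : T) → Dec (s ≡ t)) (s t : Bool) (ℓ : Fin n → T) →
    (∀ {x y} → Region s t x → ¬ Region s t y → ℓ x ≡ 0# → adj G x y ≡ false) →
    (∀ {x x' y} → Region s t x → Region s t x' → ¬ Region s t y → ℓ x ≡ ℓ x' → adj G x y ≡ adj G x' y) →
    (∀ {x x'} → Region s t x → Region s t x' → ℓ x ≢ 0# → ℓ x' ≢ 0# → ℓ x ≡ ℓ x') → AtMostOne (Region s t)
  small 0# _≟ᵀ_ s t ℓ zero-row same-row on-line x y rx ry =
    on-line⇒small 0# _≟ᵀ_ ℓ (does ∘ region? s t) (λ p q → zero-row (inside p) (outside q))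
      (λ p p' q → same-row (inside p) (inside p') (outside q)) (λ p p' → on-line (inside p) (inside p'))
      (two-outside s t) x y (dec-true (region? s t x) rx) (dec-true (region? s t y) ry)

  lin : Pauli → Pauli → Bool
  lin l m = (proj₁ l ∧ proj₁ m) xor (proj₂ l ∧ proj₂ m)

  lin₁ : ∀ l k → proj₁ l ∧ k ≡ lin l (k , false)
  lin₁ = dec! (∀ᵖ λ l → ∀ᵇ λ k → (proj₁ l ∧ k) 𝔹.≟ lin l (k , false))

  lin₂ : ∀ l k → proj₂ l ∧ k ≡ lin l (false , k)
  lin₂ = dec! (∀ᵖ λ l → ∀ᵇ λ k → (proj₂ l ∧ k) 𝔹.≟ lin l (false , k))

  label : Fin n → Pauli
  label x = β x , γ x

  private
    vec : Fin n → Pauli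
    vec y = if δ y a then (α b , false) else if side y then (α y , false) else (false , ε y)

    row : ∀ {x y} → Region false true x → ¬ Region false true y → adj G x y ≡ lin (label x) (vec y)
    row {x} {y} ((xa , xb , xc) , sx , sx') out with y ≟ a | side y in sy
    -- The split at `a` says nothing about the row of `a`; its twin `b` stands in.
    ... | yes refl | _ = trans (adj-sym G x a) (trans (twin xa xb xc) (trans (adj-sym G b x)
                           (trans (rank1ᵀ k xa (a≢b ∘ sym) sx kb) (lin₁ (label x) (α b)))))
    ... | no ya | true = trans (rank1ᵀ k xa ya sx sy) (lin₁ (label x) (α y))
    ... | no ya | false = trans (rank1' xb yb sx' sy') (lin₂ (label x) (ε y))
      where
      yb : y ≢ b
      yb refl = true≢false (trans (sym kb) sy)
      sy' : side' y ≡ false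
      sy' = case y ≟ c of λ where
        (yes refl) → k'c
        (no yc) → 𝔹.¬-not λ sy' → out ((ya , yb , yc) , refl , sy')

    zero-row : ∀ {x y} → Region false true x → ¬ Region false true y → label x ≡ 𝐈 → adj G x y ≡ false
    zero-row {y = y} r out eq = trans (row r out) (cong (λ l → lin l (vec y)) eq)

    same-row : ∀ {x x' y} → Region false true x → Region false true x' → ¬ Region false true y → label x ≡ label x' →
      adj G x y ≡ adj G x' y
    same-row {y = y} r r' out eq = trans (row r out) (trans (cong (λ l → lin l (vec y)) eq) (sym (row r' out)))

  -- If all labels were zero, no edge would leave the region; it would then be a single isolated
  -- vertex.
  nonzero-label : ∀ {x} → Region false true x → ∃[ x ] Region false true x × label x ≢ 𝐈
  nonzero-label {x₀} r₀ with Fin.any? (λ x → region? false true x ×-dec ¬? (label x ≟ᵖ 𝐈))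
  ... | yes found = found
  ... | no none = ⊥-elim (neighbours>1 (proj₁ (proj₁ r₀)) λ {u} ux ua → zero-row r₀ (λ ru → ux (sym (one x₀ u r₀ ru))) (all-zero r₀))
    where
    all-zero : ∀ {x} → Region false true x → label x ≡ 𝐈
    all-zero {x} r = decidable-stable (label x ≟ᵖ 𝐈) λ l≢ → none (x , r , l≢)
    one : AtMostOne (Region false true)
    one = small 𝐈 _≟ᵖ_ false true label zero-row same-row
      λ r _ l≢ _ → ⊥-elim (l≢ (all-zero r))

  opposite⇒small : ∀ {y} → Region true false y → (α y , ε y) ≢ 𝐈 → AtMostOne (Region false true)
  opposite⇒small {y} ((ya , yb , yc) , sy , sy') ≢𝐈 = small 𝐈 _≟ᵖ_ false true label zero-row same-row
      λ {x} {x'} r r' l≢ l'≢ → ⟂⇒line (label x) (label x') (α y , ε y) l≢ l'≢ ≢𝐈 (orth r) (orth r')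
    where
    orth : ∀ {x} → Region false true x → lin (label x) (α y , ε y) ≡ false
    orth {x} ((xa , xb , xc) , sx , sx') = trans (cong₂ _xor_ (sym (rank1ᵀ k xa ya sx sy)) (sym (rank1' xb yb sx' sy')))
      (𝔹.xor-same (adj G x y))

-- Tutte's triangle lemma: with the splits (A₁, A₂) of G∖a and (B₁, B₂) of G∖b separating b resp. a from c, the
-- remaining vertices fall into four regions; the rows of A₂ ∩ B₁ and A₁ ∩ B₂ are governed by mutually orthogonal
-- labels in F₂², and one of A₁ ∩ B₁, A₂ ∩ B₂ must be empty.
module Triangle {n : ℕ} (5≤n : 5 ≤ n) {G : Graph n} (prime : Prime G) {a b c : Fin n} (a≢b : a ≢ b) (a≢c : a ≢ c) (b≢c : b ≢ c)
  (twin : ∀ {u} → u ≢ a → u ≢ b → u ≢ c → adj G a u ≡ adj G b u) (apart : adj G a c ≢ adj G b c)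
  (k : Cut G (_≡ a)) (k' : Cut G (_≡ b))
  (kb : Cut.side k b ≡ true) (kc : Cut.side k c ≡ false) (k'a : Cut.side k' a ≡ true) (k'c : Cut.side k' c ≡ false)
  (no𝐙 : ∀ {d p q} → Triple G d a p q → d a ≢ 𝐙) where
  open PrimeGraph 5≤n {G} prime
  open PrimeCuts 5≤n {G} prime
  open PrimeRows 5≤n {G} prime
  open TwinCuts 5≤n {G} prime a≢b a≢c b≢c twin k k' kb kc k'a k'c
  module Mirror = TwinCuts 5≤n {G} prime (a≢b ∘ sym) b≢c a≢c (λ ub ua uc → sym (twin ua ub uc)) k' k k'a k'c kb kc
  open Cut k
  open Cut k' using () renaming (side to side'; α to γ; β to ε; rank1 to rank1'; left to left'; right to right')

  mirror : ∀ {s t u} → Region s t u → Mirror.Region t s u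
  mirror ((ua , ub , uc) , s , t) = (ub , ua , uc) , t , s

  unmirror : ∀ {s t u} → Mirror.Region t s u → Region s t u
  unmirror ((ub , ua , uc) , t , s) = (ua , ub , uc) , s , t

  -- The letters C, D, F, I stand for A₁ ∩ B₁, A₂ ∩ B₁, A₁ ∩ B₂, A₂ ∩ B₂. A nonempty F has a nonzero
  -- label, and orthogonality to it puts the labels of D on a line.
  F⇒D-small : ∀ {y} → Region true false y → AtMostOne (Region false true)
  F⇒D-small r = let y , r' , ≢𝐈 = Mirror.nonzero-label (mirror r)
                in opposite⇒small (unmirror r') λ eq → ≢𝐈 (cong (λ (s , z) → z , s) eq)

  D⇒F-small : ∀ {x} → Region false true x → AtMostOne (Region true false)
  D⇒F-small r x y rx ry = let z , r' , ≢𝐈 = nonzero-label r in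
    Mirror.opposite⇒small (mirror r') (λ eq → ≢𝐈 (cong (λ (s , z) → z , s) eq)) x y (mirror rx) (mirror ry)

  no-side-pair : ∀ {s x y} → (∀ {u} → u ≢ a → side u ≡ s → u ≡ x ⊎ u ≡ y) → x ≢ y → x ≢ a → y ≢ a → side x ≡ s → side y ≡ s → ⊥
  no-side-pair {true} only xy xa ya sx sy = let d , t , d𝐙 = small-side⇒triple k xy xa ya sx sy only in no𝐙 t d𝐙
  no-side-pair {false} only xy xa ya sx sy =
    let d , t , d𝐙 = small-side⇒triple (cut-flip k) xy xa ya (cong not sx) (cong not sy) (λ ua su → only ua (𝔹.not-injective su)) in no𝐙 t d𝐙

  -- If A₂ ∩ B₂ is empty then A₂ = {c, x}.
  I-nonempty : (∀ {u} → ¬ Region false false u) → ⊥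
  I-nonempty empty = no-side-pair only (proj₂ (proj₂ (proj₁ rx)) ∘ sym) (a≢c ∘ sym) (proj₁ (proj₁ rx)) kc (proj₁ (proj₂ rx))
    where
    pick-F : ∃[ y ] Region true false y
    pick-F with right'
    ... | p , q , p≢q , (pb , sp) , (qb , sq) = case p ≟ c of λ where
        (no pc) → p , go pb pc sp
        (yes refl) → q , go qb (p≢q ∘ sym) sq
      where
      go : ∀ {u} → u ≢ b → u ≢ c → side' u ≡ false → Region true false u
      go {u} ub uc su' = (ua , ub , uc) , 𝔹.¬-not (λ su → empty ((ua , ub , uc) , su , su')) , su'
        where ua = λ { refl → true≢false (trans (sym k'a) su') }
    D-elem : ∀ {u} → u ≢ a → u ≢ c → side u ≡ false → Region false true u
    D-elem {u} ua uc su = (ua , ub , uc) , su , 𝔹.¬-not (λ su' → empty ((ua , ub , uc) , su , su'))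
      where ub = λ { refl → true≢false (trans (sym kb) su) }
    pick-D : ∃[ x ] Region false true x
    pick-D with right
    ... | p , q , p≢q , (pa , sp) , (qa , sq) = case p ≟ c of λ where
        (no pc) → p , D-elem pa pc sp
        (yes refl) → q , D-elem qa (p≢q ∘ sym) sq
    x = proj₁ pick-D
    rx = proj₂ pick-D
    only : ∀ {u} → u ≢ a → side u ≡ false → u ≡ c ⊎ u ≡ x
    only {u} ua su = case u ≟ c of λ where
      (yes eq) → inj₁ eq
      (no uc) → inj₂ (F⇒D-small (proj₂ pick-F) u x (D-elem ua uc su) rx)

  -- If A₁ ∩ B₁ is empty then A₁ = {b, x}.
  C-nonempty : (∀ {u} → ¬ Region true true u) → ⊥
  C-nonempty empty = no-side-pair only (proj₁ (proj₂ (proj₁ rx)) ∘ sym) (a≢b ∘ sym) (proj₁ (proj₁ rx)) kb (proj₁ (proj₂ rx))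
    where
    pick-D : ∃[ y ] Region false true y
    pick-D with left'
    ... | p , q , p≢q , (pb , sp) , (qb , sq) = case p ≟ a of λ where
        (no pa) → p , go pb pa sp
        (yes refl) → q , go qb (p≢q ∘ sym) sq
      where
      go : ∀ {u} → u ≢ b → u ≢ a → side' u ≡ true → Region false true u
      go {u} ub ua su' = (ua , ub , uc) , 𝔹.¬-not (λ su → empty ((ua , ub , uc) , su , su')) , su'
        where uc = λ { refl → true≢false (trans (sym su') k'c) }
    F-elem : ∀ {u} → u ≢ a → u ≢ b → side u ≡ true → Region true false u
    F-elem {u} ua ub su = (ua , ub , uc) , su , 𝔹.¬-not (λ su' → empty ((ua , ub , uc) , su , su'))
      where uc = λ { refl → true≢false (trans (sym su) kc) }
    pick-F : ∃[ x ] Region true false x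
    pick-F with left
    ... | p , q , p≢q , (pa , sp) , (qa , sq) = case p ≟ b of λ where
        (no pb) → p , F-elem pa pb sp
        (yes refl) → q , F-elem qa (p≢q ∘ sym) sq
    x = proj₁ pick-F
    rx = proj₂ pick-F
    only : ∀ {u} → u ≢ a → side u ≡ true → u ≡ b ⊎ u ≡ x
    only {u} ua su = case u ≟ b of λ where
      (yes eq) → inj₁ eq
      (no ub) → inj₂ (D⇒F-small (proj₂ pick-D) u x (F-elem ua ub su) rx)

  -- With zero labels only `c` can be adjacent to A₂ ∩ B₂ from outside, so this region has at most
  -- one vertex, and that vertex would have no neighbour but `c`. Hence the region is empty.
  I-zero⇒⊥ : (∀ {y} → Region false false y → (β y , ε y) ≡ 𝐈) → ⊥
  I-zero⇒⊥ zero-label = I-nonempty λ {u} r → neighbours>1 (proj₂ (proj₂ (proj₁ r)))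
      λ {w} wu wc → row r (λ rw → wu (sym (one u w r rw))) wc
    where
    row : ∀ {x y} → Region false false x → ¬ Region false false y → y ≢ c → adj G x y ≡ false
    row {x} {y} r@((xa , xb , xc) , sx , sx') out yc with zero-label r
    ... | eq = value-at (adj G x) row-a λ ya →
          case side y 𝔹.≟ true of λ where
            (yes sy) → trans (rank1ᵀ k xa ya sx sy) (cong (_∧ α y) (cong proj₁ eq))
            (no sy) → by-side' ya (𝔹.¬-not sy)
      where
      row-a : adj G x a ≡ false
      row-a = trans (rank1ᵀ k' xb a≢b sx' k'a) (cong (_∧ γ a) (cong proj₂ eq))
      by-side' : y ≢ a → side y ≡ false → adj G x y ≡ false
      by-side' ya sy = trans (rank1ᵀ k' xb yb sx' (𝔹.¬-not λ sy' → out ((ya , yb , yc) , sy , sy'))) (cong (_∧ γ y) (cong proj₂ eq))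
        where yb = λ { refl → true≢false (trans (sym kb) sy) }
    one : AtMostOne (Region false false)
    one = small false 𝔹._≟_ false false (λ x → adj G x c)
      (λ {x} {y} r out eq → value-at (adj G x) eq (row r out))
      (λ {x} {x'} {y} r r' out eq → by-cases {P = λ y → adj G x y ≡ adj G x' y} eq λ yc → trans (row r out yc) (sym (row r' out yc)))
      λ _ _ → ≢false⇒≡

  -- With zero labels only `a` and `b` can be adjacent to A₁ ∩ B₁ from outside, and they have the
  -- same neighbours in it. So it has at most one vertex, whose star would be a triple with
  -- direction Z at `a`.
  C-zero⇒⊥ : (∀ {y} → Region true true y → (α y , γ y) ≡ 𝐈) → ⊥
  C-zero⇒⊥ zero-label = C-nonempty λ {u} r →
      let ua , ub , uc = proj₁ r
          t = to-triple (ua ∘ sym) a≢b ub (L-star G u)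
                (λ {w} wa wu wb → star-off G wu (row r (λ rw → wu (sym (one u w r rw))) wa wb)) (star-≢𝐈 G u)
      in no𝐙 t (S≡false⇒𝐙 _ (at₁ t) (δ-≢ ua))
    where
    row : ∀ {x y} → Region true true x → ¬ Region true true y → y ≢ a → y ≢ b → adj G x y ≡ false
    row {x} {y} r@((xa , xb , xc) , sx , sx') out ya yb with zero-label r
    ... | eq = case side y 𝔹.≟ false of λ where
        (yes sy) → trans (rank1 xa ya sx sy) (cong (_∧ β y) (cong proj₁ eq))
        (no sy) → let sy = 𝔹.¬-not sy in
          trans (rank1' xb yb sx' (𝔹.¬-not λ sy' → out ((ya , yb , λ { refl → true≢false (trans (sym sy) kc) }) , sy , sy')))
            (cong (_∧ ε y) (cong proj₂ eq))
    one : AtMostOne (Region true true)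
    one = small false 𝔹._≟_ true true (adj G a)
      (λ {x} {y} r out eq → value-at (adj G x) (trans (adj-sym G x a) eq) λ ya →
        value-at (adj G x) (trans (adj-sym G x b) (trans (sym (twin′ r)) eq)) (row r out ya))
      (λ {x} {x'} {y} r r' out eq → by-cases {P = λ y → adj G x y ≡ adj G x' y} (trans (adj-sym G x a) (trans eq (adj-sym G a x'))) λ ya →
        by-cases {P = λ y → adj G x y ≡ adj G x' y}
          (trans (adj-sym G x b) (trans (sym (twin′ r)) (trans eq (trans (twin′ r') (adj-sym G b x')))))
          λ yb → trans (row r out ya yb) (sym (row r' out ya yb)))
      λ _ _ → ≢false⇒≡
      where
      twin′ : ∀ {x} → Region true true x → adj G a x ≡ adj G b x
      twin′ ((xa , xb , xc) , _) = twin xa xb xc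

  -- For `x` in A₁ ∩ B₁ and `y` in A₂ ∩ B₂ with nonzero labels, adjacency is read off from both
  -- splits, with `b` representing the twins in the first and `a` in the second. The readings agree
  -- for `x` with `y`, `x` with `c` and the twins with `y`, but by `apart` not for the twins with
  -- `c`.
  contradiction : ⊥
  contradiction with Fin.any? (λ x → region? true true x ×-dec ¬? ((α x , γ x) ≟ᵖ 𝐈))
  ... | no none = C-zero⇒⊥ λ {x} r → decidable-stable (_ ≟ᵖ 𝐈) λ l≢ → none (x , r , l≢)
  ... | yes (x , ((xa , xb , xc) , sx , sx') , x≢) = I-zero⇒⊥ λ {y} ((ya , yb , yc) , sy , sy') →
      decidable-stable (_ ≟ᵖ 𝐈) λ y≢ → no-bad-square (α x , γ x) (α b , γ a) (β y , ε y) (β c , ε c) x≢ y≢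
        (trans (sym (rank1 xa ya sx sy)) (rank1' xb yb sx' sy'))
        (trans (sym (rank1 xa (a≢c ∘ sym) sx kc)) (rank1' xb (b≢c ∘ sym) sx' k'c))
        (trans (sym (rank1 (a≢b ∘ sym) ya kb sy)) (trans (sym (twin ya yb yc)) (rank1' a≢b yb k'a sy')))
        λ eq → apart (trans (rank1' a≢b (b≢c ∘ sym) k'a k'c) (trans (sym eq) (sym (rank1 (a≢b ∘ sym) (a≢c ∘ sym) kb kc))))

-- Essential vertices

-- The minor of G at v in direction p is not prime (Z: deletion, Y: deletion after local
-- complementation at v, X: contraction).
Bad : Graph n → Fin n → Pauli → Set
Bad G v p = ∃[ us ] τ* G us v p ≡ 𝐙 × Cut (G ⋆ us) (_≡ v)

Essential : Graph n → Fin n → Set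
Essential G v = ∃₂ λ p q → p ≢ q × p ≢ 𝐈 × q ≢ 𝐈 × Bad G v p × Bad G v q

bad⇒cut : {G : Graph n} {v : Fin n} {p : Pauli} → Bad G v p → (ws : List (Fin n)) → τ* G ws v p ≡ 𝐙 → Cut (G ⋆ ws) (_≡ v)
bad⇒cut {G = G} (us , us𝐙 , k) ws ws𝐙 = cut-transport G us ws us𝐙 ws𝐙 k

τ-𝐘 : (G : Graph n) (v : Fin n) → τ G v v 𝐘 ≡ 𝐙
τ-𝐘 G v = cong₂ (λ e m → act e m 𝐘) (δ-refl v) (adj-irr G v)

τ-pivot-𝐗 : (G : Graph n) {v w : Fin n} → Adj G v w → τ* G (v ∷ w ∷ v ∷ []) v 𝐗 ≡ 𝐙
τ-pivot-𝐗 G {v} {w} vw = trans (cong (τ (G * v * w) v v ∘ τ (G * v) w v) (cong₂ (λ e m → act e m 𝐗) (δ-refl v) (adj-irr G v)))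
  (trans (cong (τ (G * v * w) v v) (cong₂ (λ e m → act e m 𝐗) (δ-≢ w≢v) (trans (adj-sym (G * v) w v) (trans (lcAdj-self G v w) vw))))
    (τ-𝐘 (G * v * w) v))
  where
  w≢v : w ≢ v
  w≢v refl = true≢false (trans (sym vw) (adj-irr G v))

¬nonessential⇒essential : {G : Graph n} → 5 ≤ n → Prime G → ∀ v → ¬ NonEssential G v → M (Essential G v)
¬nonessential⇒essential {suc n} {G} 5≤n prime v ¬ne = do
  z? ← excluded-middle (Split (delete G v))
  y? ← excluded-middle (Split (delete (G * v) v))
  x? ← excluded-middle (Split (delete (pivot G v w) v))
  return (decide z? y? x?)
  where
  open PrimeRows 5≤n {G} prime
  w = proj₁ (neighbour v)
  vw = proj₂ (neighbour v)
  bad-z : Split (delete G v) → Bad G v 𝐙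
  bad-z s = [] , refl , split-delete⇒cut s
  bad-y : Split (delete (G * v) v) → Bad G v 𝐘
  bad-y s = v ∷ [] , τ-𝐘 G v , split-delete⇒cut s
  bad-x : Split (delete (pivot G v w) v) → Bad G v 𝐗
  bad-x s = v ∷ w ∷ v ∷ [] , τ-pivot-𝐗 G vw , split-delete⇒cut s
  decide : Dec (Split (delete G v)) → Dec (Split (delete (G * v) v)) → Dec (Split (delete (pivot G v w) v)) → Essential G v
  decide (yes z) (yes y) _ = 𝐙 , 𝐘 , (λ ()) , (λ ()) , (λ ()) , bad-z z , bad-y y
  decide (yes z) (no _) (yes x) = 𝐙 , 𝐗 , (λ ()) , (λ ()) , (λ ()) , bad-z z , bad-x x
  decide (no _) (yes y) (yes x) = 𝐘 , 𝐗 , (λ ()) , (λ ()) , (λ ()) , bad-y y , bad-x x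
  decide (no z) (no y) _ = ⊥-elim (¬ne (inj₁ (z , y)))
  decide (no z) (yes _) (no x) = ⊥-elim (¬ne (inj₂ (inj₁ (z , inj₂ (w , vw , x)))))
  decide (yes _) (no y) (no x) = ⊥-elim (¬ne (inj₂ (inj₂ (y , inj₂ (w , vw , x)))))

Double : Graph n → Fin n → Set
Double G v = ∃₂ λ d d' → (∃₂ λ p q → Triple G d v p q) × (∃₂ λ p q → Triple G d' v p q) × d v ≢ d' v

-- Two directions carrying triples give two minors with splits, whereas a non-essential vertex has
-- at most one such minor.
double⇒¬nonessential : {G : Graph n} → 5 ≤ n → Prime G → ∀ {v} → Double G v → ¬ NonEssential G v
double⇒¬nonessential {suc n} {G} 5≤n prime {v} (d , d' , (_ , _ , t) , (_ , _ , t') , dv≢) = λ where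
    (inj₁ (z , y)) → no𝐙𝐘 _ _ (at₁ t) (at₁ t') (not𝐙 z t) (not𝐙 z t') (not𝐘 y t) (not𝐘 y t') dv≢
    (inj₂ (inj₁ (z , x))) → no𝐙𝐗 _ _ (at₁ t) (at₁ t') (not𝐙 z t) (not𝐙 z t') (not𝐗 x t) (not𝐗 x t') dv≢
    (inj₂ (inj₂ (y , x))) → no𝐘𝐗 _ _ (at₁ t) (at₁ t') (not𝐘 y t) (not𝐘 y t') (not𝐗 x t) (not𝐗 x t') dv≢
  where
  open PrimeRows 5≤n {G} prime
  exclude : (r r' : Pauli) → Dec (∀ p q → p ≢ 𝐈 → q ≢ 𝐈 → p ≢ r → q ≢ r → p ≢ r' → q ≢ r' → p ≢ q → ⊥)
  exclude r r' = ∀ᵖ λ p → ∀ᵖ λ q → ¬? (p ≟ᵖ 𝐈) →-dec (¬? (q ≟ᵖ 𝐈) →-dec (¬? (p ≟ᵖ r) →-dec (¬? (q ≟ᵖ r) →-dec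
    (¬? (p ≟ᵖ r') →-dec (¬? (q ≟ᵖ r') →-dec (¬? (p ≟ᵖ q) →-dec no id))))))
  no𝐙𝐘 = dec! (exclude 𝐙 𝐘)
  no𝐙𝐗 = dec! (exclude 𝐙 𝐗)
  no𝐘𝐗 = dec! (exclude 𝐘 𝐗)
  not𝐙 : ∀ {e p q} → Prime (delete G v) → Triple G e v p q → e v ≢ 𝐙
  not𝐙 z s ev = z (cut⇒split-delete (triple-𝐙⇒cut 5≤n s ev))
  not𝐘 : ∀ {e p q} → Prime (delete (G * v) v) → Triple G e v p q → e v ≢ 𝐘
  not𝐘 y s ev = y (cut⇒split-delete (triple-𝐙⇒cut 5≤n (triple-τ* (v ∷ []) s) (trans (cong (τ G v v) ev) (τ-𝐘 G v))))
  not𝐗 : ∀ {e p q} → ContractPrime G v → Triple G e v p q → e v ≢ 𝐗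
  not𝐗 (inj₁ (isolated , _)) s ev = true≢false (trans (sym (proj₂ (neighbour v))) (isolated _))
  not𝐗 (inj₂ (w , vw , x)) s ev = x (cut⇒split-delete
    (triple-𝐙⇒cut 5≤n (triple-τ* (v ∷ w ∷ v ∷ []) s) (trans (cong (τ* G (v ∷ w ∷ v ∷ []) v) ev) (τ-pivot-𝐗 G vw))))

-- Frames prescribed at a few vertices

assign : List (Fin n × Pauli) → Fin n → Maybe Pauli
assign [] v = nothing
assign ((w , p) ∷ l) v = if does (w ≟ v) then just p else assign l v

assign-∉ : (l : List (Fin n × Pauli)) (v : Fin n) → v ∉ map proj₁ l → assign l v ≡ nothing
assign-∉ [] v v∉ = refl
assign-∉ ((w , p) ∷ l) v v∉ with w ≟ v
... | yes refl = ⊥-elim (v∉ (here refl))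
... | no _ = assign-∉ l v (v∉ ∘ there)

assign-≢𝐈 : (l : List (Fin n × Pauli)) → All (λ (_ , p) → p ≢ 𝐈) l → ∀ v → assign l v ≢ just 𝐈
assign-≢𝐈 ((w , p) ∷ l) (p≢ ∷ ps) v with w ≟ v
... | yes _ = p≢ ∘ Maybe.just-injective
... | no _ = assign-≢𝐈 l ps v

assign-∈ : (l : List (Fin n × Pauli)) → Unique (map proj₁ l) → All (λ (v , p) → assign l v ≡ just p) l
assign-∈ [] [] = []
assign-∈ ((w , p) ∷ l) (w∉ ∷ unique) = head ∷ tail l w∉ (assign-∈ l unique)
  where
  head : assign ((w , p) ∷ l) w ≡ just p
  head rewrite δ-refl w = refl
  tail : ∀ m → All (w ≢_) (map proj₁ m) → All (λ (v , q) → assign l v ≡ just q) m →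
    All (λ (v , q) → assign ((w , p) ∷ l) v ≡ just q) m
  tail [] [] [] = []
  tail ((v , q) ∷ m) (w≢v ∷ w≢) (eq ∷ eqs) = trans (cong (λ b → if b then just p else assign l v) (δ-≢ w≢v)) eq ∷ tail m w≢ eqs

opaque
  -- This is `rotation` with directions prescribed on a list; all others are free, so an obstruction
  -- vanishes off the list.
  frame : (G : Graph n) (l : List (Fin n × Pauli)) → Unique (map proj₁ l) → All (λ (_ , p) → p ≢ 𝐈) l →
    (∀ {d} → L G d → (∀ {v} → v ∉ map proj₁ l → d v ≡ 𝐈) → All (λ (v , p) → d v ≡ 𝐈 ⊎ d v ≡ p) l → ∀ v → d v ≡ 𝐈) →
    ∃[ us ] All (λ (v , p) → τ* G us v p ≡ 𝐙) l
  frame G l unique ≢𝐈 unobstructed =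
    let us , to𝐙 , _ = rotation G (assign l) (assign-≢𝐈 l ≢𝐈) λ d d∈ on →
          unobstructed d∈
            (λ {v} v∉ → [ id , (λ eq → case trans eq (assign-∉ l v v∉) of λ ()) ]′ (on v))
            (All.map (λ {(v , p)} eq → [ inj₁ , (λ eq' → inj₂ (Maybe.just-injective (trans eq' eq))) ]′ (on v)) (assign-∈ l unique))
    in us , All.map (λ {(v , p)} eq → to𝐙 v eq) (assign-∈ l unique)

τ*-≢𝐈 : {G : Graph n} (us : List (Fin n)) {v : Fin n} {p : Pauli} → p ≢ 𝐈 → τ* G us v p ≢ 𝐈
τ*-≢𝐈 {G = G} us {v} p≢ eq = p≢ (τ*-injective G us v (trans eq (sym (τ*-𝐈 G us v))))

-- The two bad directions at v are rotated to deletion and deletion after local complementation.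
essential⇒triple : {G : Graph n} → 5 ≤ n → Prime G → ∀ {v} → Essential G v → M (∃[ d ] ∃₂ λ a b → Triple G d v a b)
essential⇒triple {n} {G} 5≤n prime {v} (p , q , p≢q , p≢𝐈 , q≢𝐈 , bad-p , bad-q) =
  by-direction (τ* G us v q) refl
  where
  open PrimeGraph 5≤n {G} prime
  framed = frame G ((v , p) ∷ []) ([] ∷ []) (p≢𝐈 ∷ [])
    λ d∈ o _ → weight>2 (proj₂ (other v)) d∈ λ uv _ → o λ { (here eq) → uv eq }
  us = proj₁ framed
  p𝐙 : τ* G us v p ≡ 𝐙
  p𝐙 = case proj₂ framed of λ { (eq ∷ []) → eq }
  finish : ∀ ws → τ* G ws v p ≡ 𝐙 → τ* G ws v q ≡ 𝐘 → M (∃[ d ] ∃₂ λ a b → Triple G d v a b)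
  finish ws pz qy = do
    r ← two-cuts⇒triple 5≤n {G ⋆ ws} (prime-⋆ ws {G} prime) (bad⇒cut bad-p ws pz)
          (subst (λ K → Cut K (_≡ v)) (⋆-++ G ws (v ∷ []))
            (bad⇒cut bad-q (ws ++ v ∷ []) (trans (τ*-++ G ws (v ∷ []) v q) (trans (cong (τ (G ⋆ ws) v v) qy) (τ-𝐘 (G ⋆ ws) v)))))
    return (case r of λ where
      (inj₁ (d , a , b , t , _)) → _ , a , b , triple-τ*⁻¹ ws t
      (inj₂ (d , a , b , t , _)) → _ , a , b , triple-τ*⁻¹ ws (triple-τ*⁻¹ {G = G ⋆ ws} (v ∷ []) t))
  by-direction : ∀ r → τ* G us v q ≡ r → M (∃[ d ] ∃₂ λ a b → Triple G d v a b)
  by-direction 𝐈 eq = ⊥-elim (τ*-≢𝐈 us q≢𝐈 eq)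
  by-direction 𝐙 eq = ⊥-elim (p≢q (τ*-injective G us v (trans p𝐙 (sym eq))))
  by-direction 𝐘 eq = finish us p𝐙 eq
  -- Complementation at a neighbour `w` of `v` turns X into Y at `v` and keeps Z.
  by-direction 𝐗 eq = finish (us ++ w ∷ [])
      (trans (τ*-++ G us (w ∷ []) v p) (trans (cong (τ H w v) p𝐙) (τ-𝐙 H w≢v)))
      (trans (τ*-++ G us (w ∷ []) v q) (trans (cong (τ H w v) eq) (cong₂ (λ e m → act e m 𝐗) (δ-≢ w≢v) (trans (adj-sym H w v) vw))))
    where
    H = G ⋆ us
    open PrimeRows 5≤n {H} (prime-⋆ us {G} prime)
    w = proj₁ (neighbour v)
    vw = proj₂ (neighbour v)
    w≢v : w ≢ v
    w≢v eq = true≢false (trans (sym vw) (trans (cong (adj H v) eq) (adj-irr H v)))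

xor-≡ : ∀ f g → f xor g ≡ false → f ≡ g
xor-≡ = dec! (∀ᵇ λ f → ∀ᵇ λ g → (f xor g 𝔹.≟ false) →-dec (f 𝔹.≟ g))

≢𝐙⇒S : ∀ r → r ≢ 𝐈 → r ≢ 𝐙 → proj₁ r ≡ true
≢𝐙⇒S = dec! (∀ᵖ λ r → ¬? (r ≟ᵖ 𝐈) →-dec (¬? (r ≟ᵖ 𝐙) →-dec (proj₁ r 𝔹.≟ true)))

pair-row : {H : Graph n} → ∀ {d a b c} → Triple H d a b c → S d a ≡ true → S d b ≡ true → S d c ≡ false →
  ∀ u → Z d u ≡ adj H a u xor adj H b u
pair-row {H = H} {d} {a} {b} {c} t Sa Sb Sc u = begin
  Z d u
    ≡⟨ Z≡ (mem t) u ⟩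
  sum (λ v → S d v ∧ adj H v u)
    ≡⟨ sum-supp₃ _ (a≢b t) (a≢c t) (b≢c t) (λ v va vb vc → cong (λ r → proj₁ r ∧ adj H v u) (off t va vb vc)) ⟩
  (S d a ∧ adj H a u) xor ((S d b ∧ adj H b u) xor (S d c ∧ adj H c u))
    ≡⟨ cong₂ (λ s e → (s ∧ adj H a u) xor e) Sa (cong₂ (λ s s' → (s ∧ adj H b u) xor (s' ∧ adj H c u)) Sb Sc) ⟩
  adj H a u xor (adj H b u xor false)
    ≡⟨ cong (adj H a u xor_) (𝔹.xor-identityʳ _) ⟩
  adj H a u xor adj H b u ∎
  where open ≡-Reasoning

-- Bad directions at `a` and `b` other than those of `t`, and the direction of `t` at `c`, are
-- rotated to Z. Then `t` makes `a` and `b` twins except at `c`, the setting of `Triangle`, where a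
-- triple with direction Z at `a` would be the one sought.
triangle : {G : Graph n} → 5 ≤ n → Prime G → ∀ {t a b c} → Triple G t a b c → Essential G a → Essential G b →
  M (∃[ d ] ∃₂ λ p q → Triple G d a p q × d a ≢ t a)
triangle {n} {G} 5≤n prime {t} {a} {b} {c} T ess-a ess-b none =
  Triangle.contradiction 5≤n {H} prime-H (a≢b T) (a≢c T) (b≢c T) twin apart k̂ k̂' kb kc k'a k'c no𝐙
  where
  open PrimeGraph 5≤n {G} prime
  other-bad : ∀ {v} → Essential G v → ∀ r → ∃[ p ] p ≢ r × p ≢ 𝐈 × Bad G v p
  other-bad (p , q , p≢q , p≢𝐈 , q≢𝐈 , bad-p , bad-q) r = case p ≟ᵖ r of λ where
    (yes p≡r) → q , (λ q≡r → p≢q (trans p≡r (sym q≡r))) , q≢𝐈 , bad-q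
    (no p≢r) → p , p≢r , p≢𝐈 , bad-p
  p = proj₁ (other-bad ess-a (t a))
  q = proj₁ (other-bad ess-b (t b))
  p≢ = proj₁ (proj₂ (other-bad ess-a (t a)))
  q≢ = proj₁ (proj₂ (other-bad ess-b (t b)))
  framed = frame G ((a , p) ∷ (b , q) ∷ (c , t c) ∷ []) ((a≢b T ∷ a≢c T ∷ []) ∷ (b≢c T ∷ []) ∷ [] ∷ [])
    (proj₁ (proj₂ (proj₂ (other-bad ess-a (t a)))) ∷ proj₁ (proj₂ (proj₂ (other-bad ess-b (t b)))) ∷ at₃ T ∷ [])
    -- An obstruction would be a triple on `a`, `b`, `c`, hence equal to `t`, but `t` has another
    -- direction at `a`.
    λ { {d} d∈ o (da ∷ db ∷ dc ∷ []) v → decidable-stable (d v ≟ᵖ 𝐈) λ dv →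
      let s = to-triple (a≢b T) (a≢c T) (b≢c T) d∈ (λ ua ub uc → o λ { (here eq) → ua eq ; (there (here eq)) → ub eq ; (there (there (here eq))) → uc eq }) dv
      in p≢ ([ (λ eq → ⊥-elim (at₁ s eq)) , (λ eq → trans (sym eq) (same-support⇒same s T a)) ]′ da) }
  us = proj₁ framed
  H = G ⋆ us
  prime-H = prime-⋆ us {G} prime
  open PrimeRows 5≤n {H} prime-H
  a𝐙 : τ* G us a p ≡ 𝐙
  a𝐙 = All.head (proj₂ framed)
  b𝐙 : τ* G us b q ≡ 𝐙
  b𝐙 = All.head (All.tail (proj₂ framed))
  t' = λ v → τ* G us v (t v)
  T' : Triple H t' a b c
  T' = triple-τ* us T
  c𝐙 : t' c ≡ 𝐙
  c𝐙 = All.head (All.tail (All.tail (proj₂ framed)))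
  Sa : S t' a ≡ true
  Sa = ≢𝐙⇒S _ (at₁ T') λ eq → p≢ (τ*-injective G us a (trans a𝐙 (sym eq)))
  Sb : S t' b ≡ true
  Sb = ≢𝐙⇒S _ (at₂ T') λ eq → q≢ (τ*-injective G us b (trans b𝐙 (sym eq)))
  Zrow : ∀ u → Z t' u ≡ adj H a u xor adj H b u
  Zrow = pair-row T' Sa Sb (cong proj₁ c𝐙)
  twin : ∀ {u} → u ≢ a → u ≢ b → u ≢ c → adj H a u ≡ adj H b u
  twin {u} ua ub uc = xor-≡ _ _ (trans (sym (Zrow u)) (cong proj₂ (off T' ua ub uc)))
  apart : adj H a c ≢ adj H b c
  apart eq = true≢false (trans (sym (cong proj₂ c𝐙)) (trans (Zrow c) (trans (cong (_xor adj H b c) eq) (𝔹.xor-same (adj H b c)))))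
  together : ∀ {v x} → x ≢ v → (∀ {u} → u ≢ v → u ≢ x → u ≢ c → adj H v u ≡ adj H x u) → (k : Cut H (_≡ v)) →
    Cut.side k x ≡ true → Cut.side k c ≡ true → ⊥
  together x≢v rows k sx sc = absorb k x≢v sx λ {y} yv sy → rows yv
    (λ { refl → true≢false (trans (sym sx) sy) }) (λ { refl → true≢false (trans (sym sc) sy) })
  K = orient b c (together (a≢b T ∘ sym) twin) (bad⇒cut (proj₂ (proj₂ (proj₂ (other-bad ess-a (t a))))) us a𝐙)
  K' = orient a c (together (a≢b T) λ ub ua uc → sym (twin ua ub uc)) (bad⇒cut (proj₂ (proj₂ (proj₂ (other-bad ess-b (t b))))) us b𝐙)
  k̂ = proj₁ K
  kb = proj₁ (proj₂ K)
  kc = proj₂ (proj₂ K)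
  k̂' = proj₁ K'
  k'a = proj₁ (proj₂ K')
  k'c = proj₂ (proj₂ K')
  no𝐙 : ∀ {d x y} → Triple H d a x y → d a ≢ 𝐙
  no𝐙 {d} {x} {y} s da = none (_ , x , y , triple-τ*⁻¹ us s , λ eq → p≢
    (trans (sym (τ*⁻¹-τ* G us a p)) (trans (cong (τ*⁻¹ G us a) (trans a𝐙 (sym da))) eq)))

-- Neighbourhoods read off from rotated triples

Neighbours : Graph n → Fin n → Fin n → Fin n → Set
Neighbours H v p q = Adj H v p × Adj H v q × (∀ {u} → u ≢ p → u ≢ q → adj H v u ≡ false)

Degree2 : Graph n → Fin n → Set
Degree2 H v = ∃₂ λ p q → p ≢ q × Neighbours H v p q

-- The local form of a union of paths; `ThetaPaths` recovers the paths from it in a prime graph.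
Theta : Graph n → Fin n → Fin n → Set
Theta H x y = x ≢ y × (∀ {v} → v ≢ x → v ≢ y → Degree2 H v) × (∀ z → Adj H x z → Adj H y z → ⊥)

HasTheta : Graph n → Set
HasTheta G = ∃[ us ] ∃₂ λ x y → Theta (G ⋆ us) x y

adj⇒≢ : (H : Graph n) {x y : Fin n} → Adj H x y → x ≢ y
adj⇒≢ H {x} xy refl = true≢false (trans (sym xy) (adj-irr H x))

ω-self′ : ∀ p r → r ≡ 𝐈 ⊎ r ≡ p → ω p r ≡ false
ω-self′ p r (inj₁ refl) = dec! (∀ᵖ λ p → ω p 𝐈 𝔹.≟ false) p
ω-self′ p r (inj₂ refl) = ω-self p

centre⇒neighbours : {H : Graph n} → ∀ {d v p q} → Triple H d v p q → S d v ≡ true → d p ≡ 𝐙 → d q ≡ 𝐙 → Neighbours H v p q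
centre⇒neighbours {H = H} {d} {v} {p} {q} t Sv dp dq =
    trans (sym (row p)) (cong proj₂ dp) , trans (sym (row q)) (cong proj₂ dq) ,
    λ {u} up uq → value-at (adj H v) (adj-irr H v) λ uv → trans (sym (row u)) (cong proj₂ (off t uv up uq))
  where
  S-off : ∀ y u → u ≢ v → S d u ∧ adj H u y ≡ false
  S-off y u uv = by-cases {P = λ u → S d u ∧ adj H u y ≡ false} (cong (λ r → proj₁ r ∧ adj H p y) dp) λ up →
    by-cases {P = λ u → S d u ∧ adj H u y ≡ false} (cong (λ r → proj₁ r ∧ adj H q y) dq) λ uq → cong (λ r → proj₁ r ∧ adj H u y) (off t uv up uq)
  row : ∀ u → Z d u ≡ adj H v u
  row u = trans (Z≡ (mem t) u) (trans (sum-supp₁ _ v (S-off u)) (cong (_∧ adj H v u) Sv))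

full-triple-row : {H : Graph n} → ∀ {d a b c} → Triple H d a b c → S d a ≡ true → S d b ≡ true → S d c ≡ true →
  ∀ {u} → u ≢ a → u ≢ b → u ≢ c → adj H a u ≡ false → adj H b u ≡ adj H c u
full-triple-row {H = H} {d} {a} {b} {c} t Sa Sb Sc {u} ua ub uc au = xor-≡ _ _ (begin
  adj H b u xor adj H c u                                                  ≡⟨ cong (_xor (adj H b u xor adj H c u)) (sym au) ⟩
  adj H a u xor (adj H b u xor adj H c u)                                  ≡⟨ cong₂ (λ s e → (s ∧ adj H a u) xor e) (sym Sa) (cong₂ (λ s s' → (s ∧ adj H b u) xor (s' ∧ adj H c u)) (sym Sb) (sym Sc)) ⟩
  (S d a ∧ adj H a u) xor ((S d b ∧ adj H b u) xor (S d c ∧ adj H c u))    ≡⟨ sym (sum-supp₃ _ (a≢b t) (a≢c t) (b≢c t) λ v va vb vc → cong (λ r → proj₁ r ∧ adj H v u) (off t va vb vc)) ⟩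
  sum (λ v → S d v ∧ adj H v u)                                            ≡⟨ sym (Z≡ (mem t) u) ⟩
  Z d u                                                                    ≡⟨ cong proj₂ (off t ua ub uc) ⟩
  false                                                                    ∎)
  where open ≡-Reasoning

rotated-S : {G : Graph n} (us : List (Fin n)) {v : Fin n} {p z : Pauli} → p ≢ 𝐈 → τ* G us v z ≡ 𝐙 → p ≢ z →
  proj₁ (τ* G us v p) ≡ true
rotated-S {G = G} us {v} p≢𝐈 z𝐙 p≢z = ≢𝐙⇒S _ (τ*-≢𝐈 us p≢𝐈) λ eq → p≢z (τ*-injective G us v (trans eq (sym z𝐙)))

rotated-centre : {G : Graph n} (us : List (Fin n)) → ∀ {d v p q z} → Triple G d v p q → τ* G us v z ≡ 𝐙 → d v ≢ z →
  τ* G us p (d p) ≡ 𝐙 → τ* G us q (d q) ≡ 𝐙 → Neighbours (G ⋆ us) v p q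
rotated-centre us t vz dv≢z = centre⇒neighbours (triple-τ* us t) (rotated-S us (at₁ t) vz dv≢z)

locEq-⋆ : (us : List (Fin n)) (G : Graph n) → LocEq G (G ⋆ us)
locEq-⋆ [] G = done λ _ _ → refl
locEq-⋆ (u ∷ us) G = step u (locEq-⋆ us (G * u))

module PrimeTriples {n : ℕ} (5≤n : 5 ≤ n) {G : Graph n} (prime : Prime G) where
  open PrimeGraph 5≤n {G} prime
  open PrimeCuts 5≤n {G} prime
  open PrimeRows 5≤n {G} prime

  no-twins : ∀ {x y} → x ≢ y → (∀ {u} → u ≢ x → u ≢ y → adj G x u ≡ adj G y u) → ⊥
  no-twins {x} {y} x≢y twin = case trans (sym (cong proj₁ (weight>2 x≢y (L-⊞ (L-star G x) (L-star G y)) off-xy x)))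
      (cong₂ _xor_ (δ-refl x) (δ-≢ (x≢y ∘ sym))) of λ ()
    where
    off-xy : ∀ {u} → u ≢ x → u ≢ y → star G x u ⊕ star G y u ≡ 𝐈
    off-xy {u} ux uy = cong₂ _,_ (cong₂ _xor_ (δ-≢ (ux ∘ sym)) (δ-≢ (uy ∘ sym)))
      (trans (cong (_xor adj G y u) (twin ux uy)) (𝔹.xor-same (adj G y u)))

  share⇒differ : ∀ {d d' v p q r} → Triple G d v p q → Triple G d' v p r → q ≢ r → d v ≢ d' v
  share⇒differ t t' q≢r eq = [ a≢c t ∘ sym , [ b≢c t ∘ sym , q≢r ]′ ]′
    (elem t' λ dq → at₃ t (trans (agree⇒same t t' eq _) dq))

  -- At `p` and `q` the vector `e` commutes with `d`, so it does at `v` by isotropy; the direction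
  -- `z` would anticommute. Obstructions to frames are eliminated in this way.
  blocked : ∀ {d e v p q z} → Triple G d v p q → L G e → z ≢ 𝐈 → d v ≢ z → e v ≡ 𝐈 ⊎ e v ≡ z →
    e p ≡ 𝐈 ⊎ e p ≡ d p → e q ≡ 𝐈 ⊎ e q ≡ d q → e v ≡ 𝐈
  blocked t e∈ z≢ dv≢z (inj₁ eq) ep eq' = eq
  blocked {d} {e} {v} {p} {q} t e∈ z≢ dv≢z (inj₂ refl) ep eq' = ⊥-elim (true≢false (trans (sym (ω-true _ _ dv≢z (at₁ t) z≢))
    (trans (sym (𝔹.xor-identityʳ _)) (trans (cong (ω (d v) (e v) xor_) (sym (cong₂ _xor_ (ω-self′ (d p) (e p) ep) (ω-self′ (d q) (e q) eq')))) (ω-sum t e∈)))))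

  list-cut : (xs : List (Fin n)) (r : Fin n → Bool) →
    (∀ {x} → x ∈ xs → (∀ {y} → y ∉ xs → adj G x y ≡ false) ⊎ (∀ {y} → y ∉ xs → adj G x y ≡ r y)) →
    ∀ {a b} → a ∈ xs → b ∈ xs → a ≢ b → Two (_∉ xs) → ⊥
  list-cut xs r rows a∈ b∈ a≢b others = prime⇒no-cut {G = G} prime
    (cut (λ u → does (u ∈? xs)) (_ , _ , a≢b , (id , dec-true (_ ∈? xs) a∈) , (id , dec-true (_ ∈? xs) b∈))
      (two-map (λ u∉ → id , dec-false (_ ∈? xs) u∉) others) (λ x → coefficient (x ∈? xs)) r λ {x} {y} _ _ → rk x y)
    where
    coefficient : ∀ {x} → Dec (x ∈ xs) → Bool
    coefficient (yes x∈) = [ (λ _ → false) , (λ _ → true) ]′ (rows x∈)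
    coefficient (no _) = false
    rk : ∀ x y → does (x ∈? xs) ≡ true → does (y ∈? xs) ≡ false → adj G x y ≡ coefficient (x ∈? xs) ∧ r y
    rk x y sx sy with x ∈? xs | y ∈? xs
    ... | yes x∈ | no y∉ with rows x∈
    ...   | inj₁ zero-row = zero-row y∉
    ...   | inj₂ r-row = r-row y∉

  -- Complementation at a vertex of degree 2 toggles only the edge between its two neighbours.
  chord : ∀ {u c e} → Neighbours G u c e → c ≢ e →
    ∃[ ws ] adj (G ⋆ ws) c e ≡ false × (∀ {x y} → ¬ (x ≡ c × y ≡ e) → ¬ (x ≡ e × y ≡ c) → adj (G ⋆ ws) x y ≡ adj G x y)
  chord {u} {c} {e} (uc , ue , none) c≢e with adj G c e in eq
  ... | false = [] , eq , λ _ _ → refl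
  ... | true = u ∷ [] , trans (lcAdj-≢ G u c≢e) (cong₂ _xor_ eq (cong₂ _∧_ uc ue)) , same
    where
    same : ∀ {x y} → ¬ (x ≡ c × y ≡ e) → ¬ (x ≡ e × y ≡ c) → adj (G * u) x y ≡ adj G x y
    same {x} {y} ¬ce ¬ec with x ≟ y
    ... | yes refl = sym (adj-irr G x)
    ... | no x≢y = trans (cong (adj G x y xor_) (apart (x ≟ c) (x ≟ e) (y ≟ c) (y ≟ e))) (𝔹.xor-identityʳ _)
      where
      apart : Dec (x ≡ c) → Dec (x ≡ e) → Dec (y ≡ c) → Dec (y ≡ e) → adj G u x ∧ adj G u y ≡ false
      apart (yes refl) _ (yes refl) _ = ⊥-elim (x≢y refl)
      apart (yes refl) _ (no _) (yes refl) = ⊥-elim (¬ce (refl , refl))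
      apart (yes refl) _ (no yc) (no ye) = trans (cong (adj G u x ∧_) (none yc ye)) (𝔹.∧-zeroʳ _)
      apart (no _) (yes refl) (yes refl) _ = ⊥-elim (¬ec (refl , refl))
      apart (no _) (yes refl) (no _) (yes refl) = ⊥-elim (x≢y refl)
      apart (no _) (yes refl) (no yc) (no ye) = trans (cong (adj G u x ∧_) (none yc ye)) (𝔹.∧-zeroʳ _)
      apart (no xc) (no xe) _ _ = cong (_∧ adj G u y) (none xc xe)

  -- Any edge can provide the ends: with a common neighbour, its ends of degree 2 would have no
  -- further neighbours and be twins.
  cycle⇒theta : (∀ v → Degree2 G v) → ∃₂ λ x y → Theta G x y
  cycle⇒theta deg = x , y , adj⇒≢ G xy , (λ _ _ → deg _) , λ z xz yz → no-twins (adj⇒≢ G xy) λ {u} ux uy →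
      [ (λ eq → trans (cong (adj G x) eq) (trans (trans xz (sym yz)) (cong (adj G y) (sym eq))))
      , (λ uz → trans (none (deg x) xy xz (λ eq → adj⇒≢ G yz eq) uy uz)
          (sym (none (deg y) (trans (adj-sym G y x) xy) yz (λ eq → adj⇒≢ G xz eq) ux uz))) ]′ (or (u ≟ z))
    where
    x = proj₁ (fresh {n} [] (ℕ.≤-trans (s≤s z≤n) 5≤n))
    y = proj₁ (neighbour x)
    xy = proj₂ (neighbour x)
    or : {A : Set} → Dec A → A ⊎ ¬ A
    or (yes a) = inj₁ a
    or (no a) = inj₂ a
    none : ∀ {v p q u} → Degree2 G v → Adj G v p → Adj G v q → p ≢ q → u ≢ p → u ≢ q → adj G v u ≡ false
    none {v} {p} {q} {u} (a , b , a≢b , va , vb , rest) vp vq p≢q up uq = by (locate vp) (locate vq)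
      where
      locate : ∀ {w} → Adj G v w → w ≡ a ⊎ w ≡ b
      locate {w} vw with w ≟ a | w ≟ b
      ... | yes eq | _ = inj₁ eq
      ... | no _ | yes eq = inj₂ eq
      ... | no wa | no wb = ⊥-elim (true≢false (trans (sym vw) (rest wa wb)))
      by : p ≡ a ⊎ p ≡ b → q ≡ a ⊎ q ≡ b → adj G v u ≡ false
      by (inj₁ refl) (inj₁ refl) = ⊥-elim (p≢q refl)
      by (inj₁ refl) (inj₂ refl) = rest up uq
      by (inj₂ refl) (inj₁ refl) = rest uq up
      by (inj₂ refl) (inj₂ refl) = ⊥-elim (p≢q refl)

-- Otherwise {a, b, c, e} would have cut-rank at most 1.
no-three-in-four : {G : Graph n} → 6 ≤ n → Prime G → ∀ {d d' d'' a b c e} →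
  Triple G d a b c → Triple G d' a b e → Triple G d'' a c e → ⊥
no-three-in-four {n} {G} 6≤n prime {d} {d'} {d''} {a} {b} {c} {e} t t' t'' =
  H.list-cut (a ∷ b ∷ c ∷ e ∷ []) (adj H c)
    (λ { (here refl) → inj₁ λ y∉ → proj₂ (proj₂ nb-a) (y∉ ∘ there ∘ here) (y∉ ∘ there ∘ there ∘ there ∘ here)
       ; (there (here refl)) → inj₁ λ y∉ → proj₂ (proj₂ nb-b) (y∉ ∘ here) (y∉ ∘ there ∘ there ∘ here)
       ; (there (there (here refl))) → inj₂ λ _ → refl
       ; (there (there (there (here refl)))) → inj₂ λ y∉ → sym (full-triple-row (triple-τ* us t'') Sa Sc Se
           (y∉ ∘ here) (y∉ ∘ there ∘ there ∘ here) (y∉ ∘ there ∘ there ∘ there ∘ here)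
           (proj₂ (proj₂ nb-a) (y∉ ∘ there ∘ here) (y∉ ∘ there ∘ there ∘ there ∘ here))) })
    (here refl) (there (here refl)) (a≢b t) (two-fresh _ 6≤n)
  where
  5≤n = ℕ.≤-trans (ℕ.n≤1+n 5) 6≤n
  open PrimeGraph 5≤n {G} prime
  open PrimeTriples 5≤n {G} prime
  da≢d'a = share⇒differ t t' (b≢c t'')
  db≢d'b = share⇒differ (swap₁₂ t) (swap₁₂ t') (b≢c t'')
  framed = frame G ((a , d a) ∷ (b , d' b) ∷ (c , d c) ∷ (e , d' e) ∷ [])
    ((a≢b t ∷ a≢c t ∷ a≢c t' ∷ []) ∷ (b≢c t ∷ b≢c t' ∷ []) ∷ (b≢c t'' ∷ []) ∷ [] ∷ [])
    (at₁ t ∷ at₂ t' ∷ at₃ t ∷ at₃ t' ∷ [])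
    λ { {f} f∈ o (fa ∷ fb ∷ fc ∷ fe ∷ []) →
      let fb≡ = blocked (swap₁₂ t) f∈ (at₂ t') db≢d'b fb fa fc
          fa≡ = blocked t' f∈ (at₁ t) (da≢d'a ∘ sym) fa (inj₁ fb≡) fe
      in weight>2 (b≢c t'') f∈ λ uc ue → value-at f fa≡ λ ua → value-at f fb≡ λ ub →
           o λ { (here eq) → ua eq ; (there (here eq)) → ub eq ; (there (there (here eq))) → uc eq ; (there (there (there (here eq)))) → ue eq } }
  us = proj₁ framed
  H = G ⋆ us
  module H = PrimeTriples 5≤n {H} (prime-⋆ us {G} prime)
  a𝐙 = All.head (proj₂ framed)
  b𝐙 = All.head (All.tail (proj₂ framed))
  c𝐙 = All.head (All.tail (All.tail (proj₂ framed)))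
  e𝐙 = All.head (All.tail (All.tail (All.tail (proj₂ framed))))
  nb-b : Neighbours H b a c
  nb-b = rotated-centre us (swap₁₂ t) b𝐙 db≢d'b a𝐙 c𝐙
  nb-a : Neighbours H a b e
  nb-a = rotated-centre us t' a𝐙 (da≢d'a ∘ sym) b𝐙 e𝐙
  Sa = rotated-S us (at₁ t'') a𝐙 (share⇒differ (swap₂₃ t) t'' (b≢c t') ∘ sym)
  Sc = rotated-S us (at₂ t'') c𝐙 (share⇒differ (rotʳ t) (swap₁₂ t'') (b≢c t') ∘ sym)
  Se = rotated-S us (at₃ t'') e𝐙 (share⇒differ (rotʳ t') (rotʳ t'') (b≢c t) ∘ sym)

-- In a suitable frame c, a, v, b, e is a path whose vertex set has cut-rank at most 1; hence n = 6, and up to the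
-- chord ce the graph is a 6-cycle.
quadrangle⇒theta : {G : Graph n} → 6 ≤ n → Prime G → ∀ {s s' t t' v a b c e} →
  Triple G s v a b → Triple G s' v c e → Triple G t v a c → Triple G t' v b e →
  s v ≡ s' v → t v ≡ t' v → a ≢ e → b ≢ c → HasTheta G
quadrangle⇒theta {n} {G} 6≤n prime {s} {s'} {t} {t'} {v} {a} {b} {c} {e} T T' U U' sv≡ tv≡ a≢e b≠c =
  us ++ ws , subst (λ K → ∃₂ λ x y → Theta K x y) (sym (⋆-++ G us ws))
    (PrimeTriples.cycle⇒theta 5≤n {H ⋆ ws} (prime-⋆ ws {H} prime-H) degree2)
  where
  5≤n = ℕ.≤-trans (ℕ.n≤1+n 5) 6≤n
  open PrimeGraph 5≤n {G} prime
  open PrimeTriples 5≤n {G} prime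
  sv≢tv : s v ≢ t v
  sv≢tv = share⇒differ T U b≠c
  sa≢ta : s a ≢ t a
  sa≢ta = share⇒differ (swap₁₂ T) (swap₁₂ U) b≠c
  sb≢t'b : s b ≢ t' b
  sb≢t'b = share⇒differ (swap₁₂ (swap₂₃ T)) (swap₁₂ U') a≢e
  xs = v ∷ a ∷ b ∷ c ∷ e ∷ []
  framed = frame G ((v , t v) ∷ (a , s a) ∷ (b , s b) ∷ (c , t c) ∷ (e , t' e) ∷ [])
    ((a≢b T ∷ a≢c T ∷ a≢b T' ∷ a≢c T' ∷ []) ∷ (b≢c T ∷ b≢c U ∷ a≢e ∷ []) ∷ (b≠c ∷ b≢c U' ∷ []) ∷ (b≢c T' ∷ []) ∷ [] ∷ [])
    (at₁ U ∷ at₂ T ∷ at₃ T ∷ at₃ U ∷ at₃ U' ∷ [])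
    λ { {f} f∈ o (fv ∷ fa ∷ fb ∷ fc ∷ fe ∷ []) →
      let fv≡ = blocked T f∈ (at₁ U) sv≢tv fv fa fb
          fa≡ = blocked (swap₁₂ U) f∈ (at₂ T) (sa≢ta ∘ sym) fa fv fc
          fb≡ = blocked (swap₁₂ U') f∈ (at₃ T) (sb≢t'b ∘ sym) fb (inj₁ fv≡) fe
      in weight>2 (b≢c T') f∈ λ uc ue → value-at f fv≡ λ uv → value-at f fa≡ λ ua →
        value-at f fb≡ λ ub → o λ
          { (here eq) → uv eq ; (there (here eq)) → ua eq ; (there (there (here eq))) → ub eq
          ; (there (there (there (here eq)))) → uc eq ; (there (there (there (there (here eq))))) → ue eq } }
  us = proj₁ framed
  H = G ⋆ us
  prime-H = prime-⋆ us {G} prime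
  module H = PrimeTriples 5≤n {H} prime-H
  v𝐙 = All.head (proj₂ framed)
  a𝐙 = All.head (All.tail (proj₂ framed))
  b𝐙 = All.head (All.tail (All.tail (proj₂ framed)))
  c𝐙 = All.head (All.tail (All.tail (All.tail (proj₂ framed))))
  e𝐙 = All.head (All.tail (All.tail (All.tail (All.tail (proj₂ framed)))))
  nb-v : Neighbours H v a b
  nb-v = rotated-centre us T v𝐙 sv≢tv a𝐙 b𝐙
  nb-a : Neighbours H a v c
  nb-a = rotated-centre us (swap₁₂ U) a𝐙 (sa≢ta ∘ sym) v𝐙 c𝐙
  nb-b : Neighbours H b v e
  nb-b = rotated-centre us (swap₁₂ U') b𝐙 (sb≢t'b ∘ sym) (trans (cong (τ* G us v) (sym tv≡)) v𝐙) e𝐙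
  Sv = rotated-S us (at₁ T') v𝐙 λ eq → sv≢tv (trans sv≡ eq)
  Sc = rotated-S us (at₂ T') c𝐙 (share⇒differ (swap₁₂ T') (swap₁₂ (swap₂₃ U)) (a≢e ∘ sym))
  Se = rotated-S us (at₃ T') e𝐙 (share⇒differ (swap₁₂ (swap₂₃ T')) (swap₁₂ (swap₂₃ U')) (b≠c ∘ sym))
  ce-row : ∀ {y} → y ∉ xs → adj H c y ≡ adj H e y
  ce-row y∉ = full-triple-row (triple-τ* us T') Sv Sc Se (y∉ ∘ here) (y∉ ∘ there ∘ there ∘ there ∘ here)
    (y∉ ∘ there ∘ there ∘ there ∘ there ∘ here) (proj₂ (proj₂ nb-v) (y∉ ∘ there ∘ here) (y∉ ∘ there ∘ there ∘ here))
  u = proj₁ (fresh xs 6≤n)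
  u∉ = proj₂ (fresh xs 6≤n)
  only-u : ∀ {w} → w ∉ xs → w ≡ u
  only-u {w} w∉ = decidable-stable (w ≟ u) λ w≢u → H.list-cut xs (adj H c)
    (λ { (here refl) → inj₁ λ y∉ → proj₂ (proj₂ nb-v) (y∉ ∘ there ∘ here) (y∉ ∘ there ∘ there ∘ here)
       ; (there (here refl)) → inj₁ λ y∉ → proj₂ (proj₂ nb-a) (y∉ ∘ here) (y∉ ∘ there ∘ there ∘ there ∘ here)
       ; (there (there (here refl))) → inj₁ λ y∉ → proj₂ (proj₂ nb-b) (y∉ ∘ here) (y∉ ∘ there ∘ there ∘ there ∘ there ∘ here)
       ; (there (there (there (here refl)))) → inj₂ λ _ → refl
       ; (there (there (there (there (here refl))))) → inj₂ λ y∉ → sym (ce-row y∉) })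
    (here refl) (there (here refl)) (a≢b T) (w , u , w≢u , w∉ , u∉)
  u≢ : ∀ {x} → x ∈ xs → u ≢ x
  u≢ x∈ refl = u∉ x∈
  v∈ : v ∈ xs
  v∈ = here refl
  a∈ : a ∈ xs
  a∈ = there (here refl)
  b∈ : b ∈ xs
  b∈ = there (there (here refl))
  c∈ : c ∈ xs
  c∈ = there (there (there (here refl)))
  e∈ : e ∈ xs
  e∈ = there (there (there (there (here refl))))
  cover : ∀ {P : Fin n → Set} → P v → P a → P b → P c → P e → P u → ∀ w → P w
  cover {P} pv pa pb pc pe pu w with w ∈? xs
  ... | yes (here refl) = pv
  ... | yes (there (here refl)) = pa
  ... | yes (there (there (here refl))) = pb
  ... | yes (there (there (there (here refl)))) = pc
  ... | yes (there (there (there (there (here refl))))) = pe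
  ... | no w∉ = subst P (sym (only-u w∉)) pu
  symm : ∀ {x y} → adj H x y ≡ adj H y x
  symm = adj-sym H _ _
  uv : adj H u v ≡ false
  uv = trans symm (proj₂ (proj₂ nb-v) (u≢ a∈) (u≢ b∈))
  ua : adj H u a ≡ false
  ua = trans symm (proj₂ (proj₂ nb-a) (u≢ v∈) (u≢ c∈))
  ub : adj H u b ≡ false
  ub = trans symm (proj₂ (proj₂ nb-b) (u≢ v∈) (u≢ e∈))
  ue≡uc : adj H u e ≡ adj H u c
  ue≡uc = trans symm (trans (sym (ce-row u∉)) symm)
  uc : adj H u c ≡ true
  uc = 𝔹.¬-not λ uc → let w , uw = PrimeRows.neighbour 5≤n {H} prime-H u in
    true≢false (trans (sym uw) (cover {λ w → adj H u w ≡ false} uv ua ub uc (trans ue≡uc uc) (adj-irr H u) w))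
  nb-u : Neighbours H u c e
  nb-u = uc , trans ue≡uc uc , λ {w} → cover {λ w → w ≢ c → w ≢ e → adj H u w ≡ false}
    (λ _ _ → uv) (λ _ _ → ua) (λ _ _ → ub) (λ ≢c _ → ⊥-elim (≢c refl)) (λ _ ≢e → ⊥-elim (≢e refl)) (λ _ _ → adj-irr H u) w
  chorded = H.chord nb-u (b≢c T')
  ws = proj₁ chorded
  same : ∀ {x y} → ¬ (x ≡ c × y ≡ e) → ¬ (x ≡ e × y ≡ c) → adj (H ⋆ ws) x y ≡ adj H x y
  same = proj₂ (proj₂ chorded)
  keep : ∀ {x p q} → x ≢ c → x ≢ e → p ≢ q → Neighbours H x p q → Degree2 (H ⋆ ws) x
  keep {x} {p} {q} x≢c x≢e p≢q (xp , xq , none) = p , q , p≢q , trans row xp , trans row xq , λ wp wq → trans row (none wp wq)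
    where
    row : ∀ {w} → adj (H ⋆ ws) x w ≡ adj H x w
    row = same (x≢c ∘ proj₁) (x≢e ∘ proj₁)
  ce : adj (H ⋆ ws) c e ≡ false
  ce = proj₁ (proj₂ chorded)
  deg-c : Degree2 (H ⋆ ws) c
  deg-c = a , u , u≢ a∈ ∘ sym , trans (row a≢e) (trans symm (proj₁ (proj₂ nb-a))) , trans (row (u≢ e∈)) (trans symm uc) ,
    λ {w} → cover {λ w → w ≢ a → w ≢ u → adj (H ⋆ ws) c w ≡ false}
      (λ _ _ → trans (row (a≢c T')) (trans symm (proj₂ (proj₂ nb-v) (b≢c U ∘ sym) (b≠c ∘ sym)))) (λ ≢a _ → ⊥-elim (≢a refl))
      (λ _ _ → trans (row (b≢c U')) (trans symm (proj₂ (proj₂ nb-b) (a≢b T' ∘ sym) (b≢c T'))))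
      (λ _ _ → adj-irr (H ⋆ ws) c) (λ _ _ → ce) (λ _ ≢u → ⊥-elim (≢u refl)) w
    where
    row : ∀ {w} → w ≢ e → adj (H ⋆ ws) c w ≡ adj H c w
    row w≢e = same (w≢e ∘ proj₂) λ (eq , _) → b≢c T' eq
  deg-e : Degree2 (H ⋆ ws) e
  deg-e = b , u , u≢ b∈ ∘ sym , trans (row b≠c) (trans symm (proj₁ (proj₂ nb-b))) , trans (row (u≢ c∈)) (trans symm (trans ue≡uc uc)) ,
    λ {w} → cover {λ w → w ≢ b → w ≢ u → adj (H ⋆ ws) e w ≡ false}
      (λ _ _ → trans (row (a≢b T')) (trans symm (proj₂ (proj₂ nb-v) (a≢e ∘ sym) (b≢c U' ∘ sym))))
      (λ _ _ → trans (row (b≢c U)) (trans symm (proj₂ (proj₂ nb-a) (a≢c T' ∘ sym) (b≢c T' ∘ sym)))) (λ ≢b _ → ⊥-elim (≢b refl))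
      (λ _ _ → trans (adj-sym (H ⋆ ws) e c) ce) (λ _ _ → adj-irr (H ⋆ ws) e) (λ _ ≢u → ⊥-elim (≢u refl)) w
    where
    row : ∀ {w} → w ≢ c → adj (H ⋆ ws) e w ≡ adj H e w
    row w≢c = same (λ (eq , _) → b≢c T' (sym eq)) (w≢c ∘ proj₂)
  degree2 : ∀ w → Degree2 (H ⋆ ws) w
  degree2 = cover {Degree2 (H ⋆ ws)} (keep (a≢b T') (a≢c T') (b≢c T) nb-v) (keep (b≢c U) a≢e (a≢c U) nb-a)
    (keep b≠c (b≢c U') (a≢c T') nb-b) deg-c deg-e (keep (u≢ c∈) (u≢ e∈) (b≢c T') nb-u)

-- Two triples sharing a pair of vertices

two-or-three : {P : Fin n → Set} → (∀ u → Dec (P u)) → Two P → ∀ {x} → P x →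
  (∃[ a ] a ≢ x × P a × (∀ {w} → P w → w ≡ x ⊎ w ≡ a)) ⊎ Two (λ w → w ≢ x × P w)
two-or-three {n} {P} P? (p , q , p≢q , Pp , Pq) {x} Px = case p ≟ x of λ where
    (no p≢x) → extend-from p p≢x Pp
    (yes refl) → extend-from q (p≢q ∘ sym) Pq
  where
  extend-from : ∀ a → a ≢ x → P a → (∃[ a ] a ≢ x × P a × (∀ {w} → P w → w ≡ x ⊎ w ≡ a)) ⊎ Two (λ w → w ≢ x × P w)
  extend-from a a≢x Pa with Fin.any? (λ w → ¬? (w ≟ x) ×-dec (¬? (w ≟ a) ×-dec P? w))
  ... | yes (w , w≢x , w≢a , Pw) = inj₂ (w , a , w≢a , (w≢x , Pw) , (a≢x , Pa))
  ... | no none = inj₁ (a , a≢x , Pa , λ {w} Pw → only Pw (w ≟ x) (w ≟ a))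
    where
    only : ∀ {w} → P w → Dec (w ≡ x) → Dec (w ≡ a) → w ≡ x ⊎ w ≡ a
    only Pw (yes eq) _ = inj₁ eq
    only Pw (no _) (yes eq) = inj₂ eq
    only Pw (no wx) (no wa) = ⊥-elim (none (_ , wx , wa , Pw))

-- Since x has only the neighbours y and u', one of x and y can be moved to the other side of a split of H ∖ u, unless
-- a side has only two elements; but the split must separate x from y.
module PinnedSplit {n : ℕ} (5≤n : 5 ≤ n) {H : Graph n} (prime : Prime H) {u x y u' : Fin n}
  (u≢x : u ≢ x) (u≢y : u ≢ y) (x≢y : x ≢ y) (u≢u' : u ≢ u') (nb-x : Neighbours H x y u')
  (twin : ∀ {w} → w ≢ u → w ≢ x → w ≢ y → adj H u w ≡ adj H y w) where
  open PrimeRows 5≤n {H} prime using (absorb)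
  open PrimeCuts 5≤n {H} prime

  Thin : Set
  Thin = ∃[ d ] ∃₂ λ a b → Triple H d u a b × d u ≡ 𝐙

  together : (k : Cut H (_≡ u)) → Cut.side k x ≡ true → Cut.side k y ≡ true → ⊥
  together k sx sy = absorb k (u≢y ∘ sym) sy λ {w} wu sw → twin wu (λ { refl → true≢false (trans (sym sx) sw) }) (λ { refl → true≢false (trans (sym sy) sw) })
  separated : (k : Cut H (_≡ u)) → Cut.side k x ≡ true → Cut.side k y ≡ false → Thin
  separated k sx sy = by-side (side u') refl
    where
    open Cut k
    part? : ∀ b w → Dec (w ≢ u × side w ≡ b)
    part? b w = ¬? (w ≟ u) ×-dec (side w 𝔹.≟ b)
    by-side : ∀ b → side u' ≡ b → Thin
    by-side false su' with two-or-three (part? true) left (u≢x ∘ sym , sx)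
    ... | inj₁ (a , a≢x , (au , sa) , only) = (_ , x , a ,
            proj₂ (small-side⇒triple k (a≢x ∘ sym) (u≢x ∘ sym) au sx sa λ wu sw → only (wu , sw)))
    ... | inj₂ two = ⊥-elim (together (cut-flip moved) (cong not (at-x)) (cong not (keep (x≢y ∘ sym) sy)))
      where
      side′ : Fin n → Bool
      side′ w = if δ w x then false else side w
      keep : ∀ {w b} → w ≢ x → side w ≡ b → side′ w ≡ b
      keep {w} wx sw = trans (cong (λ d → if d then false else side w) (δ-≢ wx)) sw
      at-x : side′ x ≡ false
      at-x = cong (λ d → if d then false else side x) (δ-refl x)
      moved : Cut H (_≡ u)
      moved = cut side′ (two-map (λ (wx , wu , sw) → wu , keep wx sw) two)
        (two-map (λ {w} (wu , sw) → wu , keep (λ { refl → true≢false (trans (sym sx) sw) }) sw) right)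
        α (λ w → not (δ w x) ∧ β w) λ {a} {b} → rk a b
        where
        rk : ∀ a b → a ≢ u → b ≢ u → side′ a ≡ true → side′ b ≡ false → adj H a b ≡ α a ∧ (not (δ b x) ∧ β b)
        rk a b au bu sa sb with a ≟ x | b ≟ x
        ... | no ax | yes refl = trans (adj-sym H a x) (trans (proj₂ (proj₂ nb-x)
                (λ { refl → true≢false (trans (sym sa) sy) }) (λ { refl → true≢false (trans (sym sa) su') })) (sym (𝔹.∧-zeroʳ (α a))))
        ... | no ax | no bx = rank1 au bu sa sb
    by-side true su' with two-or-three (part? false) right (u≢y ∘ sym , sy)
    ... | inj₁ (a , a≢y , (au , sa) , only) = (_ , y , a ,
            proj₂ (small-side⇒triple (cut-flip k) (a≢y ∘ sym) (u≢y ∘ sym) au (cong not sy) (cong not sa) λ wu sw → only (wu , 𝔹.not-injective sw)))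
    ... | inj₂ two = ⊥-elim (together moved (keep (x≢y) sx) (cong (λ d → if d then true else side y) (δ-refl y)))
      where
      side′ : Fin n → Bool
      side′ w = if δ w y then true else side w
      keep : ∀ {w b} → w ≢ y → side w ≡ b → side′ w ≡ b
      keep {w} wy sw = trans (cong (λ d → if d then true else side w) (δ-≢ wy)) sw
      αx : α x ≡ true
      αx = proj₁ (∧-true (α x) (β y) (trans (sym (rank1 (u≢x ∘ sym) (u≢y ∘ sym) sx sy)) (proj₁ nb-x)))
      moved : Cut H (_≡ u)
      moved = cut side′ (two-map (λ {w} (wu , sw) → wu , keep (λ { refl → true≢false (trans (sym sw) sy) }) sw) left)
        (two-map (λ (wy , wu , sw) → wu , keep wy sw) two) (λ w → δ w y) (adj H y) λ {a} {b} → rk a b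
        where
        rk : ∀ a b → a ≢ u → b ≢ u → side′ a ≡ true → side′ b ≡ false → adj H a b ≡ δ a y ∧ adj H y b
        rk a b au bu sa sb with a ≟ y | b ≟ y
        ... | yes refl | no _ = refl
        ... | no ay | no by = trans (rank1 au bu sa sb) (trans (cong (α a ∧_) βb) (𝔹.∧-zeroʳ (α a)))
          where
          βb : β b ≡ false
          βb = trans (cong (_∧ β b) (sym αx)) (trans (sym (rank1 (u≢x ∘ sym) bu sx sb))
            (proj₂ (proj₂ nb-x) by (λ { refl → true≢false (trans (sym su') sb) })))
  thin : Cut H (_≡ u) → Thin
  thin k = let k , kx , ky = orient x y together k in separated k kx ky

-- A bad direction at `u` other than that of `t` is rotated to Z, together with directions for which
-- `t'` becomes the star of `x` and `t` makes `u` and `y` twins except at `x`. `PinnedSplit` then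
-- turns the split at `u` into a triple with the bad direction.
shared-pair⇒double : {G : Graph n} → 5 ≤ n → Prime G → ∀ {t t' u u' x y} → Triple G t u x y → Triple G t' u' x y → u ≢ u' →
  Essential G u → Double G u
shared-pair⇒double {n} {G} 5≤n prime {t} {t'} {u} {u'} {x} {y} T T' u≢u' (p₁ , p₂ , p₁≢p₂ , p₁≢𝐈 , p₂≢𝐈 , bad₁ , bad₂) =
  small⇒double (PinnedSplit.thin 5≤n {H} prime-H (a≢b T) (a≢c T) (b≢c T) u≢u' nb-x twin (bad⇒cut (proj₂ (proj₂ (proj₂ chosen))) us u𝐙))
  where
  open PrimeGraph 5≤n {G} prime
  open PrimeTriples 5≤n {G} prime
  chosen : ∃[ p ] p ≢ t u × p ≢ 𝐈 × Bad G u p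
  chosen = case p₁ ≟ᵖ t u of λ where
    (yes eq) → p₂ , (λ eq' → p₁≢p₂ (trans eq (sym eq'))) , p₂≢𝐈 , bad₂
    (no neq) → p₁ , neq , p₁≢𝐈 , bad₁
  p = proj₁ chosen
  p≢tu = proj₁ (proj₂ chosen)
  tx≢t'x : t x ≢ t' x
  tx≢t'x = share⇒differ (rotˡ T) (rotˡ T') u≢u'
  ty≢t'y : t y ≢ t' y
  ty≢t'y = share⇒differ (swap₁₃ T) (swap₁₃ T') u≢u'
  framed = frame G ((u , p) ∷ (x , t x) ∷ (y , t' y) ∷ (u' , t' u') ∷ [])
    ((a≢b T ∷ a≢c T ∷ u≢u' ∷ []) ∷ (b≢c T ∷ (a≢b T' ∘ sym) ∷ []) ∷ ((a≢c T' ∘ sym) ∷ []) ∷ [] ∷ [])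
    (proj₁ (proj₂ (proj₂ chosen)) ∷ at₂ T ∷ at₃ T' ∷ at₁ T' ∷ [])
    λ { {f} f∈ o (fu ∷ fx ∷ fy ∷ fu' ∷ []) v → decidable-stable (f v ≟ᵖ 𝐈) λ fv →
      let fx≡ = blocked (rotˡ T') f∈ (at₂ T) (tx≢t'x ∘ sym) fx fy fu'
          F = to-triple (a≢c T' ∘ sym) (a≢c T ∘ sym) (u≢u' ∘ sym) f∈
                (λ vy vu' vu → value-at f fx≡ λ vx → o λ
                  { (here eq) → vu eq ; (there (here eq)) → vx eq ; (there (there (here eq))) → vy eq ; (there (there (there (here eq)))) → vu' eq }) fv
      in [ at₁ F , (λ fy≡ → share⇒differ F (rotʳ T') (a≢b T) fy≡) ]′ fy }
  us = proj₁ framed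
  H = G ⋆ us
  prime-H = prime-⋆ us {G} prime
  u𝐙 = All.head (proj₂ framed)
  x𝐙 = All.head (All.tail (proj₂ framed))
  y𝐙 = All.head (All.tail (All.tail (proj₂ framed)))
  u'𝐙 = All.head (All.tail (All.tail (All.tail (proj₂ framed))))
  nb-x : Neighbours H x y u'
  nb-x = rotated-centre us (rotˡ T') x𝐙 (tx≢t'x ∘ sym) y𝐙 u'𝐙
  twin : ∀ {w} → w ≢ u → w ≢ x → w ≢ y → adj H u w ≡ adj H y w
  twin {w} wu wx wy = xor-≡ _ _ (trans (sym (pair-row (triple-τ* us (swap₂₃ T)) (rotated-S us (at₁ T) u𝐙 (p≢tu ∘ sym))
    (rotated-S us (at₃ T) y𝐙 ty≢t'y) (cong proj₁ x𝐙) w)) (cong proj₂ (off (triple-τ* us T) wu wx wy)))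
  small⇒double : (∃[ d ] ∃₂ λ a b → Triple H d u a b × d u ≡ 𝐙) → Double G u
  small⇒double (d , a , b , s , du) = t , _ , (_ , _ , T) , (_ , _ , triple-τ*⁻¹ us s) , λ eq → p≢tu (sym (trans eq
    (trans (cong (τ*⁻¹ G us u) (trans du (sym u𝐙))) (τ*⁻¹-τ* G us u p))))

-- Chains of triples

third-is : {G : Graph n} → ∀ {d a b r c} → Triple G d a b r → d c ≢ 𝐈 → c ≢ a → c ≢ b → Triple G d a b c
third-is t dc ca cb with elem t dc
... | inj₁ eq = ⊥-elim (ca eq)
... | inj₂ (inj₁ eq) = ⊥-elim (cb eq)
... | inj₂ (inj₂ refl) = t

-- Essential vertices enter only through these hypotheses. By `ends`, three distinct vertices
-- outside `Ess` are impossible; this is what excludes several of the configurations below.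
module Chains {n : ℕ} (6≤n : 6 ≤ n) {G : Graph n} (prime : Prime G) (no-theta : ¬ HasTheta G)
  (Ess : Fin n → Set)
  (double⇒ess : ∀ {v} → Double G v → Ess v)
  (ess⇒triple : ∀ {v} → Ess v → M (∃[ d ] ∃₂ λ a b → Triple G d v a b))
  (ess-pair : ∀ {t a b c} → Triple G t a b c → Ess a → Ess b → M (∃[ d ] ∃₂ λ p q → Triple G d a p q × d a ≢ t a))
  (ess-shared : ∀ {t t' u u' a b} → Triple G t u a b → Triple G t' u' a b → u ≢ u' → Ess u → M (Double G u))
  {x y : Fin n} (x≢y : x ≢ y) (ends : ∀ {v} → ¬ Ess v → v ≡ x ⊎ v ≡ y) where

  5≤n : 5 ≤ n
  5≤n = ℕ.≤-trans (ℕ.n≤1+n 5) 6≤n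

  open PrimeGraph 5≤n {G} prime
  open PrimeTriples 5≤n {G} prime

  few : ∀ {a b c} → a ≢ b → a ≢ c → b ≢ c → ¬ Ess a → ¬ Ess b → ¬ Ess c → ⊥
  few a≢b a≢c b≢c ¬a ¬b ¬c = pigeonhole a≢b a≢c b≢c (ends ¬a) (ends ¬b) (ends ¬c)

  double : ∀ {d e v p q p' q'} → Triple G d v p q → Triple G e v p' q' → d v ≢ e v → Double G v
  double t t' neq = _ , _ , (_ , _ , t) , (_ , _ , t') , neq

  third-≢ : ∀ {d e v w s t} → Triple G d v w s → Triple G e v w t → d v ≢ e v → s ≢ t
  third-≢ t t' neq refl = neq (same-support⇒same t t' _)

  partner-≢ : ∀ {d e v w s t} → Triple G d v w s → Triple G e v w t → d v ≢ e v → d w ≢ e w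
  partner-≢ t t' neq = share⇒differ (swap₁₂ t) (swap₁₂ t') (third-≢ t t' neq)

  -- The sum of the three triples is a triple on `s`, `t`, `r`. If `s` were in `Ess`, a triple with
  -- another direction at `s` would meet both `D` and this sum in a second vertex. It would consist
  -- of `s`, one of `v`, `w`, and one of `t`, `r`, so four vertices would carry three triples.
  pencil-end : ∀ {d e f v w s t r} → Triple G d v w s → Triple G e v w t → Triple G f v w r →
    d v ≢ e v → d v ≢ f v → e v ≢ f v → ¬ Ess s
  pencil-end {d} {e} {f} {v} {w} {s} {t} {r} D E F de df ef ess-s =
    ess-pair (rotʳ D) ess-s (double⇒ess (double D E de)) λ (g , _ , _ , R , g≢) →
      let g≢ = g≢ ∘ sym in [ (λ (_ , R , _) → via-v R g≢) , (λ (_ , R , _) → via-w R g≢) ]′ (cross (rotʳ D) R g≢)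
    where
    s≢t = third-≢ D E de
    s≢r = third-≢ D F df
    t≢r = third-≢ E F ef
    σ = (d ⊞ e) ⊞ f
    σs : σ s ≡ d s
    σs = trans (cong₂ (λ p q → d s ⊕ p ⊕ q) (off E (a≢c D ∘ sym) (b≢c D ∘ sym) s≢t) (off F (a≢c D ∘ sym) (b≢c D ∘ sym) s≢r))
      (trans (⊕-identityʳ _) (⊕-identityʳ _))
    Σ-triple : Triple G σ s t r
    Σ-triple = to-triple s≢t s≢r t≢r (L-⊞ (L-⊞ (mem D) (mem E)) (mem F))
      (λ us ut ur → value-at σ (⊕-distinct _ _ _ (at₁ D) (at₁ E) (at₁ F) de df ef) λ uv →
        value-at σ (⊕-distinct _ _ _ (at₂ D) (at₂ E) (at₂ F) (partner-≢ D E de) (partner-≢ D F df) (partner-≢ E F ef)) λ uw →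
          cong₂ _⊕_ (cong₂ _⊕_ (off D uv uw us) (off E uv uw ut)) (off F uv uw ur))
      {s} (λ eq → at₃ D (trans (sym σs) eq))
    via-v : ∀ {g q} → Triple G g s v q → d s ≢ g s → ⊥
    via-v R g≢ = case cross Σ-triple R (λ eq → g≢ (trans (sym σs) eq)) of λ where
      (inj₁ (_ , R' , _)) → no-three-in-four 6≤n prime D E (swap₁₂ (third-is R (at₂ R') (s≢t ∘ sym) (a≢c E ∘ sym)))
      (inj₂ (_ , R' , _)) → no-three-in-four 6≤n prime D F (swap₁₂ (third-is R (at₂ R') (s≢r ∘ sym) (a≢c F ∘ sym)))
    via-w : ∀ {g q} → Triple G g s w q → d s ≢ g s → ⊥
    via-w R g≢ = case cross Σ-triple R (λ eq → g≢ (trans (sym σs) eq)) of λ where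
      (inj₁ (_ , R' , _)) → no-three-in-four 6≤n prime (swap₁₂ D) (swap₁₂ E) (swap₁₂ (third-is R (at₂ R') (s≢t ∘ sym) (b≢c E ∘ sym)))
      (inj₂ (_ , R' , _)) → no-three-in-four 6≤n prime (swap₁₂ D) (swap₁₂ F) (swap₁₂ (third-is R (at₂ R') (s≢r ∘ sym) (b≢c F ∘ sym)))

  -- Three directions would give a pencil through two common vertices, whose three ends lie outside
  -- `Ess`, or three triples inside four vertices.
  two-directions : ∀ {d e f v p q p' q' p'' q''} → Triple G d v p q → Triple G e v p' q' → Triple G f v p'' q'' →
    d v ≢ e v → d v ≢ f v → e v ≢ f v → ⊥
  two-directions {d} {e} {f} {v} D E F de df ef =
      [ (λ (_ , E' , _) → go D E') , (λ (_ , E' , _) → go (swap₂₃ D) E') ]′ (cross D E de)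
    where
    go : ∀ {w s t} → Triple G d v w s → Triple G e v w t → ⊥
    go {w} {s} {t} D E = case cross D F df of λ where
        (inj₁ (r , F , _)) → few (third-≢ D E de) (third-≢ D F df) (third-≢ E F ef) (pencil-end D E F de df ef)
          (pencil-end E D F (de ∘ sym) ef df) (pencil-end F D E (df ∘ sym) (ef ∘ sym) de)
        (inj₂ (r , F , r≢w , _)) → case cross E F ef of λ where
          (inj₁ (_ , F' , _)) → [ b≢c D , r≢w ∘ sym ]′ (only F (at₂ F') (a≢b D ∘ sym))
          (inj₂ (_ , F' , _)) → no-three-in-four 6≤n prime D E (third-is F (at₂ F') (a≢c E ∘ sym) (third-≢ D E de ∘ sym))
      where
      only : ∀ {s r} → Triple G f v s r → f w ≢ 𝐈 → w ≢ v → w ≡ s ⊎ w ≡ r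
      only F fw wv = [ (λ eq → ⊥-elim (wv eq)) , id ]′ (elem F fw)

  -- The inner position in a chain m, p, v, p', m': `U` is the middle triple, and its two
  -- overlapping neighbours have the same direction `z` at `v`.
  record Centre (v : Fin n) (U : Vector n) (z : Pauli) : Set where
    constructor centre
    field
      {p p' m m'} : Fin n
      {T T'} : Vector n
      Uᵗ : Triple G U v p p'
      Tᵗ : Triple G T v p m
      T'ᵗ : Triple G T' v p' m'
      Tz : T v ≡ z
      T'z : T' v ≡ z
      U≢z : U v ≢ z
    m≢p' : m ≢ p'
    m≢p' = third-≢ Tᵗ Uᵗ λ eq → U≢z (trans (sym eq) Tz)
    p≢m' : p ≢ m'
    p≢m' = third-≢ (swap₂₃ Uᵗ) T'ᵗ λ eq → U≢z (trans eq T'z)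
    T≢T' : ¬ (T ≗ T')
    T≢T' T≗T' = [ a≢b Tᵗ ∘ sym , [ b≢c Uᵗ , p≢m' ]′ ]′ (elem T'ᵗ λ eq → at₂ Tᵗ (trans (T≗T' _) eq))
    m≢m' : m ≢ m'
    m≢m' eq = T≢T' (agree⇒same (swap₂₃ Tᵗ) (swap₂₃ (subst (Triple G T' v p') (sym eq) T'ᵗ)) (trans Tz (sym T'z)))

  centre-swap : ∀ {v U z} → Centre v U z → Centre v U z
  centre-swap (centre u t t' tz t'z u≢z) = centre (swap₂₃ u) t' t t'z tz u≢z

  -- By `two-directions` the direction of `W` is that of `U`. Crossing with `T` and `T'` shows that
  -- `W` contains `p` or `m`, and `p'` or `m'`. It agrees with `U` unless it consists of `v`, `m`,
  -- `m'`, which is the quadrangle.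
  centre-unique : ∀ {v U z} → Centre v U z → ∀ {W a b} → Triple G W v a b → W v ≢ z → W ≗ U
  centre-unique {v} {U} {z} c {W} w W≢z = decidable-stable (Fin.all? λ u → W u ≟ᵖ U u) λ W≢U → differing W≢U
    where
    open Centre c
    W≡U : W v ≡ U v
    W≡U = decidable-stable (W v ≟ᵖ U v) λ neq → two-directions w Uᵗ Tᵗ neq (λ eq → W≢z (trans eq Tz)) (λ eq → U≢z (trans eq Tz))
    differing : ¬ (W ≗ U) → ⊥
    differing W≢U = case cross Tᵗ w (λ eq → W≢z (trans (sym eq) Tz)) of λ where
      (inj₁ (_ , w' , _)) → W≢U (agree⇒same w' Uᵗ W≡U)
      (inj₂ (_ , w' , _)) → case cross T'ᵗ w' (λ eq → W≢z (trans (sym eq) T'z)) of λ where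
        (inj₁ (_ , w″ , _)) → W≢U (agree⇒same w″ (swap₂₃ Uᵗ) W≡U)
        (inj₂ (_ , w″ , _)) → no-theta (quadrangle⇒theta 6≤n prime Tᵗ T'ᵗ Uᵗ (third-is w' (at₂ w″) (a≢c T'ᵗ ∘ sym) (m≢m' ∘ sym))
          (trans Tz (sym T'z)) (sym W≡U) p≢m' m≢p')

  centre-double : ∀ {v U z} → Centre v U z → Double G v
  centre-double c = double Uᵗ Tᵗ λ eq → U≢z (trans eq Tz)
    where open Centre c

  -- The position at the end of a chain, where just two triples contain `v`; they share a further
  -- vertex `w`.
  record Pair (v w s t : Fin n) (T₁ T₂ : Vector n) : Set where
    constructor pair
    field
      t₁ : Triple G T₁ v w s
      t₂ : Triple G T₂ v w t
      differ : T₁ v ≢ T₂ v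
      only : ∀ {S a b} → Triple G S v a b → (S ≗ T₁) ⊎ (S ≗ T₂)

  pair-swap : ∀ {v w s t T₁ T₂} → Pair v w s t T₁ T₂ → Pair v w t s T₂ T₁
  pair-swap (pair t₁ t₂ neq only) = pair t₂ t₁ (neq ∘ sym) (swap ∘ only)

  pair-double : ∀ {v w s t T₁ T₂} → Pair v w s t T₁ T₂ → Double G v
  pair-double (pair t₁ t₂ neq only) = double t₁ t₂ neq

  partner-double : ∀ {v w s t T₁ T₂} → Pair v w s t T₁ T₂ → Double G w
  partner-double (pair t₁ t₂ neq only) = double (swap₁₂ t₁) (swap₁₂ t₂) (partner-≢ t₁ t₂ neq)

  pair-match : ∀ {v w s t T₁ T₂} → Pair v w s t T₁ T₂ → ∀ {A B u a b} → Triple G A v u a → Triple G B v u b → A v ≢ B v →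
    u ≡ w × ((A ≗ T₁ × B ≗ T₂) ⊎ (A ≗ T₂ × B ≗ T₁))
  pair-match {v} {w} {T₁ = T₁} {T₂} (pair t₁ t₂ neq only) {A} {B} {u} A' B' A≢B = case only A' , only B' of λ where
      (inj₁ a , inj₁ b) → ⊥-elim (A≢B (trans (a v) (sym (b v))))
      (inj₂ a , inj₂ b) → ⊥-elim (A≢B (trans (a v) (sym (b v))))
      (inj₁ a , inj₂ b) → common (λ eq → at₂ A' (trans (a u) eq)) (λ eq → at₂ B' (trans (b u) eq)) , inj₁ (a , b)
      (inj₂ a , inj₁ b) → common (λ eq → at₂ B' (trans (b u) eq)) (λ eq → at₂ A' (trans (a u) eq)) , inj₂ (a , b)
    where
    common : T₁ u ≢ 𝐈 → T₂ u ≢ 𝐈 → u ≡ w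
    common ne₁ ne₂ with elem t₁ ne₁ | elem t₂ ne₂
    ... | inj₁ eq | _ = ⊥-elim (a≢b A' (sym eq))
    ... | inj₂ (inj₁ eq) | _ = eq
    ... | inj₂ (inj₂ _) | inj₁ eq = ⊥-elim (a≢b A' (sym eq))
    ... | inj₂ (inj₂ _) | inj₂ (inj₁ eq) = eq
    ... | inj₂ (inj₂ us) | inj₂ (inj₂ ut) = ⊥-elim (third-≢ t₁ t₂ neq (trans (sym us) ut))

  centre-pair : ∀ {v U z w s t T₁ T₂} → Centre v U z → Pair v w s t T₁ T₂ → ⊥
  centre-pair {v} c (pair t₁ t₂ neq only) = case only Uᵗ , only Tᵗ , only T'ᵗ of λ where
      (_ , inj₁ a , inj₁ b) → T≢T' λ u → trans (a u) (sym (b u))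
      (_ , inj₂ a , inj₂ b) → T≢T' λ u → trans (a u) (sym (b u))
      (inj₁ a , inj₁ b , inj₂ _) → U≢z (trans (a v) (trans (sym (b v)) Tz))
      (inj₁ a , inj₂ _ , inj₁ b) → U≢z (trans (a v) (trans (sym (b v)) T'z))
      (inj₂ a , inj₁ _ , inj₂ b) → U≢z (trans (a v) (trans (sym (b v)) T'z))
      (inj₂ a , inj₂ b , inj₁ _) → U≢z (trans (a v) (trans (sym (b v)) Tz))
    where open Centre c

  -- A third triple has one of the two known directions, say that of `D`. It cannot contain `w`
  -- without being `D`, so it shares with `E` the vertex `t`, and `E` becomes the middle triple of a
  -- centre.
  centre-or-pair : ∀ {v} → Double G v →
    M ((∃₂ λ U z → Centre v U z) ⊎ (∃[ w ] ∃₂ λ s t → ∃₂ λ T₁ T₂ → Pair v w s t T₁ T₂))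
  centre-or-pair {v} (d , e , (_ , _ , D) , (_ , _ , E) , de) =
      [ (λ (_ , E' , _) → go D E') , (λ (_ , E' , _) → go (swap₂₃ D) E') ]′ (cross D E de)
    where
    third : ∀ {d e f w s t a b} → Triple G d v w s → Triple G e v w t → d v ≢ e v → Triple G f v a b → f v ≡ d v → ¬ (f ≗ d) →
      ∃₂ λ U z → Centre v U z
    third D E de F fd f≢d = case cross E F (λ eq → de (trans (sym fd) (sym eq))) of λ where
      (inj₁ (_ , F' , _)) → ⊥-elim (f≢d (agree⇒same F' D fd))
      (inj₂ (_ , F' , _)) → _ , _ , centre E D F' refl fd (de ∘ sym)
    go : ∀ {w s t} → Triple G d v w s → Triple G e v w t →
      M ((∃₂ λ U z → Centre v U z) ⊎ (∃[ w ] ∃₂ λ s t → ∃₂ λ T₁ T₂ → Pair v w s t T₁ T₂))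
    go D E = do
      more ← excluded-middle (∃[ f ] ∃₂ λ a b → Triple G f v a b × ¬ (f ≗ d) × ¬ (f ≗ e))
      return (case more of λ where
        (yes (f , _ , _ , F , f≢d , f≢e)) → inj₁ (case f v ≟ᵖ d v of λ where
          (yes fd) → third D E de F fd f≢d
          (no fd) → case f v ≟ᵖ e v of λ where
            (yes fe) → third E D (de ∘ sym) F fe f≢e
            (no fe) → ⊥-elim (two-directions D E F de (fd ∘ sym) (fe ∘ sym)))
        (no none) → inj₂ (_ , _ , _ , _ , _ , pair D E de λ {S} F → case Fin.all? (λ u → S u ≟ᵖ d u) of λ where
          (yes eq) → inj₁ eq
          (no neq) → inj₂ (decidable-stable (Fin.all? λ u → S u ≟ᵖ e u) λ neq' → none (S , _ , _ , F , neq , neq'))))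

  -- In the frame to be chosen, U becomes the star of v and z the Z-direction at v. The tie in lone-pair is broken by the
  -- order of Fin n so that the two vertices of the pair get different stars.
  data Star (v : Fin n) (U : Vector n) (z : Pauli) : Set where
    inner : Centre v U z → Star v U z
    outer : ∀ {w s t T U' z'} → Pair v w s t T U → Centre w U' z' → T ≗ U' → T v ≡ z → Star v U z
    lone-pair : ∀ {w w' s t s' t' T T₁ T₂} → Pair v w s t U T → Pair w w' s' t' T₁ T₂ → ¬ Ess s →
      (v Fin.< w × s ≡ x) ⊎ (w Fin.< v × s ≡ y) → T v ≡ z → Star v U z
    single : ∀ {a b} → Triple G U v a b → ¬ Ess a → ¬ Ess b → ¬ Double G v → z ≢ U v → z ≢ 𝐈 → Star v U z

  star-triple : ∀ {v U z} → Star v U z → (∃₂ λ a b → Triple G U v a b) × U v ≢ z × z ≢ 𝐈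
  star-triple (inner c) = (_ , _ , Uᵗ) , U≢z , λ eq → at₁ Tᵗ (trans Tz eq)
    where open Centre c
  star-triple (outer (pair t₁ t₂ neq _) _ _ refl) = (_ , _ , t₂) , neq ∘ sym , at₁ t₁
  star-triple (lone-pair (pair t₁ t₂ neq _) _ _ _ refl) = (_ , _ , t₁) , neq , at₁ t₂
  star-triple (single t _ _ _ z≢ z≢𝐈) = (_ , _ , t) , z≢ ∘ sym , z≢𝐈

  -- A triple with another direction at `s` meets the first triple in `v` or `w`, but these lie in
  -- two triples only: the first has the wrong direction at `s`, and the second misses `s`.
  lone-end : ∀ {v w w' s t s' t' T₁ T₂ T₁' T₂'} → Pair v w s t T₁ T₂ → Pair w w' s' t' T₁' T₂' → ¬ Ess s
  lone-end {v} {w} {s = s} {T₁ = T₁} {T₂} P@(pair t₁ t₂ neq only) Q ess-s =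
      ess-pair (rotʳ t₁) ess-s (double⇒ess (pair-double P)) λ (R , _ , _ , r , R≢) →
        case cross (rotʳ t₁) r (R≢ ∘ sym) of λ where
          (inj₁ (_ , r' , _)) → excluded r' R≢ (only (swap₁₂ r'))
          (inj₂ (_ , r' , _)) → excluded r' R≢ (only-w (swap₁₂ r'))
    where
    excluded : ∀ {R a b} → Triple G R s a b → R s ≢ T₁ s → (R ≗ T₁) ⊎ (R ≗ T₂) → ⊥
    excluded r R≢ (inj₁ eq) = R≢ (eq s)
    excluded r R≢ (inj₂ eq) = at₁ r (trans (eq s) (off t₂ (a≢c t₁ ∘ sym) (b≢c t₁ ∘ sym) (third-≢ t₁ t₂ neq)))
    only-w : ∀ {S a b} → Triple G S w a b → (S ≗ T₁) ⊎ (S ≗ T₂)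
    only-w S with pair-match Q (swap₁₂ t₁) (swap₁₂ t₂) (partner-≢ t₁ t₂ neq) | Pair.only Q S
    ... | _ , inj₁ (a , b) | inj₁ c = inj₁ λ u → trans (c u) (sym (a u))
    ... | _ , inj₁ (a , b) | inj₂ c = inj₂ λ u → trans (c u) (sym (b u))
    ... | _ , inj₂ (a , b) | inj₁ c = inj₂ λ u → trans (c u) (sym (b u))
    ... | _ , inj₂ (a , b) | inj₂ c = inj₁ λ u → trans (c u) (sym (a u))

  another-direction : (p : Pauli) → p ≢ 𝐈 → ∃[ z ] z ≢ p × z ≢ 𝐈
  another-direction 𝐈 p≢ = ⊥-elim (p≢ refl)
  another-direction 𝐗 _ = 𝐙 , (λ ()) , λ ()
  another-direction 𝐘 _ = 𝐙 , (λ ()) , λ ()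
  another-direction 𝐙 _ = 𝐗 , (λ ()) , λ ()

  star-exists : ∀ {v} → Ess v → M (∃₂ λ U z → Star v U z)
  star-exists {v} ess-v = do
      yes dbl ← excluded-middle (Double G v)
        where no ¬dbl → do
                (U , a , b , t) ← ess⇒triple ess-v
                let z , z≢ , z≢𝐈 = another-direction (U v) (at₁ t)
                    ¬ess : ∀ {a b} → Triple G U v a b → ¬ Ess a
                    ¬ess t ess-a = ess-pair t ess-v ess-a λ (_ , _ , _ , t' , neq) → ¬dbl (double t' t neq)
                return (U , z , single t (¬ess t) (¬ess (swap₂₃ t)) ¬dbl z≢ z≢𝐈)
      inj₂ (w , s , t , T₁ , T₂ , P) ← centre-or-pair dbl
        where inj₁ (U , z , c) → return (U , z , inner c)
      inj₂ (w' , s' , t' , T₁' , T₂' , Q) ← centre-or-pair (partner-double P)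
        where inj₁ (U , z , c) → return (beside P c)
      return (isolated P Q)
    where
    beside : ∀ {w s t T₁ T₂ U z} → Pair v w s t T₁ T₂ → Centre w U z → ∃₂ λ U z → Star v U z
    beside {w} {T₁ = T₁} {T₂} {z = z} P@(pair t₁ t₂ neq only) c = case T₁ w ≟ᵖ z of λ where
      -- The triple whose direction at `w` is not `z` is the middle triple of `w`; the other one
      -- becomes the star of `v`.
      (no T₁≢z) → T₂ , T₁ v , outer P c (centre-unique c (swap₁₂ t₁) T₁≢z) refl
      (yes T₁≡z) → T₁ , T₂ v , outer (pair-swap P) c
        (centre-unique c (swap₁₂ t₂) λ T₂≡z → partner-≢ t₁ t₂ neq (trans T₁≡z (sym T₂≡z))) refl
    isolated : ∀ {w w' s t s' t' T₁ T₂ T₁' T₂'} → Pair v w s t T₁ T₂ → Pair w w' s' t' T₁' T₂' → ∃₂ λ U z → Star v U z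
    isolated {w} P@(pair t₁ t₂ neq _) Q = order (ends ¬s) (ends ¬t) (Fin.<-cmp v w)
      where
      ¬s = lone-end P Q
      ¬t = lone-end (pair-swap P) Q
      first : _ → _
      first tie = _ , _ , lone-pair P Q ¬s tie refl
      second : _ → _
      second tie = _ , _ , lone-pair (pair-swap P) Q ¬t tie refl
      order : _ ≡ x ⊎ _ ≡ y → _ ≡ x ⊎ _ ≡ y → Tri (v Fin.< w) (v ≡ w) (w Fin.< v) → ∃₂ λ U z → Star v U z
      order _ _ (tri≈ _ eq _) = ⊥-elim (a≢b t₁ eq)
      order (inj₁ s≡x) (inj₁ t≡x) _ = ⊥-elim (third-≢ t₁ t₂ neq (trans s≡x (sym t≡x)))
      order (inj₂ s≡y) (inj₂ t≡y) _ = ⊥-elim (third-≢ t₁ t₂ neq (trans s≡y (sym t≡y)))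
      order (inj₁ s≡x) (inj₂ t≡y) (tri< v<w _ _) = first (inj₁ (v<w , s≡x))
      order (inj₁ s≡x) (inj₂ t≡y) (tri> _ _ w<v) = second (inj₂ (w<v , t≡y))
      order (inj₂ s≡y) (inj₁ t≡x) (tri< v<w _ _) = second (inj₁ (v<w , t≡x))
      order (inj₂ s≡y) (inj₁ t≡x) (tri> _ _ w<v) = first (inj₂ (w<v , s≡y))

  centre-cong : ∀ {v U U' z} → U ≗ U' → Centre v U z → Centre v U' z
  centre-cong U≗U' (centre u t t' tz t'z u≢z) = centre (triple-cong U≗U' u) t t' tz t'z λ eq → u≢z (trans (U≗U' _) eq)

  -- A triple with another direction at `m` would differ from `T` at `a` or `b` as well, hence be
  -- the middle triple `U`, which misses `m`.
  centre-leaf : ∀ {a b m U T z z'} → Centre a U z → Centre b U z' → Triple G T m a b → T a ≡ z → T b ≡ z' → U m ≡ 𝐈 → ¬ Ess m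
  centre-leaf {m = m} ca cb t Ta Tb Um ess-m = ess-pair t ess-m (double⇒ess (centre-double ca)) λ (R , _ , _ , r , R≢) →
    case cross t r (R≢ ∘ sym) of λ where
      (inj₁ (_ , r' , _ , neq)) → at₁ r (trans (centre-unique ca (swap₁₂ r') (λ eq → neq (trans Ta (sym eq))) m) Um)
      (inj₂ (_ , r' , _ , neq)) → at₁ r (trans (centre-unique cb (swap₁₂ r') (λ eq → neq (trans Tb (sym eq))) m) Um)

  -- Otherwise `U` would be the middle triple at all of `v`, `p`, `p'`. The triples joining these in
  -- pairs would then have three distinct third vertices, all outside `Ess` by `centre-leaf`.
  centre-centre : ∀ {v U z} (c : Centre v U z) → ∀ {U' z'} → Centre (Centre.p c) U' z' → U (Centre.p c) ≡ z'
  centre-centre {v} {U} {z} c {U'} {z'} c' = decidable-stable (U p ≟ᵖ z') λ Up≢z' → shared Up≢z' (second Up≢z')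
    where
    open Centre c
    second : U p ≢ z' → ∃₂ λ B n' → Triple G B p p' n' × B p ≡ z'
    second Up≢z' with elem (Centre.Uᵗ c') (λ eq → at₃ Uᵗ (trans (centre-unique c' (swap₁₂ Uᵗ) Up≢z' p') eq))
    ... | inj₁ eq = ⊥-elim (b≢c Uᵗ (sym eq))
    ... | inj₂ (inj₁ eq) = _ , _ , subst (λ w → Triple G _ p w _) (sym eq) (Centre.Tᵗ c') , Centre.Tz c'
    ... | inj₂ (inj₂ eq) = _ , _ , subst (λ w → Triple G _ p w _) (sym eq) (Centre.T'ᵗ c') , Centre.T'z c'
    shared : U p ≢ z' → (∃₂ λ B n' → Triple G B p p' n' × B p ≡ z') → ⊥
    shared Up≢z' (B , n' , Bᵗ , Bz) = few m≢m' m≢n' m'≢n'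
        (centre-leaf c cp (rotʳ Tᵗ) Tz Tp (off Uᵗ (a≢c Tᵗ ∘ sym) (b≢c Tᵗ ∘ sym) m≢p'))
        (centre-leaf c cp' (rotʳ T'ᵗ) T'z refl (off Uᵗ (a≢c T'ᵗ ∘ sym) (p≢m' ∘ sym) (b≢c T'ᵗ ∘ sym)))
        (centre-leaf cp cp' (rotʳ Bᵗ) Bz Bp' (off Uᵗ n'≢v (a≢c Bᵗ ∘ sym) (b≢c Bᵗ ∘ sym)))
      where
      cp : Centre p U z'
      cp = centre-cong (λ u → sym (centre-unique c' (swap₁₂ Uᵗ) Up≢z' u)) c'
      Tp : T p ≡ z'
      Tp = decidable-stable (T p ≟ᵖ z') λ Tp≢z' → [ a≢c Uᵗ ∘ sym , [ b≢c Uᵗ ∘ sym , m≢p' ∘ sym ]′ ]′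
        (elem Tᵗ λ eq → at₃ Uᵗ (trans (sym (centre-unique cp (swap₁₂ Tᵗ) Tp≢z' p')) eq))
      Up≢Bp : U p ≢ B p
      Up≢Bp eq = Up≢z' (trans eq Bz)
      n'≢v : n' ≢ v
      n'≢v eq = third-≢ (swap₂₃ (swap₁₂ Uᵗ)) Bᵗ Up≢Bp (sym eq)
      Up'≢Bp' : U p' ≢ B p'
      Up'≢Bp' = partner-≢ (swap₂₃ (swap₁₂ Uᵗ)) Bᵗ Up≢Bp
      Up'≢T'p' : U p' ≢ T' p'
      Up'≢T'p' = partner-≢ (swap₂₃ Uᵗ) T'ᵗ λ eq → U≢z (trans eq T'z)
      Bp' : B p' ≡ T' p'
      Bp' = decidable-stable (B p' ≟ᵖ T' p') λ neq → two-directions (rotʳ Uᵗ) (swap₁₂ Bᵗ) (swap₁₂ T'ᵗ) Up'≢Bp' Up'≢T'p' neq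
      cp' : Centre p' U (T' p')
      cp' = centre (rotʳ Uᵗ) (swap₁₂ T'ᵗ) (swap₁₂ Bᵗ) refl Bp' Up'≢T'p'
      m≢n' : m ≢ n'
      m≢n' eq = [ a≢b Uᵗ , [ a≢c Uᵗ , n'≢v ∘ sym ]′ ]′
        (elem Bᵗ λ Bv → at₁ Tᵗ (trans (agree⇒same (rotˡ Tᵗ) (swap₂₃ (subst (Triple G B p p') (sym eq) Bᵗ)) (trans Tp (sym Bz)) v) Bv))
      m'≢n' : m' ≢ n'
      m'≢n' eq = [ a≢b Uᵗ ∘ sym , [ b≢c Uᵗ , p≢m' ]′ ]′ (elem T'ᵗ λ T'p → at₁ Bᵗ
        (trans (agree⇒same (rotˡ (subst (Triple G B p p') (sym eq) Bᵗ)) (rotˡ T'ᵗ) Bp' p) T'p))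

  inner-consistent : ∀ {v U z} (c : Centre v U z) → ∀ {U' z'} → Star (Centre.p c) U' z' → U (Centre.p c) ≡ z'
  inner-consistent c (inner c') = centre-centre c c'
  inner-consistent {v} {U} {z} c (outer P cw T°≗U₁ Tz°) = case pair-match P (swap₁₂ Uᵗ) (swap₁₂ Tᵗ)
      (partner-≢ Uᵗ Tᵗ λ eq → U≢z (trans eq Tz)) of λ where
      (refl , inj₁ (U≗T° , _)) → trans (U≗T° _) Tz°
      (refl , inj₂ (_ , T≗T°)) → ⊥-elim (T≢T' λ u → trans (T≗T° u) (trans (T°≗U₁ u) (sym (centre-unique cw T'ᵗ
        (λ eq → Centre.U≢z cw (trans (sym (trans (T≗T° v) (T°≗U₁ v))) (trans (trans Tz (sym T'z)) eq))) u))))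
    where open Centre c
  inner-consistent c (lone-pair P Q _ _ _) = case pair-match P (swap₁₂ Uᵗ) (swap₁₂ Tᵗ)
      (partner-≢ Uᵗ Tᵗ λ eq → U≢z (trans eq Tz)) of λ { (refl , _) → ⊥-elim (centre-pair c Q) }
    where open Centre c
  inner-consistent c (single _ _ _ ¬dbl _ _) = ⊥-elim (¬dbl (double (swap₁₂ Uᵗ) (swap₁₂ Tᵗ) (partner-≢ Uᵗ Tᵗ λ eq → U≢z (trans eq Tz))))
    where open Centre c

  outer-end : ∀ {v w s t T U U₁ z₁} → Pair v w s t T U → Centre w U₁ z₁ → T ≗ U₁ → ¬ Ess t
  outer-end {v} {w} {t = t} {T} {U} {z₁ = z₁} P@(pair t₁ t₂ neq only) cw T≗U₁ ess-t =
      ess-pair (rotʳ t₂) ess-t (double⇒ess (pair-double P)) λ (R , _ , _ , r , R≢) → case cross (rotʳ t₂) r (R≢ ∘ sym) of λ where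
        (inj₁ (_ , r' , _)) → case only (swap₁₂ r') of λ where
          (inj₁ R≗T) → at₁ r (trans (R≗T t) Tt)
          (inj₂ R≗U) → R≢ (R≗U t)
        (inj₂ (_ , r' , _ , neq')) → at₁ r (trans (centre-unique cw (swap₁₂ r') (λ eq → neq' (trans Uw (sym eq))) t) (trans (sym (T≗U₁ t)) Tt))
    where
    Tt : T t ≡ 𝐈
    Tt = off t₁ (a≢c t₂ ∘ sym) (b≢c t₂ ∘ sym) (third-≢ t₁ t₂ neq ∘ sym)
    Uw : U w ≡ z₁
    Uw = decidable-stable (U w ≟ᵖ z₁) λ Uw≢ → neq (trans (T≗U₁ v) (sym (centre-unique cw (swap₁₂ t₂) Uw≢ v)))

  -- The compatibility on which the frame rests: the direction that one star needs at another
  -- essential vertex is the one chosen as Z there.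
  star-consistent : ∀ {v U z a U' z'} → Star v U z → Star a U' z' → a ≢ v → U a ≢ 𝐈 → Ess a → U a ≡ z'
  star-consistent (inner c) S a≢v Ua _ with elem (Centre.Uᵗ c) Ua
  ... | inj₁ eq = ⊥-elim (a≢v eq)
  ... | inj₂ (inj₁ refl) = inner-consistent c S
  ... | inj₂ (inj₂ refl) = inner-consistent (centre-swap c) S
  star-consistent {U = U} {z' = z'} (outer {w = w} {T = T} P@(pair t₁ t₂ neq only) cw T≗U₁ _) S a≢v Ua ess-a with elem t₂ Ua
  ... | inj₁ eq = ⊥-elim (a≢v eq)
  ... | inj₂ (inj₂ refl) = ⊥-elim (outer-end P cw T≗U₁ ess-a)
  ... | inj₂ (inj₁ refl) = at-w S
    where
    at-w : ∀ {U' z'} → Star w U' z' → U w ≡ z'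
    at-w {U'} {z'} (inner c') = decidable-stable (U w ≟ᵖ z') λ Uw≢z' →
      let U≗U' = centre-unique c' (swap₁₂ t₂) Uw≢z'
          Tw = decidable-stable (T w ≟ᵖ z') λ Tw≢z' → neq (trans (centre-unique c' (swap₁₂ t₁) Tw≢z' _) (sym (U≗U' _)))
          z'≢ : ∀ {r} → r ≡ z' → r ≢ _
          z'≢ r≡ eq = Centre.U≢z cw (trans (sym (T≗U₁ w)) (trans Tw (trans (sym r≡) eq)))
      in Centre.T≢T' c' λ u → trans (centre-unique cw (Centre.Tᵗ c') (z'≢ (Centre.Tz c')) u)
           (sym (centre-unique cw (Centre.T'ᵗ c') (z'≢ (Centre.T'z c')) u))
    at-w (outer P' _ _ _) = ⊥-elim (centre-pair cw P')
    at-w (lone-pair P' _ _ _ _) = ⊥-elim (centre-pair cw P')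
    at-w (single _ _ _ ¬dbl _ _) = ⊥-elim (¬dbl (centre-double cw))
  star-consistent {v} {U = U} (lone-pair {w = w} {s = s} {T = T} P@(pair t₁ t₂ neq only) Q ¬s tie _) S a≢v Ua ess-a with elem t₁ Ua
  ... | inj₁ eq = ⊥-elim (a≢v eq)
  ... | inj₂ (inj₂ refl) = ⊥-elim (¬s ess-a)
  ... | inj₂ (inj₁ refl) = at-w S
    where
    at-w : ∀ {U' z'} → Star w U' z' → U w ≡ z'
    at-w (inner c') = ⊥-elim (centre-pair c' Q)
    at-w (outer P' cw' _ _) = case pair-match P' (swap₁₂ t₁) (swap₁₂ t₂) (partner-≢ t₁ t₂ neq) of λ
      { (refl , _) → ⊥-elim (centre-pair cw' P) }
    at-w {U'} (lone-pair {s = s°} P' Q' _ tie° T°z) = case pair-match P' (swap₁₂ t₁) (swap₁₂ t₂) (partner-≢ t₁ t₂ neq) of λ where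
        (refl , inj₂ (U≗T° , _)) → trans (U≗T° w) T°z
        -- Here `v` and `w` would have chosen the same triple; the tie-breaking forbids it.
        (refl , inj₁ (U≗U' , _)) → ⊥-elim (clash tie tie° (same-end U≗U' (Pair.t₁ P')))
      where
      same-end : U ≗ U' → Triple G U' w v s° → s ≡ s°
      same-end U≗U' t = [ (λ eq → ⊥-elim (b≢c t₁ (sym eq))) , [ (λ eq → ⊥-elim (a≢c t₁ (sym eq))) , id ]′ ]′
        (elem t λ eq → at₃ t₁ (trans (U≗U' s) eq))
      clash : (v Fin.< w × s ≡ x) ⊎ (w Fin.< v × s ≡ y) → (w Fin.< v × s° ≡ x) ⊎ (v Fin.< w × s° ≡ y) → s ≡ s° → ⊥
      clash (inj₁ (v<w , _)) (inj₁ (w<v , _)) _ = ℕ.<-asym v<w w<v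
      clash (inj₁ (_ , s≡x)) (inj₂ (_ , s°≡y)) eq = x≢y (trans (sym s≡x) (trans eq s°≡y))
      clash (inj₂ (_ , s≡y)) (inj₁ (_ , s°≡x)) eq = x≢y (trans (sym s°≡x) (trans (sym eq) s≡y))
      clash (inj₂ (w<v , _)) (inj₂ (v<w , _)) _ = ℕ.<-asym v<w w<v
    at-w (single _ _ _ ¬dbl _ _) = ⊥-elim (¬dbl (pair-double Q))
  star-consistent (single t ¬a ¬b _ _ _) S a≢v Ua ess-a with elem t Ua
  ... | inj₁ eq = ⊥-elim (a≢v eq)
  ... | inj₂ (inj₁ refl) = ⊥-elim (¬a ess-a)
  ... | inj₂ (inj₂ refl) = ⊥-elim (¬b ess-a)

  EndShape : Fin n → Vector n → Fin n → Set
  EndShape v U e = (∃[ w ] Triple G U v w e × ∃₂ λ s t → ∃₂ λ T₁ T₂ → Pair v w s t T₁ T₂)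
                 ⊎ (∃[ b ] Triple G U v e b × ¬ Ess b × ¬ Double G v)

  end-shape : ∀ {v U z e} → Star v U z → e ≢ v → U e ≢ 𝐈 → ¬ Ess e → EndShape v U e
  end-shape (inner c) e≢v Ue ¬e = ⊥-elim (¬e (double⇒ess (case elem Uᵗ Ue of λ where
      (inj₁ eq) → ⊥-elim (e≢v eq)
      (inj₂ (inj₁ refl)) → double (swap₁₂ Uᵗ) (swap₁₂ Tᵗ) (partner-≢ Uᵗ Tᵗ λ eq → U≢z (trans eq Tz))
      (inj₂ (inj₂ refl)) → double (rotʳ Uᵗ) (swap₁₂ T'ᵗ) (partner-≢ (swap₂₃ Uᵗ) T'ᵗ λ eq → U≢z (trans eq T'z)))))
    where open Centre c
  end-shape (outer P _ _ _) e≢v Ue ¬e = case elem (Pair.t₂ P) Ue of λ where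
    (inj₁ eq) → ⊥-elim (e≢v eq)
    (inj₂ (inj₁ refl)) → ⊥-elim (¬e (double⇒ess (partner-double P)))
    (inj₂ (inj₂ refl)) → inj₁ (_ , Pair.t₂ P , _ , _ , _ , _ , P)
  end-shape (lone-pair P _ _ _ _) e≢v Ue ¬e = case elem (Pair.t₁ P) Ue of λ where
    (inj₁ eq) → ⊥-elim (e≢v eq)
    (inj₂ (inj₁ refl)) → ⊥-elim (¬e (double⇒ess (partner-double P)))
    (inj₂ (inj₂ refl)) → inj₁ (_ , Pair.t₁ P , _ , _ , _ , _ , P)
  end-shape (single t ¬a ¬b ¬dbl _ _) e≢v Ue ¬e = case elem t Ue of λ where
    (inj₁ eq) → ⊥-elim (e≢v eq)
    (inj₂ (inj₁ refl)) → inj₂ (_ , t , ¬b , ¬dbl)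
    (inj₂ (inj₂ refl)) → inj₂ (_ , swap₂₃ t , ¬a , ¬dbl)

  pair-end-unique : ∀ {v w e s t T₁ T₂ U U' q q'} → Pair v w s t T₁ T₂ → w ≢ e → Triple G U v e q → Triple G U' v e q' → U e ≡ U' e
  pair-end-unique {v} {U = U} {U'} P w≢e t t' = case U v ≟ᵖ U' v of λ where
    (yes eq) → agree⇒same t t' eq _
    (no neq) → ⊥-elim (w≢e (sym (proj₁ (pair-match P t t' neq))))

  paired-end : ∀ {v v' w e s t T₁ T₂ U U' z z'} → ¬ Ess e → Star v U z → Star v' U' z' → e ≢ v' → U' e ≢ 𝐈 →
    Triple G U v w e → Pair v w s t T₁ T₂ → U e ≢ U' e → ⊥
  paired-end {v} {v'} {w} {e} {U = U} {U'} ¬e S S' e≢v' U'e t P neq =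
      case cross (rotʳ t) (proj₂ (proj₂ (refocus (proj₂ (proj₂ (proj₁ (star-triple S')))) U'e))) neq of λ where
        (inj₁ (_ , t' , _)) → neq (pair-end-unique P (b≢c t) (swap₂₃ t) (swap₁₂ t'))
        (inj₂ (_ , t' , _ , Uw≢U'w)) → case v' ≟ w of λ where
          (no v'≢w) → star-exists ess-w λ (_ , _ , Sw) → Uw≢U'w (trans
            (star-consistent S Sw (a≢b t ∘ sym) (at₂ t) ess-w) (sym (star-consistent S' Sw (v'≢w ∘ sym) (at₂ t') ess-w)))
          (yes refl) → case end-shape S' e≢v' U'e ¬e of λ where
            (inj₁ (_ , t″ , _ , _ , _ , _ , P')) → neq (pair-end-unique P' (b≢c t″) (rotˡ t) (swap₁₂ t'))
            (inj₂ (_ , _ , _ , ¬dbl)) → ¬dbl (partner-double P)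
    where
    ess-w : Ess w
    ess-w = double⇒ess (partner-double P)

  -- No star is centred at `e` to dictate a direction, so the stars through `e` must agree among
  -- themselves. Two single stars that disagree have either a common second vertex outside `Ess`,
  -- and `ess-shared` applies, or two different ones, which makes three vertices outside `Ess`.
  end-consistent : ∀ {v v' e U U' z z'} → ¬ Ess e → Ess v → Ess v' → v ≢ v' → Star v U z → Star v' U' z' → U e ≢ 𝐈 → U' e ≢ 𝐈 → U e ≡ U' e
  end-consistent {v} {v'} {e} {U} {U'} ¬e ess-v ess-v' v≢v' S S' Ue U'e = decidable-stable (U e ≟ᵖ U' e) λ neq →
      shapes neq (end-shape S e≢v Ue ¬e) (end-shape S' e≢v' U'e ¬e)
    where
    e≢v : e ≢ v
    e≢v refl = ¬e ess-v
    e≢v' : e ≢ v'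
    e≢v' refl = ¬e ess-v'
    shapes : U e ≢ U' e → EndShape v U e → EndShape v' U' e → ⊥
    shapes neq (inj₁ (_ , t , _ , _ , _ , _ , P)) _ = paired-end ¬e S S' e≢v' U'e t P neq
    shapes neq (inj₂ _) (inj₁ (_ , t , _ , _ , _ , _ , P)) = paired-end ¬e S' S e≢v Ue t P (neq ∘ sym)
    shapes neq (inj₂ (b , t , ¬b , ¬dbl)) (inj₂ (b' , t' , ¬b' , _)) = case b ≟ b' of λ where
      (yes refl) → ess-shared t t' v≢v' ess-v ¬dbl
      (no b≢b') → few (b≢c t) (b≢c t') b≢b' ¬e ¬b ¬b'

  Choice : Fin n → Set
  Choice v = (Ess v × ∃₂ λ U z → Star v U z) ⊎ ¬ Ess v

  EndDirection : (∀ v → Choice v) → Fin n → Set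
  EndDirection choose e = ∃[ p ] p ≢ 𝐈 × (∀ v ess-v U z S → choose v ≡ inj₁ (ess-v , U , z , S) → ¬ Ess e → U e ≢ 𝐈 → U e ≡ p)

  end-direction : (choose : ∀ v → Choice v) → ∀ e → M (EndDirection choose e)
  end-direction choose e = do
      no ¬ess-e ← excluded-middle (Ess e)
        where yes ess-e → return (𝐗 , (λ ()) , λ _ _ _ _ _ _ ¬ess-e → ⊥-elim (¬ess-e ess-e))
      used ← excluded-middle (∃₂ λ v ess-v → ∃₂ λ U z → ∃[ S ] choose v ≡ inj₁ (ess-v , U , z , S) × U e ≢ 𝐈)
      return (case used of λ where
        -- No star passes through `e`, so any nonzero direction serves.
        (no none) → 𝐗 , (λ ()) , λ _ _ _ _ _ eq _ Ue → ⊥-elim (none (_ , _ , _ , _ , _ , eq , Ue))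
        (yes (v , ess-v , U , z , S , eq , Ue)) → U e , Ue , λ v' ess-v' U' z' S' eq' ¬e U'e → same ¬e (v ≟ v') ess-v S eq Ue eq' U'e)
    where
    same : ¬ Ess e → ∀ {v v' U z U' z' ess-v'} {S' : Star v' U' z'} → Dec (v ≡ v') → (ess-v : Ess v) (S : Star v U z) →
      choose v ≡ inj₁ (ess-v , U , z , S) → U e ≢ 𝐈 → choose v' ≡ inj₁ (ess-v' , U' , z' , S') → U' e ≢ 𝐈 → U' e ≡ U e
    same ¬e (yes refl) ess-v S eq Ue eq' U'e with trans (sym eq) eq'
    ... | refl = refl
    same ¬e {ess-v' = ess-v'} {S'} (no v≢v') ess-v S eq Ue eq' U'e = sym (end-consistent ¬e ess-v ess-v' v≢v' S S' Ue U'e)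

  degree2-frame : M (∃[ us ] (∀ {v} → v ≢ x → v ≢ y → Degree2 (G ⋆ us) v))
  degree2-frame = do
    choose ← choice {B = Choice} λ v → do
      yes ess-v ← excluded-middle (Ess v)
        where no ¬ess-v → return (inj₂ ¬ess-v)
      S ← star-exists ess-v
      return (inj₁ (ess-v , S))
    dirs ← choice (end-direction choose)
    return (framed choose dirs)
    where
    framed : (choose : ∀ v → Choice v) → (∀ e → EndDirection choose e) → ∃[ us ] (∀ {v} → v ≢ x → v ≢ y → Degree2 (G ⋆ us) v)
    framed choose dirs = us , λ {v} vx vy → degree2 (choose v) refl vx vy
      where
      direction : ∀ {v} → Choice v → Pauli → Pauli
      direction (inj₁ (_ , _ , z , _)) _ = z
      direction (inj₂ _) p = p
      ζ : Fin n → Pauli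
      ζ v = direction (choose v) (proj₁ (dirs v))
      ζ≢𝐈 : ∀ v → ζ v ≢ 𝐈
      ζ≢𝐈 v with choose v
      ... | inj₁ (_ , _ , _ , S) = proj₂ (proj₂ (star-triple S))
      ... | inj₂ _ = proj₁ (proj₂ (dirs v))
      on-ζ : ∀ {v ess-v U z S} → choose v ≡ inj₁ (ess-v , U , z , S) → ∀ {a} → a ≢ v → U a ≢ 𝐈 → U a ≡ ζ a
      on-ζ {S = S} eq {a} a≢v Ua with choose a | proj₂ (proj₂ (dirs a))
      ... | inj₁ (ess-a , _ , _ , S') | _ = star-consistent S S' a≢v Ua ess-a
      ... | inj₂ ¬ess-a | agree = agree _ _ _ _ _ eq ¬ess-a Ua
      at-ζ : ∀ {v ess-v U z S} → choose v ≡ inj₁ (ess-v , U , z , S) → ζ v ≡ z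
      at-ζ {v} eq = cong (λ c → direction c (proj₁ (dirs v))) eq
      unobstructed : NoObstruction G (just ∘ ζ)
      -- Every star forces an obstruction to vanish at its centre; at most `x` and `y` are left.
      unobstructed d d∈ on = weight>2 x≢y d∈ λ {v} vx vy → zero-at (choose v) refl vx vy
        where
        on′ : ∀ v → d v ≡ 𝐈 ⊎ d v ≡ ζ v
        on′ v = [ inj₁ , inj₂ ∘ Maybe.just-injective ]′ (on v)
        zero-at : ∀ {v} (c : Choice v) → choose v ≡ c → v ≢ x → v ≢ y → d v ≡ 𝐈
        zero-at (inj₂ ¬ess-v) eq vx vy = ⊥-elim ([ vx , vy ]′ (ends ¬ess-v))
        zero-at {v} (inj₁ (ess-v , U , z , S)) eq vx vy = let (_ , _ , t) , Uv≢z , z≢𝐈 = star-triple S in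
          blocked t d∈ z≢𝐈 Uv≢z ([ inj₁ , (λ e → inj₂ (trans e (at-ζ eq))) ]′ (on′ v))
            ([ inj₁ , (λ e → inj₂ (trans e (sym (on-ζ eq (a≢b t ∘ sym) (at₂ t))))) ]′ (on′ _))
            ([ inj₁ , (λ e → inj₂ (trans e (sym (on-ζ eq (a≢c t ∘ sym) (at₃ t))))) ]′ (on′ _))
      rotated = rotation G (just ∘ ζ) (λ v eq → ζ≢𝐈 v (Maybe.just-injective eq)) unobstructed
      us = proj₁ rotated
      to𝐙 : ∀ {v p} → p ≡ ζ v → τ* G us v p ≡ 𝐙
      to𝐙 {v} eq = proj₁ (proj₂ rotated) v (cong just (sym eq))
      degree2 : ∀ {v} (c : Choice v) → choose v ≡ c → v ≢ x → v ≢ y → Degree2 (G ⋆ us) v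
      degree2 (inj₂ ¬ess-v) eq vx vy = ⊥-elim ([ vx , vy ]′ (ends ¬ess-v))
      degree2 {v} (inj₁ (ess-v , U , z , S)) eq vx vy = let (a , b , t) , Uv≢z , z≢𝐈 = star-triple S in
        a , b , b≢c t , rotated-centre us t (to𝐙 (sym (at-ζ eq))) Uv≢z
          (to𝐙 (on-ζ eq (a≢b t ∘ sym) (at₂ t))) (to𝐙 (on-ζ eq (a≢c t ∘ sym) (at₃ t)))

-- Vertices of degree 2

neighbours-swap : {H : Graph n} → ∀ {v p q} → Neighbours H v p q → Neighbours H v q p
neighbours-swap (vp , vq , none) = vq , vp , λ uq up → none up uq

neighbour-of : {H : Graph n} → ∀ {v p q u} → Neighbours H v p q → Adj H v u → u ≡ p ⊎ u ≡ q
neighbour-of {p = p} {q} {u} (_ , _ , none) vu with u ≟ p | u ≟ q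
... | yes eq | _ = inj₁ eq
... | no _ | yes eq = inj₂ eq
... | no up | no uq = ⊥-elim (true≢false (trans (sym vu) (none up uq)))

other-neighbour : {H : Graph n} → ∀ {v q} → Degree2 H v → Adj H v q → ∃[ p ] q ≢ p × Neighbours H v q p
other-neighbour {H = H} (a , b , a≢b , nb) vq = case neighbour-of {H = H} nb vq of λ where
  (inj₁ refl) → b , a≢b , nb
  (inj₂ refl) → a , a≢b ∘ sym , neighbours-swap {H = H} nb

-- One side of a split that separates the neighbours of `v`; the other side is the same module with
-- the cut flipped and `x`, `y` exchanged.
module BridgeSide {n : ℕ} (5≤n : 5 ≤ n) {H : Graph n} (prime : Prime H) {v x y : Fin n} (nb-v : Neighbours H v x y)
  (degree2 : ∀ {u} → u ≢ x → u ≢ y → Degree2 H u) (k : Cut H (_≡ v)) (kx : Cut.side k x ≡ true) (ky : Cut.side k y ≡ false) where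
  open PrimeGraph 5≤n {H} prime
  open PrimeCuts 5≤n {H} prime
  open PrimeRows 5≤n {H} prime
  open Cut k

  x≢v : x ≢ v
  x≢v = adj⇒≢ H (proj₁ nb-v) ∘ sym

  y≢v : y ≢ v
  y≢v = adj⇒≢ H (proj₁ (proj₂ nb-v)) ∘ sym

  to-v : ∀ {u} → u ≢ x → u ≢ y → adj H u v ≡ false
  to-v ux uy = trans (adj-sym H _ _) (proj₂ (proj₂ nb-v) ux uy)

  left≢y : ∀ {u} → side u ≡ true → u ≢ y
  left≢y su refl = true≢false (trans (sym su) ky)

  one-exit : (P : Fin n → Bool) → (∀ {u w} → P u ≡ true → P w ≡ false → u ≢ x → adj H u w ≡ false) →
    Two (λ u → P u ≡ false) → AtMostOne (λ u → P u ≡ true)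
  one-exit P none = on-line⇒small false 𝔹._≟_ (λ u → δ u x) P
    (λ {u} Pu Pw eq → none Pu Pw λ { refl → true≢false (trans (sym (δ-refl u)) eq) })
    (λ {u} {u'} Pu Pu' Pw eq → same Pu Pu' Pw (u ≟ x) (u' ≟ x) eq)
    λ _ _ → ≢false⇒≡
    where
    same : ∀ {u u' w} → P u ≡ true → P u' ≡ true → P w ≡ false → (d : Dec (u ≡ x)) (d' : Dec (u' ≡ x)) → does d ≡ does d' →
      adj H u w ≡ adj H u' w
    same Pu Pu' Pw (yes refl) (yes refl) _ = refl
    same Pu Pu' Pw (no ux) (no u'x) _ = trans (none Pu Pw ux) (sym (none Pu' Pw u'x))

  -- If only `x` had edges to the other side, the side would have cut-rank at most 1, although it
  -- has two vertices.
  crossing : ∃₂ λ p q → p ≢ x × p ≢ v × side p ≡ true × q ≢ v × side q ≡ false × Adj H p q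
  crossing with Fin.any? (λ p → Fin.any? λ q → ¬? (p ≟ x) ×-dec (¬? (p ≟ v) ×-dec ((side p 𝔹.≟ true) ×-dec
                  (¬? (q ≟ v) ×-dec ((side q 𝔹.≟ false) ×-dec (adj H p q 𝔹.≟ true))))))
  ... | yes found = found
  ... | no none = ⊥-elim (absurd left)
    where
    P : Fin n → Bool
    P u = not (δ u v) ∧ side u
    P-true : ∀ {u} → P u ≡ true → u ≢ v × side u ≡ true
    P-true {u} Pu = (λ { refl → true≢false (trans (sym (proj₁ (∧-true _ (side u) Pu))) (cong not (δ-refl u))) }) , proj₂ (∧-true _ (side u) Pu)
    P-intro : ∀ {u b} → u ≢ v → side u ≡ b → P u ≡ b
    P-intro {u} uv su = trans (cong (λ d → not d ∧ side u) (δ-≢ uv)) su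
    exit : ∀ {u w} → P u ≡ true → P w ≡ false → u ≢ x → adj H u w ≡ false
    exit {u} {w} Pu Pw ux = let uv , su = P-true Pu in value-at (adj H u) (to-v ux (left≢y su)) λ wv →
      𝔹.¬-not λ uw → none (u , w , ux , uv , su , wv , trans (sym (P-intro wv refl)) Pw , uw)
    absurd : Two (λ u → u ≢ v × side u ≡ true) → ⊥
    absurd (a , b , a≢b , (av , sa) , (bv , sb)) = a≢b (one-exit P exit
      (two-map (λ (uv , su) → P-intro uv su) right) a b (P-intro av sa) (P-intro bv sb))

  side≢ : ∀ {u w} → side u ≡ true → side w ≡ false → u ≢ w
  side≢ su sw refl = true≢false (trans (sym su) sw)

  α-true : ∀ {p q} → p ≢ v → q ≢ v → side p ≡ true → side q ≡ false → Adj H p q → α p ≡ true × β q ≡ true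
  α-true {p} {q} pv qv sp sq pq = ∧-true (α p) (β q) (trans (sym (rank1 pv qv sp sq)) pq)

  -- Without `p` the side can be left only through `x`, so nothing but `x` remains.
  two-left : ∀ {p} → p ≢ x → p ≢ v → side p ≡ true → (∀ {u} → side u ≡ true → adj H p u ≡ false) →
    (∀ {u} → u ≢ v → side u ≡ true → α u ≡ true → u ≢ p → u ≡ x) → ∀ {u} → u ≢ v → side u ≡ true → u ≡ x ⊎ u ≡ p
  two-left {p} px pv sp p-out only-x {u} uv su = case u ≟ p of λ where
      (yes eq) → inj₂ eq
      (no up) → inj₁ (one-exit P exit outside u x (P-intro uv up su) (P-intro x≢v (px ∘ sym) kx))
    where
    P : Fin n → Bool
    P u = not (δ u v) ∧ (not (δ u p) ∧ side u)
    P-intro : ∀ {u b} → u ≢ v → u ≢ p → side u ≡ b → P u ≡ b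
    P-intro {u} uv up su = trans (cong₂ (λ d e → not d ∧ (not e ∧ side u)) (δ-≢ uv) (δ-≢ up)) su
    P-true : ∀ {u} → P u ≡ true → u ≢ v × u ≢ p × side u ≡ true
    P-true {u} Pu with u ≟ v | u ≟ p
    ... | no uv | no up = uv , up , Pu
    outside : Two (λ u → P u ≡ false)
    outside = two-map (λ (uv , su) → P-intro uv (λ { refl → true≢false (trans (sym sp) su) }) su) right
    exit : ∀ {u w} → P u ≡ true → P w ≡ false → u ≢ x → adj H u w ≡ false
    exit {u} {w} Pu Pw ux = let uv , up , su = P-true Pu in
      value-at (adj H u) (to-v ux (left≢y su)) λ wv →
      value-at (adj H u) (trans (adj-sym H u p) (p-out su)) λ wp →
        trans (rank1 uv wv su (trans (sym (P-intro wv wp refl)) Pw))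
          (cong (_∧ β w) (𝔹.¬-not λ αu → ux (only-x uv su αu up)))

-- The edge `pq` crosses the cut and its ends have degree 2. According to the sides of their other
-- neighbours `p₁` and `q₁`, an end `x` or `y` has too few neighbours (`lone-x`, `lone-y`), or there
-- are twins or only five vertices (`five`), or `p` carries all crossing edges on its side and can
-- be moved across (`Shift`).
module BridgeEdge {n : ℕ} (6≤n : 6 ≤ n) {H : Graph n} (prime : Prime H) {v x y : Fin n} (nb-v : Neighbours H v x y)
  (degree2 : ∀ {u} → u ≢ x → u ≢ y → Degree2 H u) (k : Cut H (_≡ v)) (kx : Cut.side k x ≡ true) (ky : Cut.side k y ≡ false)
  {p q p₁ q₁ : Fin n} (px : p ≢ x) (pv : p ≢ v) (sp : Cut.side k p ≡ true) (qy : q ≢ y) (qv : q ≢ v) (sq : Cut.side k q ≡ false)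
  (αp : Cut.α k p ≡ true) (βq : Cut.β k q ≡ true)
  (q≢p₁ : q ≢ p₁) (nbp : Neighbours H p q p₁) (p≢q₁ : p ≢ q₁) (nbq : Neighbours H q p q₁) where

  private
    5≤n : 5 ≤ n
    5≤n = ℕ.≤-trans (ℕ.n≤1+n 5) 6≤n
  open PrimeRows 5≤n {H} prime
  open PrimeTriples 5≤n {H} prime
  open Cut k
  open BridgeSide 5≤n {H} prime nb-v degree2 k kx ky
  module R = BridgeSide 5≤n {H} prime {v} {y} {x} (neighbours-swap {H = H} nb-v)
    (λ uy ux → degree2 ux uy) (cut-flip k) (cong not ky) (cong not kx)

  joined : ∀ {u w} → u ≢ v → w ≢ v → side u ≡ true → side w ≡ false → α u ≡ true → β w ≡ true → Adj H u w
  joined uv wv su sw αu βw = trans (rank1 uv wv su sw) (cong₂ _∧_ αu βw)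
  pq : Adj H p q
  pq = joined pv qv sp sq αp βq
  py : p ≢ y
  py = left≢y sp
  qx : q ≢ x
  qx = R.left≢y (cong not sq)
  p₁v : p₁ ≢ v
  p₁v eq = true≢false (trans (sym (proj₁ (proj₂ nbp))) (trans (cong (adj H p) eq) (to-v px py)))
  q₁v : q₁ ≢ v
  q₁v eq = true≢false (trans (sym (proj₁ (proj₂ nbq))) (trans (cong (adj H q) eq) (to-v qx qy)))
  α-only : ∀ {u} → u ≢ v → side u ≡ true → α u ≡ true → u ≡ p ⊎ u ≡ q₁
  α-only uv su αu = neighbour-of {H = H} nbq (trans (adj-sym H q _) (joined uv qv su sq αu βq))
  β-only : ∀ {w} → w ≢ v → side w ≡ false → β w ≡ true → w ≡ q ⊎ w ≡ p₁
  β-only wv sw βw = neighbour-of {H = H} nbp (joined pv wv sp sw αp βw)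
  p-out : side p₁ ≡ false → ∀ {u} → side u ≡ true → adj H p u ≡ false
  p-out sp₁ su = proj₂ (proj₂ nbp) (side≢ su sq) (side≢ su sp₁)
  q-out : side q₁ ≡ true → ∀ {u} → not (side u) ≡ true → adj H q u ≡ false
  q-out sq₁ su = proj₂ (proj₂ nbq) (λ { refl → true≢false (trans (sym su) (cong not sp)) }) (λ { refl → true≢false (trans (sym su) (cong not sq₁)) })
  lone-x : side p₁ ≡ false → side q₁ ≡ false → ⊥
  lone-x sp₁ sq₁ = neighbours>1 x≢v none
    where
    only : ∀ {u} → u ≢ v → side u ≡ true → u ≡ x ⊎ u ≡ p
    only = two-left px pv sp (p-out sp₁) λ uv su αu up → [ (λ eq → ⊥-elim (up eq)) , (λ eq → ⊥-elim (side≢ su sq₁ eq)) ]′ (α-only uv su αu)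
    none : ∀ {u} → u ≢ x → u ≢ v → adj H x u ≡ false
    none {u} ux uv = case side u 𝔹.≟ true of λ where
      (yes su) → [ (λ eq → ⊥-elim (ux eq)) , (λ eq → trans (cong (adj H x) eq) (trans (adj-sym H x p) (p-out sp₁ kx))) ]′ (only uv su)
      (no su) → trans (rank1 x≢v uv kx (𝔹.¬-not su)) (cong (_∧ β u) (𝔹.¬-not λ αx →
        [ px ∘ sym , side≢ kx sq₁ ]′ (α-only x≢v kx αx)))
  lone-y : side p₁ ≡ true → side q₁ ≡ true → ⊥
  lone-y sp₁ sq₁ = neighbours>1 y≢v none
    where
    only : ∀ {u} → u ≢ v → not (side u) ≡ true → u ≡ y ⊎ u ≡ q
    only = R.two-left qy qv (cong not sq) (q-out sq₁) λ uv su βu uq →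
      [ (λ eq → ⊥-elim (uq eq)) , (λ eq → ⊥-elim (side≢ sp₁ (𝔹.not-injective su) (sym eq))) ]′ (β-only uv (𝔹.not-injective su) βu)
    none : ∀ {u} → u ≢ y → u ≢ v → adj H y u ≡ false
    none {u} uy uv = case side u 𝔹.≟ true of λ where
      (no su) → [ (λ eq → ⊥-elim (uy eq)) , (λ eq → trans (cong (adj H y) eq) (trans (adj-sym H y q) (q-out sq₁ (cong not ky)))) ]′ (only uv (cong not (𝔹.¬-not su)))
      (yes su) → trans (adj-sym H y u) (trans (rank1 uv y≢v su ky) (trans (cong (α u ∧_) (𝔹.¬-not λ βy →
        [ qy ∘ sym , (λ eq → side≢ sp₁ ky (sym eq)) ]′ (β-only y≢v ky βy))) (𝔹.∧-zeroʳ (α u))))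
  αq₁ : side q₁ ≡ true → α q₁ ≡ true
  αq₁ sq₁ = proj₁ (α-true q₁v qv sq₁ sq (trans (adj-sym H q₁ q) (proj₁ (proj₂ nbq))))
  βp₁ : side p₁ ≡ false → β p₁ ≡ true
  βp₁ sp₁ = proj₂ (α-true pv p₁v sp sp₁ (proj₁ (proj₂ nbp)))
  same-neighbours : ∀ {a b c d} → a ≢ b → Neighbours H a c d → Degree2 H b → Adj H b c → Adj H b d → c ≢ d → ⊥
  same-neighbours {a} {b} {c} {d} a≢b (ac , ad , none) deg bc bd c≢d with other-neighbour {H = H} deg bc
  ... | r , c≢r , nb with neighbour-of {H = H} nb bd
  ...   | inj₁ d≡c = c≢d (sym d≡c)
  ...   | inj₂ refl = no-twins a≢b λ {u} _ _ → by-cases {P = λ u → adj H a u ≡ adj H b u} (trans ac (sym bc)) λ uc →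
            by-cases {P = λ u → adj H a u ≡ adj H b u} (trans ad (sym bd)) λ ud → trans (none uc ud) (sym (proj₂ (proj₂ nb) uc ud))
  five : side p₁ ≡ false → side q₁ ≡ true → ⊥
  five sp₁ sq₁ with q₁ ≟ x | p₁ ≟ y
  ... | no q₁x | _ = same-neighbours p≢q₁ nbp (degree2 q₁x (left≢y sq₁)) (trans (adj-sym H q₁ q) (proj₁ (proj₂ nbq)))
          (joined q₁v p₁v sq₁ sp₁ (αq₁ sq₁) (βp₁ sp₁)) q≢p₁
  ... | yes _ | no p₁y = same-neighbours q≢p₁ nbq (degree2 (R.left≢y (cong not sp₁)) p₁y) (trans (adj-sym H p₁ p) (proj₁ (proj₂ nbp)))
          (trans (adj-sym H p₁ q₁) (joined q₁v p₁v sq₁ sp₁ (αq₁ sq₁) (βp₁ sp₁))) p≢q₁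
  ... | yes q₁≡x | yes p₁≡y = let u , u∉ = fresh (v ∷ x ∷ p ∷ y ∷ q ∷ []) 6≤n
                                  uv : u ≢ v
                                  uv = u∉ ∘ here
                              in case side u 𝔹.≟ true of λ where
        (yes su) → [ u∉ ∘ there ∘ here , u∉ ∘ there ∘ there ∘ here ]′ (two-left px pv sp (p-out sp₁)
          (λ wv sw αw wp → [ (λ eq → ⊥-elim (wp eq)) , (λ eq → trans eq q₁≡x) ]′ (α-only wv sw αw)) uv su)
        (no su) → [ u∉ ∘ there ∘ there ∘ there ∘ here , u∉ ∘ there ∘ there ∘ there ∘ there ∘ here ]′ (R.two-left qy qv (cong not sq) (q-out sq₁)
          (λ wv sw βw wq → [ (λ eq → ⊥-elim (wq eq)) , (λ eq → trans eq p₁≡y) ]′ (β-only wv (𝔹.not-injective sw) βw)) uv (cong not (𝔹.¬-not su)))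
  module Shift (sp₁ : side p₁ ≡ true) (sq₁ : side q₁ ≡ false) where
    α-p : ∀ {u} → u ≢ v → side u ≡ true → u ≢ p → α u ≡ false
    α-p uv su up = 𝔹.¬-not λ αu → [ up , side≢ su sq₁ ]′ (α-only uv su αu)
    side′ : Fin n → Bool
    side′ u = not (δ u p) ∧ side u
    keep : ∀ {u b} → u ≢ p → side u ≡ b → side′ u ≡ b
    keep {u} up su = trans (cong (λ d → not d ∧ side u) (δ-≢ up)) su
    side′-true : ∀ {u} → side′ u ≡ true → u ≢ p × side u ≡ true
    side′-true {u} s′ with u ≟ p
    ... | no up = up , s′
    rk : ∀ {a b} → a ≢ v → b ≢ v → side′ a ≡ true → side′ b ≡ false → adj H a b ≡ δ a p₁ ∧ δ b p
    rk {a} {b} av bv sa sb with side′-true sa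
    ... | ap , sa with b ≟ p
    ...   | yes refl = trans (adj-sym H a p) (trans (row (a ≟ p₁)) (sym (𝔹.∧-identityʳ _)))
      where
      row : (d : Dec (a ≡ p₁)) → adj H p a ≡ does d
      row (yes refl) = proj₁ (proj₂ nbp)
      row (no ap₁) = proj₂ (proj₂ nbp) (side≢ sa sq) ap₁
    ...   | no bp = trans (rank1 av bv sa sb) (trans (cong (_∧ β b) (α-p av sa ap)) (sym (𝔹.∧-zeroʳ (δ a p₁))))
    left′ : Two (λ w → w ≢ x × w ≢ v × side w ≡ true) → Two (λ w → w ≢ v × side′ w ≡ true)
    left′ (a , b , a≢b , (ax , av , sa) , (bx , bv , sb)) = case a ≟ p of λ where
      (no ap) → x , a , ax ∘ sym , (x≢v , keep (px ∘ sym) kx) , (av , keep ap sa)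
      (yes refl) → x , b , bx ∘ sym , (x≢v , keep (px ∘ sym) kx) , (bv , keep (a≢b ∘ sym) sb)
    moved : Two (λ w → w ≢ x × w ≢ v × side w ≡ true) → Cut H (_≡ v)
    moved two = cut side′ (left′ two) (two-map (λ (uv , su) → uv , keep (λ { refl → side≢ sp su refl }) su) right)
      (λ a → δ a p₁) (λ b → δ b p) rk

  Smaller : Cut H (_≡ v) → Set
  Smaller k' = Cut.side k' x ≡ true × Cut.side k' y ≡ false × (∀ {u} → Cut.side k' u ≡ true → u ≢ p × side u ≡ true)

  end-degree2 : ((k' : Cut H (_≡ v)) → Smaller k' → Degree2 H x) → Degree2 H x
  end-degree2 smaller = result (side p₁) (side q₁) refl refl
    where
    result : ∀ b b' → side p₁ ≡ b → side q₁ ≡ b' → Degree2 H x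
    result false false sp₁ sq₁ = ⊥-elim (lone-x sp₁ sq₁)
    result true true sp₁ sq₁ = ⊥-elim (lone-y sp₁ sq₁)
    result false true sp₁ sq₁ = ⊥-elim (five sp₁ sq₁)
    result true false sp₁ sq₁ with two-or-three (λ u → ¬? (u ≟ v) ×-dec (side u 𝔹.≟ true)) left (x≢v , kx)
    ... | inj₂ two = smaller (moved two) (keep (px ∘ sym) kx , keep (py ∘ sym) ky , side′-true)
      where open Shift sp₁ sq₁
    ... | inj₁ (a , a≢x , _ , only) = v , p , pv ∘ sym , trans (adj-sym H x v) (proj₁ nb-v) , trans (adj-sym H x p) px′ , none
      where
      open Shift sp₁ sq₁
      within : ∀ {u} → u ≢ v → side u ≡ true → u ≡ x ⊎ u ≡ p
      within uv su with only (uv , su) | only (pv , sp)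
      ... | inj₁ eq | _ = inj₁ eq
      ... | inj₂ _ | inj₁ eq = ⊥-elim (px eq)
      ... | inj₂ eq | inj₂ eq' = inj₂ (trans eq (sym eq'))
      px′ : Adj H p x
      px′ = [ (λ eq → subst (Adj H p) eq (proj₁ (proj₂ nbp))) , (λ eq → ⊥-elim (adj⇒≢ H (proj₁ (proj₂ nbp)) (sym eq))) ]′ (within p₁v sp₁)
      none : ∀ {u} → u ≢ v → u ≢ p → adj H x u ≡ false
      none {u} uv up = case side u 𝔹.≟ true of λ where
        (yes su) → [ (λ eq → trans (cong (adj H x) eq) (adj-irr H x)) , (λ eq → ⊥-elim (up eq)) ]′ (within uv su)
        (no su) → trans (rank1 x≢v uv kx (𝔹.¬-not su)) (cong (_∧ β u) (α-p x≢v kx (px ∘ sym)))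

module _ {n : ℕ} (6≤n : 6 ≤ n) {H : Graph n} (prime : Prime H) where

  private
    5≤n : 5 ≤ n
    5≤n = ℕ.≤-trans (ℕ.n≤1+n 5) 6≤n
  open PrimeRows 5≤n {H} prime
  open PrimeTriples 5≤n {H} prime

  -- The bridge of the split is moved along the path of vertices of degree 2 until it reaches x.
  bridge-end : ∀ m {v x y} → Neighbours H v x y → (∀ {u} → u ≢ x → u ≢ y → Degree2 H u) →
    (k : Cut H (_≡ v)) → Cut.side k x ≡ true → Cut.side k y ≡ false →
    (xs : List (Fin n)) → length xs ≤ m → (∀ {u} → u ≢ v → Cut.side k u ≡ true → u ∈ xs) → Degree2 H x
  bridge-end zero nb-v degree2 k kx ky [] len cover = case cover (λ eq → adj⇒≢ H (proj₁ nb-v) (sym eq)) kx of λ ()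
  bridge-end (suc m) {v} {x} {y} nb-v degree2 k kx ky xs len cover = edge Left.crossing Right.crossing
    where
    module Left = BridgeSide 5≤n {H} prime nb-v degree2 k kx ky
    module Right = BridgeSide 5≤n {H} prime {v} {y} {x} (neighbours-swap {H = H} nb-v)
      (λ uy ux → degree2 ux uy) (cut-flip k) (cong not ky) (cong not kx)
    edge : _ → _ → Degree2 H x
    edge (p , q′ , px , pv , sp , q′v , sq′ , pq′) (q , p′ , qy , qv , sq , p′v , sp′ , qp′) =
        by-neighbours (other-neighbour {H = H} (degree2 px (Left.left≢y sp)) pq)
          (other-neighbour {H = H} (degree2 (Right.left≢y sq) qy) (trans (adj-sym H q p) pq))
      where
      αp : Cut.α k p ≡ true
      αp = proj₁ (Left.α-true pv q′v sp sq′ pq′)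
      βq : Cut.β k q ≡ true
      βq = proj₁ (Right.α-true qv p′v sq sp′ qp′)
      pq : Adj H p q
      pq = trans (Cut.rank1 k pv qv sp (𝔹.not-injective sq)) (cong₂ _∧_ αp βq)
      xs′ = filter (λ u → ¬? (u ≟ p)) xs
      shorter : suc (length xs′) ≤ suc m
      shorter = ℕ.≤-trans (filter-notAll (λ u → ¬? (u ≟ p)) xs (Any.map (λ p≡u u≢p → u≢p (sym p≡u)) (cover pv sp))) len
      by-neighbours : ∃[ p₁ ] q ≢ p₁ × Neighbours H p q p₁ → ∃[ q₁ ] p ≢ q₁ × Neighbours H q p q₁ → Degree2 H x
      by-neighbours (p₁ , q≢p₁ , nbp) (q₁ , p≢q₁ , nbq) =
        BridgeEdge.end-degree2 6≤n {H} prime nb-v degree2 k kx ky px pv sp qy qv (𝔹.not-injective sq) αp βq q≢p₁ nbp p≢q₁ nbq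
          λ k' (k'x , k'y , smaller) → bridge-end m nb-v degree2 k' k'x k'y xs′ (ℕ.≤-pred shorter)
            λ uv su → let up , su′ = smaller su in ∈-filter⁺ (λ u → ¬? (u ≟ p)) (cover uv su′) up

  bridge⇒cycle : ∀ {v x y} → Neighbours H v x y → (∀ {u} → u ≢ x → u ≢ y → Degree2 H u) → Cut H (_≡ v) → ∀ u → Degree2 H u
  bridge⇒cycle {v} {x} {y} nb-v@(vx , vy , none) degree2 k u = case u ≟ x of λ where
      (yes refl) → at-end nb-v degree2 (orient x y together k)
      (no ux) → case u ≟ y of λ where
        (yes refl) → at-end (neighbours-swap {H = H} nb-v) (λ uy ux → degree2 ux uy) (orient y x (λ k ky kx → together k kx ky) k)
        (no uy) → degree2 ux uy
    where
    together : (k : Cut H (_≡ v)) → Cut.side k x ≡ true → Cut.side k y ≡ true → ⊥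
    together k kx ky = absorb-row k false λ wv sw →
      none (λ { refl → true≢false (trans (sym kx) sw) }) (λ { refl → true≢false (trans (sym ky) sw) })
    at-end : ∀ {x y} → Neighbours H v x y → (∀ {u} → u ≢ x → u ≢ y → Degree2 H u) →
      (Σ (Cut H (_≡ v)) λ k → Cut.side k x ≡ true × Cut.side k y ≡ false) → Degree2 H x
    at-end nb degree2 (k , kx , ky) = bridge-end _ nb degree2 k kx ky (allFin n) ℕ.≤-refl λ {u} _ _ → ∈-allFin u

-- The neighbours of `v` are `x` and `y`, so complementation at `v` toggles only the edge between
-- them and the degrees of the other vertices survive. Either split therefore makes all degrees 2,
-- and any edge can supply new ends.
common-neighbour⇒theta : 6 ≤ n → {H : Graph n} → Prime H → ∀ {x y} → x ≢ y → (∀ {u} → u ≢ x → u ≢ y → Degree2 H u) →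
  ∀ {v} → Adj H x v → Adj H y v → Cut H (_≡ v) ⊎ Cut (H * v) (_≡ v) → HasTheta H
common-neighbour⇒theta {n} 6≤n {H} prime {x} {y} x≢y degree2 {v} xv yv split = cases split
  where
  5≤n = ℕ.≤-trans (ℕ.n≤1+n 5) 6≤n
  vx : Adj H v x
  vx = trans (adj-sym H v x) xv
  nb-v : Neighbours H v x y
  nb-v with other-neighbour {H = H} (degree2 (adj⇒≢ H xv ∘ sym) (adj⇒≢ H yv ∘ sym)) vx
  ... | r , x≢r , nb with neighbour-of {H = H} nb (trans (adj-sym H v y) yv)
  ...   | inj₁ y≡x = ⊥-elim (x≢y (sym y≡x))
  ...   | inj₂ refl = nb
  row : ∀ {u w} → u ≢ x → u ≢ y → adj (H * v) u w ≡ adj H u w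
  row {u} {w} ux uy = case u ≟ w of λ where
    (yes refl) → trans (adj-irr (H * v) u) (sym (adj-irr H u))
    (no u≢w) → trans (lcAdj-≢ H v u≢w) (trans (cong (λ b → adj H u w xor (b ∧ adj H v w)) (proj₂ (proj₂ nb-v) ux uy)) (𝔹.xor-identityʳ _))
  move : ∀ {u a b} → u ≢ x → u ≢ y → Neighbours H u a b → Neighbours (H * v) u a b
  move ux uy (ua , ub , none) = trans (row ux uy) ua , trans (row ux uy) ub , λ wa wb → trans (row ux uy) (none wa wb)
  cases : Cut H (_≡ v) ⊎ Cut (H * v) (_≡ v) → HasTheta H
  cases (inj₁ k) = [] , PrimeTriples.cycle⇒theta 5≤n {H} prime (bridge⇒cycle 6≤n {H} prime nb-v degree2 k)
  cases (inj₂ k) = v ∷ [] , PrimeTriples.cycle⇒theta 5≤n {H * v} (prime-lc {G = H} v prime)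
    (bridge⇒cycle 6≤n {H * v} (prime-lc {G = H} v prime) (move (adj⇒≢ H xv ∘ sym) (adj⇒≢ H yv ∘ sym) nb-v)
      (λ ux uy → let a , b , a≢b , nb = degree2 ux uy in a , b , a≢b , move ux uy nb) k)

-- Paths

lookup-injective : {l : List A} → Unique l → ∀ i j → lookup l i ≡ lookup l j → i ≡ j
lookup-injective (_ ∷ _) zero zero _ = refl
lookup-injective (x∉ ∷ _) zero (suc j) eq = ⊥-elim (All.lookup x∉ (∈-lookup j) eq)
lookup-injective (x∉ ∷ _) (suc i) zero eq = ⊥-elim (All.lookup x∉ (∈-lookup i) (sym eq))
lookup-injective (_ ∷ unique) (suc i) (suc j) eq = cong suc (lookup-injective unique i j eq)

module ThetaPaths {n : ℕ} (5≤n : 5 ≤ n) {H : Graph n} (prime : Prime H) {x y : Fin n} (theta : Theta H x y) where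
  open PrimeCuts 5≤n {H} prime
  open PrimeRows 5≤n {H} prime
  open PrimeTriples 5≤n {H} prime

  x≢y : x ≢ y
  x≢y = proj₁ theta

  degree2 : ∀ {v} → v ≢ x → v ≢ y → Degree2 H v
  degree2 = proj₁ (proj₂ theta)

  symm : ∀ {u v} → Adj H u v → Adj H v u
  symm {u} {v} uv = trans (adj-sym H v u) uv

  -- Chain a w l: the list l starts at w, follows vertices of degree 2 away from a, and stops just before y.
  data Chain (a w : Fin n) : List (Fin n) → Set where
    end  : w ≢ x → w ≢ y → Neighbours H w a y → Chain a w (w ∷ [])
    step : ∀ {b l} → w ≢ x → w ≢ y → Neighbours H w a b → Chain w b l → Chain a w (w ∷ l)

  chain-∉ : ∀ {a w l u} → Chain a w l → u ∈ l → u ≢ x × u ≢ y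
  chain-∉ (end wx wy _) (here refl) = wx , wy
  chain-∉ (step wx wy _ _) (here refl) = wx , wy
  chain-∉ (step _ _ _ c) (there u∈) = chain-∉ c u∈

  chain-head : ∀ {a w l} → Chain a w l → w ∈ l
  chain-head (end _ _ _) = here refl
  chain-head (step _ _ _ _) = here refl

  chain-linked : ∀ {a w l} → Chain a w l → Linked (Adj H) (a ∷ l ++ y ∷ [])
  chain-linked (end _ _ (wa , wy , _)) = symm wa ∷ wy ∷ [-]
  chain-linked (step _ _ (wa , wb , _) c@(end _ _ _)) = symm wa ∷ chain-linked c
  chain-linked (step _ _ (wa , wb , _) c@(step _ _ _ _)) = symm wa ∷ chain-linked c

  chain-consecutive : ∀ {a w l u z} → Chain a w l → u ∈ l → Adj H u z →
    Consecutive u z (a ∷ l ++ y ∷ []) ⊎ Consecutive z u (a ∷ l ++ y ∷ [])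
  chain-consecutive (end _ _ nb) (here refl) uz with neighbour-of {H = H} nb uz
  ... | inj₁ refl = inj₂ ([] , _ , refl)
  ... | inj₂ refl = inj₁ (_ ∷ [] , _ , refl)
  chain-consecutive (step _ _ nb c) (here refl) uz with neighbour-of {H = H} nb uz | c
  ... | inj₁ refl | _ = inj₂ ([] , _ , refl)
  ... | inj₂ refl | end _ _ _ = inj₁ (_ ∷ [] , _ , refl)
  ... | inj₂ refl | step _ _ _ _ = inj₁ (_ ∷ [] , _ , refl)
  chain-consecutive {a} (step _ _ _ c) (there u∈) uz with chain-consecutive c u∈ uz
  ... | inj₁ (as , bs , eq) = inj₁ (a ∷ as , bs , cong (a ∷_) eq)
  ... | inj₂ (as , bs , eq) = inj₂ (a ∷ as , bs , cong (a ∷_) eq)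

  chain-closed : ∀ {a w l u z} → Chain a w l → u ∈ l → Adj H u z → z ∈ l ⊎ z ≡ a ⊎ z ≡ y
  chain-closed (end _ _ nb) (here refl) uz = inj₂ (neighbour-of {H = H} nb uz)
  chain-closed (step _ _ nb c) (here refl) uz with neighbour-of {H = H} nb uz
  ... | inj₁ z≡a = inj₂ (inj₁ z≡a)
  ... | inj₂ refl = inj₁ (there (chain-head c))
  chain-closed (step _ _ _ c) (there u∈) uz with chain-closed c u∈ uz
  ... | inj₁ z∈ = inj₁ (there z∈)
  ... | inj₂ (inj₁ refl) = inj₁ (here refl)
  ... | inj₂ (inj₂ z≡y) = inj₂ (inj₂ z≡y)

  chain-avoids-x : ∀ {a w l u} → a ≢ x → Chain a w l → u ∈ l → ¬ Adj H u x
  chain-avoids-x ax (end _ _ nb) (here refl) ux = [ ax ∘ sym , x≢y ]′ (neighbour-of {H = H} nb ux)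
  chain-avoids-x ax (step _ _ nb c) (here refl) ux =
    [ ax ∘ sym , (λ eq → proj₁ (chain-∉ c (chain-head c)) (sym eq)) ]′ (neighbour-of {H = H} nb ux)
  chain-avoids-x ax (step wx _ _ c) (there u∈) ux = chain-avoids-x wx c u∈ ux

  chain-start : ∀ {w l u} → Chain x w l → u ∈ l → Adj H u x → u ≡ w
  chain-start (end _ _ _) (here eq) _ = eq
  chain-start (step _ _ _ _) (here eq) _ = eq
  chain-start (step wx _ _ c) (there u∈) ux = ⊥-elim (chain-avoids-x wx c u∈ ux)

  -- Walking back along one chain from a common vertex never leaves the other: that one can be left
  -- only through `x` and `y`, which are on no chain.
  chain-back : ∀ {a w l u w' l'} → Chain x w' l' → Chain a w l → u ∈ l → u ∈ l' → w ∈ l'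
  chain-back c' (end _ _ _) (here refl) u∈' = u∈'
  chain-back c' (step _ _ _ _) (here refl) u∈' = u∈'
  chain-back c' (step wx wy (_ , wb , _) c) (there u∈) u∈' with chain-closed c' (chain-back c' c u∈ u∈') (symm wb)
  ... | inj₁ w∈ = w∈
  ... | inj₂ (inj₁ w≡x) = ⊥-elim (wx w≡x)
  ... | inj₂ (inj₂ w≡y) = ⊥-elim (wy w≡y)

  chains-disjoint : ∀ {w w' l l' u} → Adj H x w → Chain x w l → Chain x w' l' → u ∈ l → u ∈ l' → w ≡ w'
  chains-disjoint xw c c' u∈ u∈' = chain-start c' (chain-back c' c u∈ u∈') (symm xw)

  -- If the chain returned to x, its vertices would be attached to the rest through x alone.
  trace : ∀ m {a w} (visited left : List (Fin n)) → length left ≤ m → (∀ {u} → u ∉ visited → u ∈ left) →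
    w ∉ visited → w ≢ x → w ≢ y → Adj H w a → a ∈ visited ⊎ a ≡ x × visited ≡ [] → (∀ {e} → e ∈ visited → e ≢ x × e ≢ y) →
    (∀ {e z} → e ∈ visited → Adj H e z → z ∈ visited ⊎ z ≡ w ⊎ z ≡ x) → (∀ {e} → e ∈ visited → Adj H e w → e ≡ a) →
    ∃[ l ] Chain a w l × Unique l × (∀ {u} → u ∈ l → u ∉ visited)
  trace zero visited [] _ cover w∉ _ _ _ _ _ _ _ = case cover w∉ of λ ()
  trace (suc m) {a} {w} visited left len cover w∉ wx wy wa prev interior closed entry
    with other-neighbour {H = H} (degree2 wx wy) wa
  ... | b , a≢b , nb = next (b ≟ y) (b ≟ x)
    where
    wb : Adj H w b
    wb = proj₁ (proj₂ nb)
    a-known : ∀ {z} → z ≡ a → z ∈ w ∷ visited ⊎ z ≡ b ⊎ z ≡ x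
    a-known refl = [ inj₁ ∘ there , (λ (a≡x , _) → inj₂ (inj₂ a≡x)) ]′ prev
    loop : b ≡ x → ⊥
    loop refl = case prev of λ where
        (inj₂ (a≡x , _)) → a≢b a≡x
        (inj₁ a∈) → list-cut (w ∷ visited) (λ u → δ u x) (λ e∈ → rows e∈ (adj H _ x) refl) (here refl) (there a∈) (adj⇒≢ H wa)
                      (x , y , x≢y , outside (λ eq → wx (sym eq)) (λ e∈ → proj₁ (interior e∈)) , outside (λ eq → wy (sym eq)) (λ e∈ → proj₂ (interior e∈)))
      where
      outside : ∀ {u} → u ≢ w → (∀ {e} → e ∈ visited → e ≢ u) → u ∉ w ∷ visited
      outside u≢w _ (here eq) = u≢w eq
      outside _ u∉ (there u∈) = u∉ u∈ refl
      exits : ∀ {e z} → e ∈ w ∷ visited → z ∉ w ∷ visited → Adj H e z → z ≡ x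
      exits (here refl) z∉ ez = [ (λ z≡a → case a-known z≡a of λ { (inj₁ z∈) → ⊥-elim (z∉ z∈) ; (inj₂ (inj₁ eq)) → eq ; (inj₂ (inj₂ eq)) → eq })
                                , id ]′ (neighbour-of {H = H} nb ez)
      exits (there e∈) z∉ ez with closed e∈ ez
      ... | inj₁ z∈ = ⊥-elim (z∉ (there z∈))
      ... | inj₂ (inj₁ z≡w) = ⊥-elim (z∉ (here z≡w))
      ... | inj₂ (inj₂ z≡x) = z≡x
      rows : ∀ {e} → e ∈ w ∷ visited → ∀ r → adj H e x ≡ r →
        (∀ {z} → z ∉ w ∷ visited → adj H e z ≡ false) ⊎ (∀ {z} → z ∉ w ∷ visited → adj H e z ≡ δ z x)
      rows e∈ false ex = inj₁ λ z∉ → 𝔹.¬-not λ ez → true≢false (trans (sym ez) (trans (cong (adj H _) (exits e∈ z∉ ez)) ex))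
      rows {e} e∈ true ex = inj₂ λ {z} z∉ → row z∉ (z ≟ x)
        where
        row : ∀ {z} → z ∉ w ∷ visited → (d : Dec (z ≡ x)) → adj H e z ≡ does d
        row z∉ (yes refl) = ex
        row z∉ (no z≢x) = 𝔹.¬-not λ ez → z≢x (exits e∈ z∉ ez)
    next : Dec (b ≡ y) → Dec (b ≡ x) → ∃[ l ] Chain a w l × Unique l × (∀ {u} → u ∈ l → u ∉ visited)
    next (yes refl) _ = w ∷ [] , end wx wy nb , [] ∷ [] , λ { (here refl) → w∉ }
    next (no _) (yes b≡x) = ⊥-elim (loop b≡x)
    next (no b≢y) (no b≢x) = let l , c , unique , fresh-l = rest in
        w ∷ l , step wx wy nb c , All.tabulate (λ u∈ w≡u → fresh-l u∈ (here (sym w≡u))) ∷ unique ,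
        λ { (here refl) → w∉ ; (there u∈) → fresh-l u∈ ∘ there }
      where
      left′ = filter (λ u → ¬? (u ≟ w)) left
      shorter : suc (length left′) ≤ suc m
      shorter = ℕ.≤-trans (filter-notAll (λ u → ¬? (u ≟ w)) left (Any.map (λ w≡u u≢w → u≢w (sym w≡u)) (cover w∉))) len
      closed′ : ∀ {e z} → e ∈ w ∷ visited → Adj H e z → z ∈ w ∷ visited ⊎ z ≡ b ⊎ z ≡ x
      closed′ (here refl) ez = [ a-known , (λ z≡b → inj₂ (inj₁ z≡b)) ]′ (neighbour-of {H = H} nb ez)
      closed′ (there e∈) ez with closed e∈ ez
      ... | inj₁ z∈ = inj₁ (there z∈)
      ... | inj₂ (inj₁ z≡w) = inj₁ (here z≡w)
      ... | inj₂ (inj₂ z≡x) = inj₂ (inj₂ z≡x)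
      entry′ : ∀ {e} → e ∈ w ∷ visited → Adj H e b → e ≡ w
      entry′ (here eq) _ = eq
      entry′ (there e∈) eb with closed e∈ eb
      ... | inj₁ b∈ = ⊥-elim (a≢b (sym (entry b∈ (symm wb))))
      ... | inj₂ (inj₁ b≡w) = ⊥-elim (adj⇒≢ H wb (sym b≡w))
      ... | inj₂ (inj₂ b≡x) = ⊥-elim (b≢x b≡x)
      rest = trace m {w} {b} (w ∷ visited) left′ (ℕ.≤-pred shorter)
        (λ u∉ → ∈-filter⁺ (λ u → ¬? (u ≟ w)) (cover (u∉ ∘ there)) (u∉ ∘ here))
        (λ { (here b≡w) → adj⇒≢ H wb (sym b≡w) ; (there b∈) → a≢b (sym (entry b∈ (symm wb))) })
        b≢x b≢y (symm wb) (inj₁ (here refl)) (λ { (here refl) → wx , wy ; (there e∈) → interior e∈ }) closed′ entry′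

  -- The first alternative is the edge from `x` to `y`, a path without inner vertices.
  Path : Fin n → List (Fin n) → Set
  Path w l = (w ≡ y × l ≡ []) ⊎ (w ≢ y × Chain x w l × Unique l)

  path : ∀ {w} → Adj H x w → ∃[ l ] Path w l
  path {w} xw = by-end (w ≟ y)
    where
    by-end : Dec (w ≡ y) → ∃[ l ] Path w l
    by-end (yes eq) = [] , inj₁ (eq , refl)
    by-end (no w≢y) with trace (length (allFin n)) [] (allFin n) ℕ.≤-refl (λ _ → ∈-allFin _) (λ ()) (adj⇒≢ H xw ∘ sym) w≢y
                           (symm xw) (inj₂ (refl , refl)) (λ ()) (λ ()) (λ ())
    ... | l , c , unique , _ = l , inj₂ (w≢y , c , unique)

  starts : List (Fin n)
  starts = filter (λ w → adj H x w 𝔹.≟ true) (allFin n)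

  start∈ : ∀ {w} → Adj H x w → w ∈ starts
  start∈ xw = ∈-filter⁺ (λ w → adj H x w 𝔹.≟ true) (∈-allFin _) xw

  k : ℕ
  k = length starts

  start : Fin k → Fin n
  start = lookup starts

  x-start : ∀ i → Adj H x (start i)
  x-start i = proj₂ (∈-filter⁻ (λ w → adj H x w 𝔹.≟ true) {xs = allFin n} (∈-lookup {xs = starts} i))

  start-injective : ∀ {i j} → start i ≡ start j → i ≡ j
  start-injective {i} {j} = lookup-injective (filter⁺ (λ w → adj H x w 𝔹.≟ true) (allFin⁺ n)) i j

  at-start : ∀ {w} → Adj H x w → ∃[ i ] w ≡ start i
  at-start xw = index (start∈ xw) , lookup-index (start∈ xw)

  mid : Fin k → List (Fin n)
  mid i = proj₁ (path (x-start i))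

  mid-path : ∀ i → Path (start i) (mid i)
  mid-path i = proj₂ (path (x-start i))

  2≤k : 2 ≤ k
  2≤k = at-least-two starts start∈
    where
    at-least-two : (l : List (Fin n)) → (∀ {w} → Adj H x w → w ∈ l) → 2 ≤ length l
    at-least-two [] all = case all (proj₂ (neighbour x)) of λ ()
    at-least-two (w ∷ []) all = ⊥-elim (case x ≟ w of λ where
      (yes refl) → case all (proj₂ (neighbour x)) of λ { (here eq) → adj⇒≢ H (proj₂ (neighbour x)) (sym eq) }
      (no x≢w) → neighbours>1 x≢w λ ux uw → 𝔹.¬-not λ xu → case all xu of λ { (here eq) → uw eq })
    at-least-two (_ ∷ _ ∷ _) _ = s≤s (s≤s z≤n)

  interior : ∀ {u} i → u ∈ mid i → u ≢ x × u ≢ y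
  interior i u∈ with mid-path i
  ... | inj₁ (_ , eq) = case subst (_ ∈_) eq u∈ of λ ()
  ... | inj₂ (_ , c , _) = chain-∉ c u∈

  is-path : ∀ i → IsPath H (pathSeq x y (mid i))
  is-path i with mid i | mid-path i
  ... | _ | inj₁ (eq , refl) = (x≢y ∷ []) ∷ [] ∷ [] , subst (Adj H x) eq (x-start i) ∷ [-]
  ... | l | inj₂ (_ , c , unique) = All.tabulate x∉ ∷ ++⁺ unique ([] ∷ []) (λ { (u∈ , here refl) → proj₂ (chain-∉ c u∈) refl }) , chain-linked c
    where
    x∉ : ∀ {u} → u ∈ l ++ y ∷ [] → x ≢ u
    x∉ u∈ refl with ∈-++⁻ l u∈
    ... | inj₁ x∈ = proj₁ (chain-∉ c x∈) refl
    ... | inj₂ (here eq) = x≢y eq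

  mids-meet : ∀ {i j u} → u ∈ mid i → u ∈ mid j → i ≡ j
  mids-meet {i} {j} u∈ u∈' with mid-path i | mid-path j
  ... | inj₁ (_ , eq) | _ = case subst (_ ∈_) eq u∈ of λ ()
  ... | inj₂ _ | inj₁ (_ , eq) = case subst (_ ∈_) eq u∈' of λ ()
  ... | inj₂ (_ , c , _) | inj₂ (_ , c' , _) = start-injective (chains-disjoint (x-start i) c c' u∈ u∈')

  mids-distinct : ∀ {i j} → mid i ≡ mid j → i ≡ j
  mids-distinct {i} {j} eq with mid-path i | mid-path j
  ... | inj₁ (p , _) | inj₁ (q , _) = start-injective (trans p (sym q))
  ... | inj₂ (_ , c , _) | _ = mids-meet {i} (chain-head c) (subst (_ ∈_) eq (chain-head c))
  ... | inj₁ _ | inj₂ (_ , c , _) = mids-meet {i} {j} (subst (_ ∈_) (sym eq) (chain-head c)) (chain-head c)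

  -- The set of missed vertices can be left only through `y`, so it has at most one element, which
  -- would have no neighbour but `y`.
  covered : ∀ {u} → u ≢ x → u ≢ y → ∃[ i ] u ∈ mid i
  covered {u₀} u₀x u₀y with Fin.any? (λ i → u₀ ∈? mid i)
  ... | yes found = found
  ... | no none = ⊥-elim (absurd (degree2 u₀x u₀y))
    where
    Missed : Fin n → Set
    Missed u = u ≢ x × u ≢ y × ¬ (∃[ i ] u ∈ mid i)
    missed? : ∀ u → Dec (Missed u)
    missed? u = ¬? (u ≟ x) ×-dec (¬? (u ≟ y) ×-dec ¬? (Fin.any? λ i → u ∈? mid i))
    not-next-to-x : ∀ {u} → Missed u → ¬ Adj H u x
    not-next-to-x (ux , uy , u∉) adj-ux with at-start (symm adj-ux)
    ... | i , refl with mid-path i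
    ...   | inj₁ (u≡y , _) = uy u≡y
    ...   | inj₂ (_ , c , _) = u∉ (i , chain-head c)
    stays : ∀ {u z} → Missed u → Adj H u z → z ≢ y → Missed z
    stays m@(ux , uy , u∉) uz z≢y = (λ { refl → not-next-to-x m uz }) , z≢y , λ (i , z∈) → back i z∈ (mid-path i)
      where
      back : ∀ i → _ ∈ mid i → Path (start i) (mid i) → ⊥
      back i z∈ (inj₁ (_ , eq)) = case subst (_ ∈_) eq z∈ of λ ()
      back i z∈ (inj₂ (_ , c , _)) with chain-closed c z∈ (symm uz)
      ... | inj₁ u∈ = u∉ (i , u∈)
      ... | inj₂ (inj₁ u≡x) = ux u≡x
      ... | inj₂ (inj₂ u≡y) = uy u≡y
    P : Fin n → Bool
    P u = does (missed? u)
    P-true : ∀ {u} → P u ≡ true → Missed u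
    P-true {u} Pu = decidable-stable (missed? u) λ ¬m → true≢false (trans (sym Pu) (dec-false (missed? u) ¬m))
    P-false : ∀ {u} → P u ≡ false → ¬ Missed u
    P-false {u} Pu m = true≢false (trans (sym (dec-true (missed? u) m)) Pu)
    exit : ∀ {u z} → P u ≡ true → P z ≡ false → z ≢ y → adj H u z ≡ false
    exit Pu Pz z≢y = 𝔹.¬-not λ uz → P-false Pz (stays (P-true Pu) uz z≢y)
    one : AtMostOne (λ u → P u ≡ true)
    one = on-line⇒small false 𝔹._≟_ (λ u → adj H u y) P
      (λ {u} {z} Pu Pz uy → value-at (adj H u) uy (exit Pu Pz))
      (λ {u} {u'} {z} Pu Pu' Pz eq → by-cases {P = λ z → adj H u z ≡ adj H u' z} eq λ zy → trans (exit Pu Pz zy) (sym (exit Pu' Pz zy)))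
      (λ _ _ → ≢false⇒≡)
      (x , y , x≢y , dec-false (missed? x) (λ m → proj₁ m refl) , dec-false (missed? y) (λ m → proj₁ (proj₂ m) refl))
    missed : Missed u₀
    missed = u₀x , u₀y , none
    alone : ∀ {z} → Adj H u₀ z → z ≡ y
    alone {z} uz = decidable-stable (z ≟ y) λ z≢y → adj⇒≢ H uz
      (one u₀ z (dec-true (missed? u₀) missed) (dec-true (missed? z) (stays missed uz z≢y)))
    absurd : Degree2 H u₀ → ⊥
    absurd (a , b , a≢b , ua , ub , _) = a≢b (trans (alone ua) (sym (alone ub)))

  some-path : Fin k
  some-path = Fin.fromℕ< (ℕ.≤-trans (s≤s z≤n) 2≤k)

  on-path : ∀ u → ∃[ i ] u ∈ pathSeq x y (mid i)
  on-path u = case u ≟ x of λ where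
    (yes refl) → some-path , here refl
    (no ux) → case u ≟ y of λ where
      (yes refl) → some-path , there (∈-++⁺ʳ (mid some-path) (here refl))
      (no uy) → let i , u∈ = covered ux uy in i , there (∈-++⁺ˡ u∈)

  inner-edge : ∀ {u v} → u ≢ x → u ≢ y → Adj H u v →
    ∃[ i ] (Consecutive u v (pathSeq x y (mid i)) ⊎ Consecutive v u (pathSeq x y (mid i)))
  inner-edge ux uy uv with covered ux uy
  ... | i , u∈ with mid-path i
  ...   | inj₁ (_ , eq) = case subst (_ ∈_) eq u∈ of λ ()
  ...   | inj₂ (_ , c , _) = i , chain-consecutive c u∈ uv

  xy-edge : Adj H x y → ∃[ i ] Consecutive x y (pathSeq x y (mid i))
  xy-edge xy with at-start xy
  ... | i , y≡ with mid-path i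
  ...   | inj₁ (_ , eq) = i , [] , [] , cong (λ l → x ∷ l ++ y ∷ []) eq
  ...   | inj₂ (neq , _) = ⊥-elim (neq (sym y≡))

  edge : ∀ u v → Adj H u v → ∃[ i ] (Consecutive u v (pathSeq x y (mid i)) ⊎ Consecutive v u (pathSeq x y (mid i)))
  edge u v uv = go (u ≟ x) (u ≟ y) (v ≟ x) (v ≟ y)
    where
    turn : ∃[ i ] (Consecutive v u (pathSeq x y (mid i)) ⊎ Consecutive u v (pathSeq x y (mid i))) →
      ∃[ i ] (Consecutive u v (pathSeq x y (mid i)) ⊎ Consecutive v u (pathSeq x y (mid i)))
    turn (i , c) = i , swap c
    go : Dec (u ≡ x) → Dec (u ≡ y) → Dec (v ≡ x) → Dec (v ≡ y) →
      ∃[ i ] (Consecutive u v (pathSeq x y (mid i)) ⊎ Consecutive v u (pathSeq x y (mid i)))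
    go (no ux) (no uy) _ _ = inner-edge ux uy uv
    go _ _ (no vx) (no vy) = turn (inner-edge vx vy (symm uv))
    go (yes refl) _ (yes refl) _ = ⊥-elim (adj⇒≢ H uv refl)
    go (yes refl) _ _ (yes refl) = let i , c = xy-edge uv in i , inj₁ c
    go _ (yes refl) (yes refl) _ = let i , c = xy-edge (symm uv) in i , inj₂ c
    go _ (yes refl) _ (yes refl) = ⊥-elim (adj⇒≢ H uv refl)

  path-union : PathUnion H x y
  path-union = x≢y , k , 2≤k , mid , is-path , (λ i j i≢j → (λ eq → i≢j (mids-distinct eq)) , λ u u∈ u∈' → i≢j (mids-meet u∈ u∈')) ,
    on-path , edge , proj₂ (proj₂ theta)

-- The case of five vertices

module FiveVertices {G : Graph 5} (prime : Prime G) where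

  private
    5≤5 : 5 ≤ 5
    5≤5 = ℕ.≤-refl
  open PrimeGraph 5≤5 {G} prime
  open PrimeRows 5≤5 {G} prime
  open PrimeTriples 5≤5 {G} prime

  -- The rows of `a`, `b`, `c` towards the two remaining vertices are three vectors in F₂², hence
  -- dependent; the corresponding sum of stars is the triple.
  every-three : ∀ {a b c} d e → a ≢ b → a ≢ c → b ≢ c → (∀ {P : Fin 5 → Set} → P a → P b → P c → P d → P e → ∀ u → P u) →
    d ≢ a → d ≢ b → d ≢ c → e ≢ a → e ≢ b → e ≢ c → ∃[ f ] Triple G f a b c
  every-three {a} {b} {c} d e ab ac bc cover da db dc ea eb ec = dependence (row a ≟ᵖ 𝐈) (row b ≟ᵖ 𝐈) (row c ≟ᵖ 𝐈)
      (row a ≟ᵖ row b) (row a ≟ᵖ row c) (row b ≟ᵖ row c)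
    where
    row : Fin 5 → Pauli
    row v = adj G v d , adj G v e
    finish : ∀ {f} → L G f → S f d ≡ false → S f e ≡ false → (Z f d , Z f e) ≡ 𝐈 → ∀ v → S f v ≡ true → ∃[ f ] Triple G f a b c
    finish {f} f∈ Sd Se eq v Sv = f , to-triple ab ac bc f∈
      (λ {u} → cover {λ u → u ≢ a → u ≢ b → u ≢ c → f u ≡ 𝐈} (λ na _ _ → ⊥-elim (na refl)) (λ _ nb _ → ⊥-elim (nb refl)) (λ _ _ nc → ⊥-elim (nc refl))
        (λ _ _ _ → cong₂ _,_ Sd (cong proj₁ eq)) (λ _ _ _ → cong₂ _,_ Se (cong proj₂ eq)) u)
      {v} λ fv → true≢false (trans (sym Sv) (cong proj₁ fv))
    none : ∀ {u v} → u ≢ v → δ v u ≡ false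
    none uv = δ-≢ (uv ∘ sym)
    single : ∀ {v} → d ≢ v → e ≢ v → row v ≡ 𝐈 → ∃[ f ] Triple G f a b c
    single {v} dv ev eq = finish (L-star G v) (none dv) (none ev) eq v (δ-refl v)
    two : ∀ {v w} → v ≢ w → d ≢ v → e ≢ v → d ≢ w → e ≢ w → row v ≡ row w → ∃[ f ] Triple G f a b c
    two {v} {w} vw dv ev dw ew eq = finish (L-⊞ (L-star G v) (L-star G w)) (cong₂ _xor_ (none dv) (none dw)) (cong₂ _xor_ (none ev) (none ew))
      (trans (cong (row v ⊕_) (sym eq)) (⊕-self (row v))) v (cong₂ _xor_ (δ-refl v) (none vw))
    dependence : Dec (row a ≡ 𝐈) → Dec (row b ≡ 𝐈) → Dec (row c ≡ 𝐈) → Dec (row a ≡ row b) → Dec (row a ≡ row c) → Dec (row b ≡ row c) →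
      ∃[ f ] Triple G f a b c
    dependence (yes eq) _ _ _ _ _ = single da ea eq
    dependence _ (yes eq) _ _ _ _ = single db eb eq
    dependence _ _ (yes eq) _ _ _ = single dc ec eq
    dependence _ _ _ (yes eq) _ _ = two ab da ea db eb eq
    dependence _ _ _ _ (yes eq) _ = two ac da ea dc ec eq
    dependence _ _ _ _ _ (yes eq) = two bc db eb dc ec eq
    dependence (no na) (no nb) (no nc) (no nab) (no nac) (no nbc) = finish (L-⊞ (L-⊞ (L-star G a) (L-star G b)) (L-star G c))
      (cong₂ _xor_ (cong₂ _xor_ (none da) (none db)) (none dc)) (cong₂ _xor_ (cong₂ _xor_ (none ea) (none eb)) (none ec))
      (⊕-distinct (row a) (row b) (row c) na nb nc nab nac nbc) a (cong₂ _xor_ (cong₂ _xor_ (δ-refl a) (none ab)) (none ac))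

  -- The triples on three consecutive vertices are made the stars of `1F`, `2F` and `3F`; the graph
  -- is then a path from `0F` to `4F`, up to the edge between its ends.
  theta : HasTheta G
  theta = us , 0F , 4F , (λ ()) , degree2 , common
    where
    T₁ = every-three {0F} {1F} {2F} 3F 4F (λ ()) (λ ()) (λ ()) (λ p q r s t → λ { 0F → p ; 1F → q ; 2F → r ; 3F → s ; 4F → t })
      (λ ()) (λ ()) (λ ()) (λ ()) (λ ()) (λ ())
    T₂ = every-three {1F} {2F} {3F} 0F 4F (λ ()) (λ ()) (λ ()) (λ p q r s t → λ { 0F → s ; 1F → p ; 2F → q ; 3F → r ; 4F → t })
      (λ ()) (λ ()) (λ ()) (λ ()) (λ ()) (λ ())
    T₃ = every-three {2F} {3F} {4F} 0F 1F (λ ()) (λ ()) (λ ()) (λ p q r s t → λ { 0F → s ; 1F → t ; 2F → p ; 3F → q ; 4F → r })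
      (λ ()) (λ ()) (λ ()) (λ ()) (λ ()) (λ ())
    f₁ = proj₁ T₁
    f₂ = proj₁ T₂
    f₃ = proj₁ T₃
    t₁ = proj₂ T₁
    t₂ = proj₂ T₂
    t₃ = proj₂ T₃
    f₁≢f₂ : f₁ 1F ≢ f₂ 1F
    f₁≢f₂ = share⇒differ (rotˡ t₁) (t₂) (λ ())
    f₂≢f₁ : f₂ 2F ≢ f₁ 2F
    f₂≢f₁ = share⇒differ (swap₁₂ t₂) (swap₁₂ (rotˡ t₁)) (λ ())
    f₃≢f₂ : f₃ 3F ≢ f₂ 3F
    f₃≢f₂ = share⇒differ (swap₁₂ t₃) (swap₁₃ t₂) (λ ())
    -- With different directions the two triples would have a second vertex in common.
    f₁≡f₃ : f₁ 2F ≡ f₃ 2F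
    f₁≡f₃ = decidable-stable (f₁ 2F ≟ᵖ f₃ 2F) λ neq → case cross (rotʳ t₁) t₃ neq of λ where
      (inj₁ (_ , s , _)) → at₂ s (off t₃ (λ ()) (λ ()) (λ ()))
      (inj₂ (_ , s , _)) → at₂ s (off t₃ (λ ()) (λ ()) (λ ()))
    framed = frame G ((0F , f₁ 0F) ∷ (1F , f₂ 1F) ∷ (2F , f₁ 2F) ∷ (3F , f₂ 3F) ∷ (4F , f₃ 4F) ∷ [])
      (((λ ()) ∷ (λ ()) ∷ (λ ()) ∷ (λ ()) ∷ []) ∷ ((λ ()) ∷ (λ ()) ∷ (λ ()) ∷ []) ∷ ((λ ()) ∷ (λ ()) ∷ []) ∷ ((λ ()) ∷ []) ∷ [] ∷ [])
      (at₁ t₁ ∷ at₁ t₂ ∷ at₃ t₁ ∷ at₃ t₂ ∷ at₃ t₃ ∷ [])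
      λ { {f} f∈ _ (e₀ ∷ e₁ ∷ e₂ ∷ e₃ ∷ e₄ ∷ []) →
        let z₁ = blocked (swap₁₂ t₁) f∈ (at₁ t₂) f₁≢f₂ e₁ e₀ e₂
            z₂ = blocked (swap₁₂ t₂) f∈ (at₃ t₁) f₂≢f₁ e₂ e₁ e₃
            z₃ = blocked (swap₁₂ t₃) f∈ (at₃ t₂) f₃≢f₂ e₃ ([ inj₁ , (λ eq → inj₂ (trans eq f₁≡f₃)) ]′ e₂) e₄
        in weight>2 {a = 0F} {4F} (λ ()) f∈ λ { {0F} n₀ _ → ⊥-elim (n₀ refl) ; {1F} _ _ → z₁ ; {2F} _ _ → z₂ ; {3F} _ _ → z₃ ; {4F} _ n₄ → ⊥-elim (n₄ refl) } }
    us = proj₁ framed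
    H = G ⋆ us
    𝐙₀ = All.head (proj₂ framed)
    𝐙₁ = All.head (All.tail (proj₂ framed))
    𝐙₂ = All.head (All.tail (All.tail (proj₂ framed)))
    𝐙₃ = All.head (All.tail (All.tail (All.tail (proj₂ framed))))
    𝐙₄ = All.head (All.tail (All.tail (All.tail (All.tail (proj₂ framed)))))
    nb₁ : Neighbours H 1F 0F 2F
    nb₁ = rotated-centre us (swap₁₂ t₁) 𝐙₁ f₁≢f₂ 𝐙₀ 𝐙₂
    nb₂ : Neighbours H 2F 1F 3F
    nb₂ = rotated-centre us (swap₁₂ t₂) 𝐙₂ f₂≢f₁ 𝐙₁ 𝐙₃
    nb₃ : Neighbours H 3F 2F 4F
    nb₃ = rotated-centre us (swap₁₂ t₃) 𝐙₃ f₃≢f₂ (trans (cong (τ* G us 2F) (sym f₁≡f₃)) 𝐙₂) 𝐙₄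
    degree2 : ∀ {v} → v ≢ 0F → v ≢ 4F → Degree2 H v
    degree2 {0F} n₀ _ = ⊥-elim (n₀ refl)
    degree2 {1F} _ _ = 0F , 2F , (λ ()) , nb₁
    degree2 {2F} _ _ = 1F , 3F , (λ ()) , nb₂
    degree2 {3F} _ _ = 2F , 4F , (λ ()) , nb₃
    degree2 {4F} _ n₄ = ⊥-elim (n₄ refl)
    refute : ∀ {u v} → adj H v u ≡ false → Adj H u v → ⊥
    refute {u} {v} vu uv = true≢false (trans (sym uv) (trans (adj-sym H u v) vu))
    common : ∀ z → Adj H 0F z → Adj H 4F z → ⊥
    common 0F p _ = adj⇒≢ H p refl
    common 1F _ q = refute (proj₂ (proj₂ nb₁) (λ ()) (λ ())) q
    common 2F p _ = refute (proj₂ (proj₂ nb₂) (λ ()) (λ ())) p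
    common 3F p _ = refute (proj₂ (proj₂ nb₃) (λ ()) (λ ())) p
    common 4F _ q = adj⇒≢ H q refl

-- From few non-essential vertices to a union of paths

theta-⋆ : (us : List (Fin n)) {G : Graph n} → HasTheta (G ⋆ us) → HasTheta G
theta-⋆ us {G} (ws , θ) = us ++ ws , subst (λ K → ∃₂ λ x y → Theta K x y) (sym (⋆-++ G us ws)) θ

-- Of two distinct bad directions at most one is X in the rotated graph; the other is Z or Y.
essential⇒cut : {G : Graph n} {v : Fin n} → Essential G v → (us : List (Fin n)) → Cut (G ⋆ us) (_≡ v) ⊎ Cut (G ⋆ us * v) (_≡ v)
essential⇒cut {G = G} {v} (p , q , p≢q , p≢𝐈 , q≢𝐈 , bad-p , bad-q) us = by-direction (τ* G us v p) (τ* G us v q) refl refl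
  where
  in-𝐘 : ∀ {r} → Bad G v r → τ* G us v r ≡ 𝐘 → Cut (G ⋆ us * v) (_≡ v)
  in-𝐘 bad eq = subst (λ K → Cut K (_≡ v)) (⋆-++ G us (v ∷ []))
    (bad⇒cut bad (us ++ v ∷ []) (trans (τ*-++ G us (v ∷ []) v _) (trans (cong (τ (G ⋆ us) v v) eq) (τ-𝐘 (G ⋆ us) v))))
  by-direction : ∀ r r' → τ* G us v p ≡ r → τ* G us v q ≡ r' → Cut (G ⋆ us) (_≡ v) ⊎ Cut (G ⋆ us * v) (_≡ v)
  by-direction 𝐙 _ eq _ = inj₁ (bad⇒cut bad-p us eq)
  by-direction 𝐘 _ eq _ = inj₂ (in-𝐘 bad-p eq)
  by-direction 𝐈 _ eq _ = ⊥-elim (τ*-≢𝐈 us p≢𝐈 eq)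
  by-direction 𝐗 𝐙 _ eq' = inj₁ (bad⇒cut bad-q us eq')
  by-direction 𝐗 𝐘 _ eq' = inj₂ (in-𝐘 bad-q eq')
  by-direction 𝐗 𝐈 _ eq' = ⊥-elim (τ*-≢𝐈 us q≢𝐈 eq')
  by-direction 𝐗 𝐗 eq eq' = ⊥-elim (p≢q (τ*-injective G us v (trans eq (sym eq'))))

-- When there are fewer than two non-essential vertices, arbitrary ones fill the places.
two-ends : 5 ≤ n → {G : Graph n} → ¬ AtLeastThreeNonEssential G →
  M (∃₂ λ x y → x ≢ y × (∀ v → v ≢ x → v ≢ y → ¬ NonEssential G v))
two-ends {n} 5≤n {G} few = do
    yes (x , ne-x) ← excluded-middle (∃[ x ] NonEssential G x)
      where no none → let u , v , u≢v , _ = two-fresh [] (ℕ.≤-trans (s≤s (s≤s z≤n)) 5≤n) in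
                      return (u , v , u≢v , λ _ _ _ ne → none (_ , ne))
    yes (y , x≢y , ne-y) ← excluded-middle (∃[ y ] x ≢ y × NonEssential G y)
      where no none → let v , v∉ = fresh (x ∷ []) (ℕ.≤-trans (s≤s (s≤s z≤n)) 5≤n) in
                      return (x , v , (λ eq → v∉ (here (sym eq))) , λ _ ux _ ne → none (_ , ux ∘ sym , ne))
    return (x , y , x≢y , λ _ ux uy ne → few (x , y , _ , x≢y , ux ∘ sym , uy ∘ sym , ne-x , ne-y , ne))

few-nonessential⇒theta : 5 ≤ n → {G : Graph n} → Prime G → ¬ AtLeastThreeNonEssential G → M (HasTheta G)
few-nonessential⇒theta {n} 5≤n {G} prime few no-theta with ℕ.m≤n⇒m<n∨m≡n 5≤n
... | inj₂ refl = no-theta (FiveVertices.theta prime)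
... | inj₁ 6≤n = two-ends 5≤n few λ (x , y , x≢y , ess) → at-ends x≢y (λ {v} → ess v)
  where
  essential : ∀ {v} → ¬ NonEssential G v → M (Essential G v)
  essential = ¬nonessential⇒essential 5≤n prime _
  ess⇒triple : ∀ {v} → ¬ NonEssential G v → M (∃[ d ] ∃₂ λ a b → Triple G d v a b)
  ess⇒triple ¬ne = do
    e ← essential ¬ne
    essential⇒triple 5≤n prime e
  ess-pair : ∀ {t a b c} → Triple G t a b c → ¬ NonEssential G a → ¬ NonEssential G b →
    M (∃[ d ] ∃₂ λ p q → Triple G d a p q × d a ≢ t a)
  ess-pair t ¬a ¬b = do
    ea ← essential ¬a
    eb ← essential ¬b
    triangle 5≤n prime t ea eb
  ess-shared : ∀ {t t' u u' a b} → Triple G t u a b → Triple G t' u' a b → u ≢ u' → ¬ NonEssential G u → M (Double G u)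
  ess-shared t t' u≢u' ¬u = do
    e ← essential ¬u
    return (shared-pair⇒double 5≤n prime t t' u≢u' e)
  at-ends : ∀ {x y} → x ≢ y → (∀ {v} → v ≢ x → v ≢ y → ¬ NonEssential G v) → ⊥
  at-ends {x} {y} x≢y ess = degree2-frame λ (us , degree2) → finish us degree2 (Fin.any? λ z → (adj (G ⋆ us) x z 𝔹.≟ true) ×-dec (adj (G ⋆ us) y z 𝔹.≟ true))
    where
    ends : ∀ {v} → ¬ ¬ NonEssential G v → v ≡ x ⊎ v ≡ y
    ends {v} ne = decidable-stable ((v ≟ x) ⊎-dec (v ≟ y)) λ neither → ne (ess (neither ∘ inj₁) (neither ∘ inj₂))
    open Chains 6≤n {G} prime no-theta (λ v → ¬ NonEssential G v) (double⇒¬nonessential 5≤n prime)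
      ess⇒triple ess-pair ess-shared x≢y ends using (degree2-frame)
    finish : ∀ us → (∀ {v} → v ≢ x → v ≢ y → Degree2 (G ⋆ us) v) → Dec (∃[ z ] Adj (G ⋆ us) x z × Adj (G ⋆ us) y z) → ⊥
    finish us degree2 (no none) = no-theta (us , x , y , x≢y , degree2 , λ z xz yz → none (z , xz , yz))
    finish us degree2 (yes (z , xz , yz)) = essential (ess (adj⇒≢ (G ⋆ us) xz ∘ sym) (adj⇒≢ (G ⋆ us) yz ∘ sym)) λ e →
      no-theta (theta-⋆ us (common-neighbour⇒theta 6≤n {G ⋆ us} (prime-⋆ us {G} prime) x≢y degree2 xz yz (essential⇒cut e us)))

-- The converse: a union of paths has few non-essential vertices

locEq⇒⋆ : {G H : Graph n} → LocEq G H → ∃[ us ] SameGraph (G ⋆ us) H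
locEq⇒⋆ (done same) = [] , same
locEq⇒⋆ (step v e) = let us , same = locEq⇒⋆ e in v ∷ us , same

unique-split : ∀ as cs {bs ds : List A} {v} → Unique (as ++ v ∷ bs) → as ++ v ∷ bs ≡ cs ++ v ∷ ds → as ≡ cs × bs ≡ ds
unique-split [] [] _ refl = refl , refl
unique-split [] (c ∷ cs) (v∉ ∷ _) refl = ⊥-elim (All.lookup v∉ (∈-++⁺ʳ cs (here refl)) refl)
unique-split (a ∷ as) [] (a∉ ∷ _) refl = ⊥-elim (All.lookup a∉ (∈-++⁺ʳ as (here refl)) refl)
unique-split (a ∷ as) (c ∷ cs) (_ ∷ unique) eq =
  let as≡ , bs≡ = unique-split as cs unique (∷-injectiveʳ eq) in cong₂ _∷_ (∷-injectiveˡ eq) as≡ , bs≡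

consecutive-cong : ∀ {u v} {p q : List (Fin n)} → p ≡ q → Consecutive u v p → Consecutive u v q
consecutive-cong refl c = c

module PathUnionDegrees {H : Graph n} {x y : Fin n} (pu : PathUnion H x y) where

  private
    k = proj₁ (proj₂ pu)
    mid = proj₁ (proj₂ (proj₂ (proj₂ pu)))
    conditions = proj₂ (proj₂ (proj₂ (proj₂ pu)))
    is-path : ∀ i → IsPath H (pathSeq x y (mid i))
    is-path = proj₁ conditions
    disjoint = proj₁ (proj₂ conditions)
    cover : ∀ u → ∃[ i ] u ∈ pathSeq x y (mid i)
    cover = proj₁ (proj₂ (proj₂ conditions))
    edges = proj₁ (proj₂ (proj₂ (proj₂ conditions)))

  no-common-neighbour : ∀ z → Adj H x z → Adj H y z → ⊥
  no-common-neighbour = proj₂ (proj₂ (proj₂ (proj₂ conditions)))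

  inner : ∀ {v i} → v ≢ x → v ≢ y → v ∈ pathSeq x y (mid i) → v ∈ mid i
  inner vx vy (here v≡x) = ⊥-elim (vx v≡x)
  inner {i = i} vx vy (there v∈) with ∈-++⁻ (mid i) v∈
  ... | inj₁ v∈mid = v∈mid
  ... | inj₂ (here v≡y) = ⊥-elim (vy v≡y)

  surrounded : ∀ a (as bs : List (Fin n)) z v → ∃₂ λ cs p → ∃₂ λ q ds → a ∷ (as ++ v ∷ bs) ++ z ∷ [] ≡ cs ++ p ∷ v ∷ q ∷ ds
  surrounded a [] [] z v = [] , a , z , [] , refl
  surrounded a [] (b ∷ bs) z v = [] , a , b , bs ++ z ∷ [] , refl
  surrounded a (a' ∷ as) bs z v = let cs , p , q , ds , eq = surrounded a' as bs z v in a ∷ cs , p , q , ds , cong (a ∷_) eq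

  linked-at : ∀ cs {p v q ds} → Linked (Adj H) (cs ++ p ∷ v ∷ q ∷ ds) → Adj H p v × Adj H v q
  linked-at [] (pv ∷ vq ∷ _) = pv , vq
  linked-at (_ ∷ []) (_ ∷ l) = linked-at [] l
  linked-at (_ ∷ c ∷ cs) (_ ∷ l) = linked-at (c ∷ cs) l

  unique-at : ∀ cs {p v q : Fin n} {ds} → Unique (cs ++ p ∷ v ∷ q ∷ ds) → p ≢ q
  unique-at [] ((_ ∷ p≢q ∷ _) ∷ _) = p≢q
  unique-at (_ ∷ cs) (_ ∷ unique) = unique-at cs unique

  -- An inner vertex occurs once and on one path only, and every edge is consecutive on some path;
  -- so its neighbours are its predecessor and its successor there.
  degree2 : ∀ {v} → v ≢ x → v ≢ y → Degree2 H v
  degree2 {v} vx vy with cover v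
  ... | i , v∈ with ∈-∃++ (inner {i = i} vx vy v∈)
  ...   | as , bs , eq with surrounded x as bs y v
  ...     | cs , p , q , ds , eq′ = p , q , unique-at cs unique , trans (adj-sym H v p) (proj₁ adjacent) , proj₂ adjacent , none
    where
    whole : pathSeq x y (mid i) ≡ cs ++ p ∷ v ∷ q ∷ ds
    whole = trans (cong (λ l → x ∷ l ++ y ∷ []) eq) eq′
    unique : Unique (cs ++ p ∷ v ∷ q ∷ ds)
    unique = subst Unique whole (proj₁ (is-path i))
    adjacent = linked-at cs (subst (Linked (Adj H)) whole (proj₂ (is-path i)))
    regroup : (cs ++ p ∷ []) ++ v ∷ q ∷ ds ≡ cs ++ p ∷ v ∷ q ∷ ds
    regroup = ++-assoc cs (p ∷ []) (v ∷ q ∷ ds)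
    same-path : ∀ {j} → v ∈ pathSeq x y (mid j) → pathSeq x y (mid j) ≡ cs ++ p ∷ v ∷ q ∷ ds
    same-path {j} v∈j with j ≟ i
    ... | yes refl = whole
    ... | no j≢i = ⊥-elim (proj₂ (disjoint j i j≢i) v (inner {i = j} vx vy v∈j) (inner {i = i} vx vy v∈))
    next : ∀ {z} → Consecutive v z (cs ++ p ∷ v ∷ q ∷ ds) → z ≡ q
    next (es , fs , e) = sym (∷-injectiveˡ (proj₂ (unique-split (cs ++ p ∷ []) es (subst Unique (sym regroup) unique) (trans regroup e))))
    previous : ∀ {z} → Consecutive z v (cs ++ p ∷ v ∷ q ∷ ds) → z ≡ p
    previous {z} (es , fs , e) = sym (∷ʳ-injectiveʳ cs es (proj₁ (unique-split (cs ++ p ∷ []) (es ++ z ∷ [])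
      (subst Unique (sym regroup) unique) (trans regroup (trans e (sym (++-assoc es (z ∷ []) (v ∷ fs))))))))
    none : ∀ {u} → u ≢ p → u ≢ q → adj H v u ≡ false
    none {u} up uq = 𝔹.¬-not λ vu → case edges v u vu of λ where
      (j , inj₁ c@(es , fs , e)) → uq (next (consecutive-cong (same-path {j} (subst (v ∈_) (sym e) (∈-++⁺ʳ es (here refl)))) c))
      (j , inj₂ c@(es , fs , e)) → up (previous (consecutive-cong (same-path {j} (subst (v ∈_) (sym e) (∈-++⁺ʳ es (there (here refl))))) c))

star-triple : {H : Graph n} → ∀ {v p q} → p ≢ q → Neighbours H v p q → Triple H (star H v) v p q
star-triple {H = H} {v} p≢q (vp , vq , none) = triple (adj⇒≢ H vp) (adj⇒≢ H vq) p≢q (L-star H v)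
  (λ eq → true≢false (trans (sym (δ-refl v)) (cong proj₁ eq)))
  (λ eq → true≢false (trans (sym vp) (cong proj₂ eq)))
  (λ eq → true≢false (trans (sym vq) (cong proj₂ eq)))
  (λ uv up uq → cong₂ _,_ (δ-≢ (uv ∘ sym)) (none up uq))

-- The two triples are the stars of v and u.
adjacent-degree2⇒double : {H : Graph n} → ∀ {v u} → Degree2 H v → Degree2 H u → Adj H v u → Double H v
adjacent-degree2⇒double {H = H} {v} {u} (p , q , p≢q , nb) deg-u vu with other-neighbour {H = H} deg-u (trans (adj-sym H u v) vu)
... | r , v≢r , nb-u = star H v , star H u , (_ , _ , star-triple p≢q nb) , (_ , _ , swap₁₂ (star-triple v≢r nb-u)) ,
  λ eq → true≢false (trans (sym (δ-refl v)) (trans (cong proj₁ eq) (δ-≢ (adj⇒≢ H vu ∘ sym))))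

double-⋆⁻¹ : {G : Graph n} (us : List (Fin n)) → ∀ {v} → Double (G ⋆ us) v → Double G v
double-⋆⁻¹ {G = G} us {v} (_ , _ , (_ , _ , t) , (_ , _ , t') , neq) =
  _ , _ , (_ , _ , triple-τ*⁻¹ us t) , (_ , _ , triple-τ*⁻¹ us t') , neq ∘ τ*⁻¹-injective G us v

-- As `x` and `y` have no common neighbour, one of the two neighbours of `v` is neither of them and
-- has degree 2 itself.
theta-interior⇒essential : 5 ≤ n → {G : Graph n} → Prime G → (us : List (Fin n)) → ∀ {x y} →
  (∀ {v} → v ≢ x → v ≢ y → Degree2 (G ⋆ us) v) → (∀ z → Adj (G ⋆ us) x z → Adj (G ⋆ us) y z → ⊥) →
  ∀ {v} → v ≢ x → v ≢ y → ¬ NonEssential G v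
theta-interior⇒essential 5≤n {G} prime us {x} {y} degree2 no-common {v} vx vy with degree2 vx vy
... | deg@(p , q , p≢q , vp , vq , none) = double⇒¬nonessential 5≤n prime (double-⋆⁻¹ us (by-ends (p ≟ x) (p ≟ y) (q ≟ x) (q ≟ y)))
  where
  H = G ⋆ us
  symm : ∀ {u} → Adj H v u → Adj H u v
  symm {u} vu = trans (adj-sym H u v) vu
  by-ends : Dec (p ≡ x) → Dec (p ≡ y) → Dec (q ≡ x) → Dec (q ≡ y) → Double H v
  by-ends (no px) (no py) _ _ = adjacent-degree2⇒double deg (degree2 px py) vp
  by-ends _ _ (no qx) (no qy) = adjacent-degree2⇒double deg (degree2 qx qy) vq
  by-ends (yes refl) _ (yes refl) _ = ⊥-elim (p≢q refl)
  by-ends _ (yes refl) _ (yes refl) = ⊥-elim (p≢q refl)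
  by-ends (yes refl) _ _ (yes refl) = ⊥-elim (no-common v (symm vp) (symm vq))
  by-ends _ (yes refl) (yes refl) _ = ⊥-elim (no-common v (symm vq) (symm vp))

path-union⇒few-nonessential : 5 ≤ n → {G : Graph n} → Prime G → ∀ {H x y} → LocEq G H → PathUnion H x y → ¬ AtLeastThreeNonEssential G
path-union⇒few-nonessential 5≤n {G} prime {H} {x} {y} e pu (a , b , c , a≢b , a≢c , b≢c , ne-a , ne-b , ne-c) with locEq⇒⋆ e
... | us , same = pigeonhole a≢b a≢c b≢c (end ne-a) (end ne-b) (end ne-c)
  where
  open PathUnionDegrees {H = H} pu
  move : ∀ {v} → Degree2 H v → Degree2 (G ⋆ us) v
  move (p , q , p≢q , vp , vq , none) = p , q , p≢q , trans (same _ _) vp , trans (same _ _) vq , λ up uq → trans (same _ _) (none up uq)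
  essential : ∀ {v} → v ≢ x → v ≢ y → ¬ NonEssential G v
  essential = theta-interior⇒essential 5≤n prime us (λ vx vy → move (degree2 vx vy))
    λ z xz yz → no-common-neighbour z (trans (sym (same _ _)) xz) (trans (sym (same _ _)) yz)
  end : ∀ {v} → NonEssential G v → v ≡ x ⊎ v ≡ y
  end {v} ne = decidable-stable ((v ≟ x) ⊎-dec (v ≟ y)) λ neither → essential (neither ∘ inj₁) (neither ∘ inj₂) ne

-- Decidability of the conclusion

two? : {P : Fin n → Set} → (∀ u → Dec (P u)) → Dec (Two P)
two? P? = Fin.any? λ a → Fin.any? λ b → ¬? (a ≟ b) ×-dec (P? a ×-dec P? b)

IsCut : Graph n → (A α β : Fin n → Bool) → Set
IsCut G A α β = Two (λ u → A u ≡ true) × Two (λ u → A u ≡ false) ×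
  (∀ x y → A x ≡ true → A y ≡ false → adj G x y ≡ α x ∧ β y)

isCut? : (G : Graph n) (A α β : Fin n → Bool) → Dec (IsCut G A α β)
isCut? G A α β = two? (λ u → A u 𝔹.≟ true) ×-dec (two? (λ u → A u 𝔹.≟ false) ×-dec
  Fin.all? λ x → Fin.all? λ y → (A x 𝔹.≟ true) →-dec ((A y 𝔹.≟ false) →-dec (adj G x y 𝔹.≟ α x ∧ β y)))

isCut-cong : (G : Graph n) {A A' α α' β β' : Fin n → Bool} → A ≗ A' → α ≗ α' → β ≗ β' → IsCut G A α β → IsCut G A' α' β'
isCut-cong G A≗ α≗ β≗ (l , r , rk) = two-map (trans (sym (A≗ _))) l , two-map (trans (sym (A≗ _))) r ,
  λ x y sx sy → trans (rk x y (trans (A≗ x) sx) (trans (A≗ y) sy)) (cong₂ _∧_ (α≗ x) (β≗ y))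

-- The side and both coefficient functions range over finitely many bit vectors; a function agrees
-- with its tabulation only pointwise, hence `isCut-cong`.
split? : (G : Graph n) → Dec (Split G)
split? G = map′ to from (anySubset? λ A → anySubset? λ α → anySubset? λ β → isCut? G (Vec.lookup A) (Vec.lookup α) (Vec.lookup β))
  where
  to : (∃[ A ] ∃₂ λ α β → IsCut G (Vec.lookup A) (Vec.lookup α) (Vec.lookup β)) → Split G
  to (A , α , β , l , r , rk) = cut⇒split {G = G} (cut (Vec.lookup A) (two-map (id ,_) l) (two-map (id ,_) r) (Vec.lookup α) (Vec.lookup β) λ {x} {y} _ _ → rk x y)
  from : Split G → ∃[ A ] ∃₂ λ α β → IsCut G (Vec.lookup A) (Vec.lookup α) (Vec.lookup β)
  from s = Vec.tabulate side , Vec.tabulate α , Vec.tabulate β ,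
      isCut-cong G (sym ∘ Vec.lookup∘tabulate side) (sym ∘ Vec.lookup∘tabulate α) (sym ∘ Vec.lookup∘tabulate β)
        (two-map proj₂ left , two-map proj₂ right , λ x y → rank1 id id)
    where open Cut (split⇒cut {G = G} s)

nonessential? : (G : Graph n) (v : Fin n) → Dec (NonEssential G v)
nonessential? {suc n} G v = (z? ×-dec y?) ⊎-dec ((z? ×-dec x?) ⊎-dec (y? ×-dec x?))
  where
  z? = ¬? (split? (delete G v))
  y? = ¬? (split? (delete (G * v) v))
  x? : Dec (ContractPrime G v)
  x? = (Fin.all? (λ u → adj G v u 𝔹.≟ false) ×-dec z?) ⊎-dec
       Fin.any? (λ w → (adj G v w 𝔹.≟ true) ×-dec ¬? (split? (delete (pivot G v w) v)))

three-nonessential? : (G : Graph n) → Dec (AtLeastThreeNonEssential G)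
three-nonessential? G = Fin.any? λ a → Fin.any? λ b → Fin.any? λ c → ¬? (a ≟ b) ×-dec (¬? (a ≟ c) ×-dec (¬? (b ≟ c) ×-dec
  (nonessential? G a ×-dec (nonessential? G b ×-dec nonessential? G c))))

theorem1p4 : ∀ (n : ℕ) (G : Graph n) → 5 ≤ n → Prime G →
    (AtLeastThreeNonEssential G ⇔
    (¬ (∃[ H ] ∃[ x ] ∃[ y ] (LocEq G H × PathUnion H x y))))
theorem1p4 n G 5≤n prime = mk⇔
  (λ three (H , x , y , e , pu) → path-union⇒few-nonessential 5≤n prime e pu three)
  λ no-path-union → decidable-stable (three-nonessential? G) λ few → few-nonessential⇒theta 5≤n prime few λ (us , x , y , θ) →
    no-path-union (G ⋆ us , x , y , locEq-⋆ us G , ThetaPaths.path-union 5≤n {G ⋆ us} (prime-⋆ us {G} prime) θ)
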